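{- Fix an integer $j\ge 2$ and a real number $c>0$. The distribution of the number of $j$-cycles of the permutation in $S_n$ obtained after multiplying $\lfloor cn\rfloor$ independent random star transpositions, starting from the identity, converges to the Poisson$\left(\frac1j\left(1-e^{ -jc}\right)\right)$ distribution as $n\to\infty$.
   Context: The star transposition walk on $S_n$ is driven by the probability measure $Q$ on $S_n$ with $Q(\pi)=\frac1{n-1}$ if $\pi$ is one of the transpositions $(1\,i)$, $2\le i\le n$, and $Q(\pi)=0$ otherwise. At each step one moves from $g$ to $hg$ with $h$ sampled independently from $Q$; after $k$ steps started at the identity the law of the permutation is the $k$-fold convolution $Q^{*k}$. Convergence is convergence in distribution. -}

module Defs where

open import Data.Fin.Base as Fin using (Fin; toℕ)
import Data.Fin.Properties as Fin
open import Data.Fin.Permutation using (Permutation′; _⟨$⟩ʳ_; _∘ₚ_; transpose)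
import Data.Fin.Permutation as Perm
open import Data.Integer.Base as ℤ using (+_)
import Data.Integer.Properties as ℤ
open import Data.List.Base using (List; []; _∷_; map; filter; length; allFin; cartesianProductWith; foldr)
open import Data.Nat.Base as ℕ using (ℕ; zero; suc)
open import Data.Nat.GeneralisedArithmetic using (fold)
import Data.Nat.Properties as ℕ
open import Data.Product.Base using (∃; _×_; _,_)
open import Data.Rational.Base
  using (ℚ; mkℚ; 0ℚ; 1ℚ; ½; _+_; _*_; _-_; -_; _≤_; _<_; ∣_∣; _/_; 1/_; toℚᵘ; positive; nonNegative)
open import Data.Rational.Properties
open import Data.Rational.Solver using (module +-*-Solver)
import Data.Rational.Unnormalised.Base as ℚᵘ
import Data.Rational.Unnormalised.Properties as ℚᵘ
open import Relation.Nullary using (Dec)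
open import Relation.Nullary.Decidable using (_×-dec_; _→-dec_)
open import Relation.Unary using (Pred; Decidable)
open import Relation.Binary.PropositionalEquality
  using (_≡_; refl; sym; trans; cong; cong₂; subst; subst₂)

open +-*-Solver using (solve; _:+_; _:*_; _:-_; :-_; _:=_)

------------------------------------------------------------------------
-- Rational arithmetic

private

  half : ∀ ε → ε * ½ + ε * ½ ≡ ε
  half ε = trans (sym (*-distribˡ-+ ε ½ ½)) (*-identityʳ ε)

  *-pos : ∀ {p q} → 0ℚ < p → 0ℚ < q → 0ℚ < p * q
  *-pos {p} {q} 0<p 0<q =
    positive⁻¹ (p * q) {{pos*pos⇒pos p {{positive 0<p}} q {{positive 0<q}}}}

  *-nonNeg : ∀ {p q} → 0ℚ ≤ p → 0ℚ ≤ q → 0ℚ ≤ p * q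
  *-nonNeg {p} {q} 0≤p 0≤q = nonNegative⁻¹ (p * q)
    {{nonNeg*nonNeg⇒nonNeg p {{nonNegative 0≤p}} q {{nonNegative 0≤q}}}}

  half-pos : ∀ {ε} → 0ℚ < ε → 0ℚ < ε * ½
  half-pos 0<ε = *-pos 0<ε (positive⁻¹ ½)

  *-mono : ∀ {p q r s} → 0ℚ ≤ p → 0ℚ ≤ s → p ≤ q → r ≤ s → p * r ≤ q * s
  *-mono {p} {q} {r} {s} 0≤p 0≤s p≤q r≤s = ≤-trans
    (*-monoˡ-≤-nonNeg p {{nonNegative 0≤p}} r≤s)
    (*-monoʳ-≤-nonNeg s {{nonNegative 0≤s}} p≤q)

  divide : ∀ {B ε} → 0ℚ < B → 0ℚ < ε → ∃ λ δ → 0ℚ < δ × B * δ ≡ ε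
  divide {B} {ε} 0<B 0<ε = 1/B * ε , *-pos (positive⁻¹ 1/B {{1/pos⇒pos B}}) 0<ε ,
    trans (sym (*-assoc B 1/B ε)) (trans (cong (_* ε) (*-inverseʳ B)) (*-identityˡ ε))
    where
    instance
      B⁺ = positive 0<B
      B≢0 = pos⇒nonZero B
    1/B = 1/ B

  ∣-∣-swap : ∀ p q → ∣ p - q ∣ ≡ ∣ q - p ∣
  ∣-∣-swap p q = trans (sym (∣-p∣≡∣p∣ (p - q)))
    (cong ∣_∣ (solve 2 (λ p q → :- (p :- q) := q :- p) refl p q))

  triangle : ∀ p q r → ∣ p - r ∣ ≤ ∣ p - q ∣ + ∣ q - r ∣
  triangle p q r = subst (_≤ ∣ p - q ∣ + ∣ q - r ∣)
    (cong ∣_∣ (solve 3 (λ p q r → (p :- q) :+ (q :- r) := p :- r) refl p q r))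
    (∣p+q∣≤∣p∣+∣q∣ (p - q) (q - r))

  ∣*-*∣≤ : ∀ a b c d → ∣ a * b - c * d ∣ ≤ ∣ a ∣ * ∣ b - d ∣ + ∣ a - c ∣ * ∣ d ∣
  ∣*-*∣≤ a b c d = subst₂ _≤_
    (cong ∣_∣ (solve 4 (λ a b c d → a :* (b :- d) :+ (a :- c) :* d := a :* b :- c :* d) refl a b c d))
    (cong₂ _+_ (∣p*q∣≡∣p∣*∣q∣ a (b - d)) (∣p*q∣≡∣p∣*∣q∣ (a - c) d))
    (∣p+q∣≤∣p∣+∣q∣ (a * (b - d)) ((a - c) * d))

fromℕ : ℕ → ℚ
fromℕ n = + n / 1

private

  inv : ℕ → ℚ
  inv i = + 1 / suc i

  toℚᵘ-fromℕ : ∀ n → toℚᵘ (fromℕ n) ℚᵘ.≃ ℚᵘ.mkℚᵘ (+ n) 0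
  toℚᵘ-fromℕ n = toℚᵘ-fromℚᵘ (ℚᵘ.mkℚᵘ (+ n) 0)

  archimedean : ∀ q → ∃ λ n → q ≤ fromℕ n
  archimedean q@(mkℚ i d _) = ℤ.∣ i ∣ , toℚᵘ-cancel-≤
    (ℚᵘ.≤-respʳ-≃ (ℚᵘ.≃-sym (toℚᵘ-fromℕ ℤ.∣ i ∣)) (ℚᵘ.*≤* (bound i)))
    where
    bound : ∀ i → i ℤ.* + 1 ℤ.≤ + ℤ.∣ i ∣ ℤ.* + suc d
    bound (+ n) = subst₂ ℤ._≤_ (ℤ.pos-* n 1) (ℤ.pos-* n (suc d))
      (ℤ.+≤+ (ℕ.*-monoʳ-≤ n (ℕ.s≤s ℕ.z≤n)))
    bound ℤ.-[1+ n ] = ℤ.-≤+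

  fromℕ-suc : ∀ n → fromℕ (suc n) ≡ 1ℚ + fromℕ n
  fromℕ-suc n = toℚᵘ-injective (ℚᵘ.≃-trans (toℚᵘ-fromℕ (suc n)) (ℚᵘ.≃-trans step (ℚᵘ.≃-sym
    (ℚᵘ.≃-trans (toℚᵘ-homo-+ 1ℚ (fromℕ n)) (ℚᵘ.+-cong (ℚᵘ.≃-refl {toℚᵘ 1ℚ}) (toℚᵘ-fromℕ n))))))
    where
    step : ℚᵘ.mkℚᵘ (+ suc n) 0 ℚᵘ.≃ ℚᵘ.mkℚᵘ (+ 1) 0 ℚᵘ.+ ℚᵘ.mkℚᵘ (+ n) 0
    step = ℚᵘ.*≡* (cong (ℤ._* + 1) (trans (ℤ.pos-+ 1 n)
      (cong (λ k → + 1 ℤ.+ k) (sym (ℤ.*-identityʳ (+ n))))))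

  fromℕ*inv : ∀ i → fromℕ (suc i) * inv i ≡ 1ℚ
  fromℕ*inv i = toℚᵘ-injective (ℚᵘ.≃-trans (toℚᵘ-homo-* (fromℕ (suc i)) (inv i))
    (ℚᵘ.≃-trans (ℚᵘ.*-cong (toℚᵘ-fromℕ (suc i)) (toℚᵘ-fromℚᵘ (ℚᵘ.mkℚᵘ (+ 1) i)))
      (ℚᵘ.*≡* eq)))
    where
    eq : (+ suc i ℤ.* + 1) ℤ.* + 1 ≡ + 1 ℤ.* (+ 1 ℤ.* + suc i)
    eq = trans (ℤ.*-identityʳ _) (trans (ℤ.*-comm (+ suc i) (+ 1)) (sym (ℤ.*-identityˡ _)))

  fromℕ-nonNeg : ∀ n → 0ℚ ≤ fromℕ n
  fromℕ-nonNeg n = nonNegative⁻¹ (fromℕ n) {{normalize-nonNeg n 1}}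

  fromℕ-mono : ∀ {m n} → m ℕ.≤′ n → fromℕ m ≤ fromℕ n
  fromℕ-mono ℕ.≤′-refl = ≤-refl
  fromℕ-mono {n = suc n} (ℕ.≤′-step m≤n) = ≤-trans (fromℕ-mono m≤n)
    (subst₂ _≤_ (+-identityˡ _) (sym (fromℕ-suc n)) (+-monoˡ-≤ (fromℕ n) (nonNegative⁻¹ 1ℚ)))

  inv-nonNeg : ∀ i → 0ℚ ≤ inv i
  inv-nonNeg i = nonNegative⁻¹ (inv i) {{normalize-nonNeg 1 (suc i)}}

------------------------------------------------------------------------
-- Real numbers

-- The terms of s from index N on are pairwise less than ε apart.
CloseFrom : (ℕ → ℚ) → ℚ → ℕ → Set
CloseFrom s ε N = ∀ m n → N ℕ.≤ m → N ℕ.≤ n → ∣ s m - s n ∣ < ε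

-- A real number is a Cauchy sequence of rationals.  Sequences with the same
-- limit represent the same real; every relation below respects this.
record ℝ : Set where
  constructor mkℝ
  field
    seq    : ℕ → ℚ
    cauchy : ∀ ε → 0ℚ < ε → ∃ (CloseFrom seq ε)

open ℝ public

infix 4 _≤ℝ_ _<ℝ_
infixl 6 _+ℝ_ _-ℝ_
infixl 7 _*ℝ_
infix 8 -ℝ_

_≤ℝ_ _<ℝ_ : ℝ → ℝ → Set
x ≤ℝ y = ∀ ε → 0ℚ < ε → ∃ λ N → ∀ n → N ℕ.≤ n → seq x n ≤ seq y n + ε
x <ℝ y = ∃ λ ε → 0ℚ < ε × ∃ λ N → ∀ n → N ℕ.≤ n → seq x n + ε ≤ seq y n

fromℚ : ℚ → ℝ
fromℚ q = mkℝ (λ _ → q) λ ε 0<ε → 0 , λ _ _ _ _ → subst (_< ε) (sym (cong ∣_∣ (+-inverseʳ q))) 0<ε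

0ℝ 1ℝ : ℝ
0ℝ = fromℚ 0ℚ
1ℝ = fromℚ 1ℚ

private

  +-close : ∀ {ε} a b c d → ∣ a - c ∣ < ε * ½ → ∣ b - d ∣ < ε * ½ → ∣ (a + b) - (c + d) ∣ < ε
  +-close {ε} a b c d p q = subst₂ _<_
    (cong ∣_∣ (solve 4 (λ a b c d → (a :- c) :+ (b :- d) := (a :+ b) :- (c :+ d)) refl a b c d))
    (half ε)
    (≤-<-trans (∣p+q∣≤∣p∣+∣q∣ (a - c) (b - d)) (+-mono-< p q))

  *-close : ∀ {ε A B δ η} a b c d → 0ℚ < A → 0ℚ < B → A * δ ≡ ε * ½ → B * η ≡ ε * ½ →
    ∣ a ∣ ≤ A → ∣ d ∣ ≤ B → ∣ b - d ∣ < δ → ∣ a - c ∣ < η → ∣ a * b - c * d ∣ < ε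
  *-close {ε} {A} {B} {δ} {η} a b c d 0<A 0<B Aδ Bη a≤A d≤B bd ac =
    subst (∣ a * b - c * d ∣ <_) (half ε) (≤-<-trans (∣*-*∣≤ a b c d) (+-mono-< first second))
    where
    first : ∣ a ∣ * ∣ b - d ∣ < ε * ½
    first = subst (∣ a ∣ * ∣ b - d ∣ <_) Aδ (≤-<-trans
      (*-monoʳ-≤-nonNeg ∣ b - d ∣ {{nonNegative (0≤∣p∣ (b - d))}} a≤A)
      (*-monoʳ-<-pos A {{positive 0<A}} bd))
    second : ∣ a - c ∣ * ∣ d ∣ < ε * ½
    second = subst (∣ a - c ∣ * ∣ d ∣ <_) (trans (*-comm η B) Bη) (≤-<-trans
      (*-monoˡ-≤-nonNeg ∣ a - c ∣ {{nonNegative (0≤∣p∣ (a - c))}} d≤B)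
      (*-monoˡ-<-pos B {{positive 0<B}} ac))

_+ℝ_ : ℝ → ℝ → ℝ
seq (x +ℝ y) n = seq x n + seq y n
cauchy (x +ℝ y) ε 0<ε with cauchy x (ε * ½) (half-pos 0<ε) | cauchy y (ε * ½) (half-pos 0<ε)
... | M , xε | N , yε = M ℕ.⊔ N , λ m n L≤m L≤n → +-close
  (seq x m) (seq y m) (seq x n) (seq y n)
  (xε m n (M≤ L≤m) (M≤ L≤n)) (yε m n (N≤ L≤m) (N≤ L≤n))
  where
  M≤ : ∀ {k} → M ℕ.⊔ N ℕ.≤ k → M ℕ.≤ k
  M≤ = ℕ.≤-trans (ℕ.m≤m⊔n M N)
  N≤ : ∀ {k} → M ℕ.⊔ N ℕ.≤ k → N ℕ.≤ k
  N≤ = ℕ.≤-trans (ℕ.m≤n⊔m M N)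

-ℝ_ : ℝ → ℝ
seq (-ℝ x) n = - seq x n
cauchy (-ℝ x) ε 0<ε with cauchy x ε 0<ε
... | N , Nx = N , λ m n N≤m N≤n → subst (_< ε)
  (trans (∣-∣-swap (seq x m) (seq x n))
    (cong ∣_∣ (solve 2 (λ a b → b :- a := (:- a) :- (:- b)) refl (seq x m) (seq x n))))
  (Nx m n N≤m N≤n)

_-ℝ_ : ℝ → ℝ → ℝ
x -ℝ y = x +ℝ (-ℝ y)

private

  EventuallyBounded : (ℕ → ℚ) → ℚ → ℕ → Set
  EventuallyBounded s B N = ∀ n → N ℕ.≤ n → ∣ s n ∣ ≤ B

  Bounded : (ℕ → ℚ) → Set
  Bounded s = ∃ λ B → 0ℚ < B × ∃ (EventuallyBounded s B)

  bounded : ∀ x → Bounded (seq x)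
  bounded x with cauchy x 1ℚ (positive⁻¹ 1ℚ)
  ... | N , Nx = ∣ seq x N ∣ + 1ℚ , +-mono-≤-< (0≤∣p∣ (seq x N)) (positive⁻¹ 1ℚ) , N , λ n N≤n →
    let a = seq x n ; b = seq x N in
    ≤-trans
      (subst (_≤ ∣ b ∣ + ∣ a - b ∣)
        (cong ∣_∣ (solve 2 (λ a b → b :+ (a :- b) := a) refl a b))
        (∣p+q∣≤∣p∣+∣q∣ b (a - b)))
      (+-monoʳ-≤ ∣ b ∣ (<⇒≤ (Nx n N N≤n ℕ.≤-refl)))

private

  *-cauchy : ∀ (s t : ℕ → ℚ) → Bounded s → Bounded t →
    (∀ ε → 0ℚ < ε → ∃ (CloseFrom s ε)) → (∀ ε → 0ℚ < ε → ∃ (CloseFrom t ε)) →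
    ∀ ε → 0ℚ < ε → ∃ (CloseFrom (λ n → s n * t n) ε)
  *-cauchy s t (A , 0<A , M₀ , sA) (B , 0<B , N₀ , tB) s-cauchy t-cauchy ε 0<ε =
    choose (divide 0<A (half-pos 0<ε)) (divide 0<B (half-pos 0<ε))
    where
    combine : ∀ {δ η} → A * δ ≡ ε * ½ → B * η ≡ ε * ½ →
      ∃ (CloseFrom t δ) → ∃ (CloseFrom s η) → ∃ (CloseFrom (λ n → s n * t n) ε)
    combine Aδ Bη (M₁ , tδ) (N₁ , sη) = L , λ m n L≤m L≤n →
      *-close (s m) (t m) (s n) (t n) 0<A 0<B Aδ Bη
        (sA m (ℕ.≤-trans M₀≤L L≤m)) (tB n (ℕ.≤-trans N₀≤L L≤n))
        (tδ m n (ℕ.≤-trans M₁≤L L≤m) (ℕ.≤-trans M₁≤L L≤n))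
        (sη m n (ℕ.≤-trans N₁≤L L≤m) (ℕ.≤-trans N₁≤L L≤n))
      where
      L = (M₀ ℕ.⊔ M₁) ℕ.⊔ (N₀ ℕ.⊔ N₁)
      M₀≤L : M₀ ℕ.≤ L
      M₀≤L = ℕ.≤-trans (ℕ.m≤m⊔n M₀ M₁) (ℕ.m≤m⊔n _ _)
      M₁≤L : M₁ ℕ.≤ L
      M₁≤L = ℕ.≤-trans (ℕ.m≤n⊔m M₀ M₁) (ℕ.m≤m⊔n _ _)
      N₀≤L : N₀ ℕ.≤ L
      N₀≤L = ℕ.≤-trans (ℕ.m≤m⊔n N₀ N₁) (ℕ.m≤n⊔m (M₀ ℕ.⊔ M₁) _)
      N₁≤L : N₁ ℕ.≤ L
      N₁≤L = ℕ.≤-trans (ℕ.m≤n⊔m N₀ N₁) (ℕ.m≤n⊔m (M₀ ℕ.⊔ M₁) _)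
    choose : (∃ λ δ → 0ℚ < δ × A * δ ≡ ε * ½) → (∃ λ η → 0ℚ < η × B * η ≡ ε * ½) →
      ∃ (CloseFrom (λ n → s n * t n) ε)
    choose (δ , 0<δ , Aδ) (η , 0<η , Bη) = combine Aδ Bη (t-cauchy δ 0<δ) (s-cauchy η 0<η)

_*ℝ_ : ℝ → ℝ → ℝ
seq (x *ℝ y) n = seq x n * seq y n
cauchy (x *ℝ y) = *-cauchy (seq x) (seq y) (bounded x) (bounded y) (cauchy x) (cauchy y)

infix 4 _⟶_

_⟶_ : (ℕ → ℝ) → ℝ → Set
s ⟶ x = ∀ ε → 0ℚ < ε → ∃ λ N → ∀ n → N ℕ.≤ n →
  (s n -ℝ x <ℝ fromℚ ε) × (x -ℝ s n <ℝ fromℚ ε)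

-- A relation, since ⌊x⌋ is not computable from a Cauchy sequence for x.
IsFloor : ℝ → ℕ → Set
IsFloor x m = (fromℚ (fromℕ m) ≤ℝ x) × (x <ℝ fromℚ (fromℕ (suc m)))

------------------------------------------------------------------------
-- The exponential function

-- xⁱ / i!
expTerm : ℚ → ℕ → ℚ
expTerm x zero    = 1ℚ
expTerm x (suc i) = expTerm x i * (x * (+ 1 / suc i))

-- Σ_{i < n} xⁱ / i!
expSum : ℚ → ℕ → ℚ
expSum x zero    = 0ℚ
expSum x (suc n) = expSum x n + expTerm x n

private

  module _ {B} (0≤B : 0ℚ ≤ B) where

    term-nonNeg : ∀ i → 0ℚ ≤ expTerm B i
    term-nonNeg zero    = nonNegative⁻¹ 1ℚ
    term-nonNeg (suc i) = *-nonNeg (term-nonNeg i) (*-nonNeg 0≤B (inv-nonNeg i))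

    sum-nonNeg : ∀ n → 0ℚ ≤ expSum B n
    sum-nonNeg zero    = ≤-refl
    sum-nonNeg (suc n) = +-mono-≤ (sum-nonNeg n) (term-nonNeg n)

    sum-mono : ∀ {m n} → m ℕ.≤′ n → expSum B m ≤ expSum B n
    sum-mono ℕ.≤′-refl = ≤-refl
    sum-mono {m} {suc n} (ℕ.≤′-step m≤n) = subst (_≤ expSum B (suc n)) (+-identityʳ _)
      (+-mono-≤ (sum-mono m≤n) (term-nonNeg n))

    ∣x*inv∣ : ∀ {x} → ∣ x ∣ ≤ B → ∀ i → ∣ x * inv i ∣ ≤ B * inv i
    ∣x*inv∣ {x} ∣x∣≤B i = subst (_≤ B * inv i)
      (sym (trans (∣p*q∣≡∣p∣*∣q∣ x (inv i)) (cong (∣ x ∣ *_) (0≤p⇒∣p∣≡p (inv-nonNeg i)))))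
      (*-monoʳ-≤-nonNeg (inv i) {{nonNegative (inv-nonNeg i)}} ∣x∣≤B)

    term-bound : ∀ {x} → ∣ x ∣ ≤ B → ∀ i → ∣ expTerm x i ∣ ≤ expTerm B i
    term-bound ∣x∣≤B zero = ≤-refl
    term-bound {x} ∣x∣≤B (suc i) = subst (_≤ expTerm B (suc i))
      (sym (∣p*q∣≡∣p∣*∣q∣ (expTerm x i) (x * inv i)))
      (*-mono (0≤∣p∣ (expTerm x i)) (*-nonNeg 0≤B (inv-nonNeg i))
        (term-bound ∣x∣≤B i) (∣x*inv∣ ∣x∣≤B i))

    tail-bound : ∀ {x} → ∣ x ∣ ≤ B → ∀ {m n} → m ℕ.≤′ n →
      ∣ expSum x n - expSum x m ∣ ≤ expSum B n - expSum B m
    tail-bound {x} ∣x∣≤B {m} ℕ.≤′-refl = ≤-reflexive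
      (trans (cong ∣_∣ (+-inverseʳ (expSum x m))) (sym (+-inverseʳ (expSum B m))))
    tail-bound {x} ∣x∣≤B {m} {suc n} (ℕ.≤′-step m≤n) = subst₂ _≤_
      (cong ∣_∣ (rearrange (expSum x n) (expTerm x n) (expSum x m)))
      (rearrange (expSum B n) (expTerm B n) (expSum B m))
      (≤-trans (∣p+q∣≤∣p∣+∣q∣ (expSum x n - expSum x m) (expTerm x n))
        (+-mono-≤ (tail-bound ∣x∣≤B m≤n) (term-bound ∣x∣≤B n)))
      where
      rearrange : ∀ s t u → (s - u) + t ≡ (s + t) - u
      rearrange = solve 3 (λ s t u → (s :- u) :+ t := (s :+ t) :- u) refl

    derivTerm : ℕ → ℚ
    derivTerm zero    = 0ℚ
    derivTerm (suc i) = expTerm B i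

    derivTerm*B : ∀ i → derivTerm i * B ≡ fromℕ i * expTerm B i
    derivTerm*B zero    = trans (*-zeroˡ B) (sym (*-zeroˡ 1ℚ))
    derivTerm*B (suc i) = sym (trans
      (solve 4 (λ f t b r → f :* (t :* (b :* r)) := (t :* b) :* (f :* r)) refl
        (fromℕ (suc i)) (expTerm B i) B (inv i))
      (trans (cong (expTerm B i * B *_) (fromℕ*inv i)) (*-identityʳ _)))

    term-lipschitz : ∀ {x y} → ∣ x ∣ ≤ B → ∣ y ∣ ≤ B → ∀ i →
      ∣ expTerm x i - expTerm y i ∣ ≤ ∣ x - y ∣ * derivTerm i
    term-lipschitz {x} {y} _ _ zero = ≤-reflexive (sym (*-zeroʳ ∣ x - y ∣))
    term-lipschitz {x} {y} ∣x∣≤B ∣y∣≤B (suc i) = ≤-trans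
      (∣*-*∣≤ (expTerm x i) (x * r) (expTerm y i) (y * r))
      (subst (∣ expTerm x i ∣ * ∣ x * r - y * r ∣ + ∣ expTerm x i - expTerm y i ∣ * ∣ y * r ∣ ≤_) eq
        (+-mono-≤
          (*-mono (0≤∣p∣ (expTerm x i)) (*-nonNeg (0≤∣p∣ (x - y)) (inv-nonNeg i))
            (term-bound ∣x∣≤B i) (≤-reflexive factor))
          (*-mono (0≤∣p∣ (expTerm x i - expTerm y i)) (*-nonNeg 0≤B (inv-nonNeg i))
            (term-lipschitz ∣x∣≤B ∣y∣≤B i) (∣x*inv∣ ∣y∣≤B i))))
      where
      r = inv i
      d = ∣ x - y ∣
      t = expTerm B i
      factor : ∣ x * r - y * r ∣ ≡ d * r
      factor = trans
        (cong ∣_∣ (solve 3 (λ x y r → x :* r :- y :* r := (x :- y) :* r) refl x y r))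
        (trans (∣p*q∣≡∣p∣*∣q∣ (x - y) r) (cong (d *_) (0≤p⇒∣p∣≡p (inv-nonNeg i))))
      eq : t * (d * r) + d * derivTerm i * (B * r) ≡ d * t
      eq = trans
        (solve 5 (λ t d r u b → t :* (d :* r) :+ d :* u :* (b :* r) := (d :* r) :* (t :+ u :* b)) refl
          t d r (derivTerm i) B)
        (trans (cong (λ u → (d * r) * (t + u)) (derivTerm*B i))
        (trans (cong (λ u → (d * r) * (u + fromℕ i * t)) (sym (*-identityˡ t)))
        (trans (solve 5 (λ d r o f t → (d :* r) :* (o :* t :+ f :* t) := d :* t :* ((o :+ f) :* r)) refl
          d r 1ℚ (fromℕ i) t)
        (trans (cong (λ u → d * t * (u * r)) (sym (fromℕ-suc i)))
        (trans (cong (d * t *_) (fromℕ*inv i)) (*-identityʳ _))))))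

    derivSum : ℕ → ℚ
    derivSum zero    = 0ℚ
    derivSum (suc n) = derivSum n + derivTerm n

    derivSum-nonNeg : ∀ n → 0ℚ ≤ derivSum n
    derivSum-nonNeg zero          = ≤-refl
    derivSum-nonNeg (suc zero)    = ≤-refl
    derivSum-nonNeg (suc (suc n)) = +-mono-≤ (derivSum-nonNeg (suc n)) (term-nonNeg n)

    sum-lipschitz : ∀ {x y} → ∣ x ∣ ≤ B → ∣ y ∣ ≤ B → ∀ n →
      ∣ expSum x n - expSum y n ∣ ≤ ∣ x - y ∣ * derivSum n
    sum-lipschitz {x} {y} _ _ zero = ≤-reflexive (sym (*-zeroʳ ∣ x - y ∣))
    sum-lipschitz {x} {y} ∣x∣≤B ∣y∣≤B (suc n) = subst₂ _≤_
      (cong ∣_∣ (solve 4 (λ a b c d → (a :- c) :+ (b :- d) := (a :+ b) :- (c :+ d)) refl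
        (expSum x n) (expTerm x n) (expSum y n) (expTerm y n)))
      (sym (*-distribˡ-+ ∣ x - y ∣ (derivSum n) (derivTerm n)))
      (≤-trans (∣p+q∣≤∣p∣+∣q∣ (expSum x n - expSum y n) (expTerm x n - expTerm y n))
        (+-mono-≤ (sum-lipschitz ∣x∣≤B ∣y∣≤B n) (term-lipschitz ∣x∣≤B ∣y∣≤B n)))

    -- From index M on, consecutive terms of the series at B at least halve.
    module _ {M} (2B≤M : B + B ≤ fromℕ M) where

      term-halves : ∀ {i} → M ℕ.≤′ i → expTerm B (suc i) + expTerm B (suc i) ≤ expTerm B i
      term-halves {i} M≤i = subst₂ _≤_
        (solve 3 (λ t b r → t :* ((b :+ b) :* r) := t :* (b :* r) :+ t :* (b :* r)) refl
          (expTerm B i) B (inv i))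
        (trans (cong (expTerm B i *_) (fromℕ*inv i)) (*-identityʳ _))
        (*-monoˡ-≤-nonNeg (expTerm B i) {{nonNegative (term-nonNeg i)}}
          (*-monoʳ-≤-nonNeg (inv i) {{nonNegative (inv-nonNeg i)}}
            (≤-trans 2B≤M (fromℕ-mono {M} {suc i} (ℕ.≤′-step M≤i)))))

      sum+2term : ∀ {m n} → M ℕ.≤′ m → m ℕ.≤′ n →
        expSum B n + (expTerm B n + expTerm B n) ≤ expSum B m + (expTerm B m + expTerm B m)
      sum+2term M≤m ℕ.≤′-refl = ≤-refl
      sum+2term {m} {suc n} M≤m (ℕ.≤′-step m≤n) = ≤-trans
        (+-monoʳ-≤ (expSum B (suc n)) (term-halves (ℕ.≤⇒≤′ (ℕ.≤-trans (ℕ.≤′⇒≤ M≤m) (ℕ.≤′⇒≤ m≤n)))))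
        (subst (_≤ expSum B m + (expTerm B m + expTerm B m)) (sym (+-assoc (expSum B n) _ _))
          (sum+2term M≤m m≤n))

      series-tail : ∀ {m n} → M ℕ.≤′ m → m ℕ.≤′ n →
        expSum B n - expSum B m ≤ expTerm B m + expTerm B m
      series-tail {m} {n} M≤m m≤n = subst₂ _≤_ refl
        (solve 2 (λ s t → (s :+ t) :- s := t) refl (expSum B m) (expTerm B m + expTerm B m))
        (+-monoˡ-≤ (- expSum B m) (≤-trans
          (subst (_≤ expSum B n + (expTerm B n + expTerm B n)) (+-identityʳ (expSum B n))
            (+-monoʳ-≤ (expSum B n) (+-mono-≤ (term-nonNeg n) (term-nonNeg n))))
          (sum+2term M≤m m≤n)))

      term-decay : ∀ k → expTerm B (k ℕ.+ M) * fromℕ (suc k) ≤ expTerm B M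
      term-decay zero    = ≤-reflexive (*-identityʳ _)
      term-decay (suc k) = ≤-trans (subst (t′ * fromℕ (suc (suc k)) ≤_) (sym (*-distribʳ-+ f t′ t′))
        (subst (_≤ t′ * f + t′ * f)
          (sym (trans (cong (t′ *_) (fromℕ-suc (suc k)))
            (*-distribˡ-+ t′ 1ℚ f)))
          (+-monoˡ-≤ (t′ * f) (*-monoˡ-≤-nonNeg t′ {{nonNegative (term-nonNeg (suc k ℕ.+ M))}}
            1≤f))))
        (≤-trans (*-monoʳ-≤-nonNeg f {{nonNegative (fromℕ-nonNeg (suc k))}}
          (term-halves (ℕ.≤⇒≤′ (ℕ.m≤n+m M k))))
        (term-decay k))
        where
        t′ = expTerm B (suc k ℕ.+ M)
        f = fromℕ (suc k)
        1≤f : 1ℚ ≤ f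
        1≤f = fromℕ-mono {1} {suc k} (ℕ.≤⇒≤′ (ℕ.s≤s ℕ.z≤n))

    small-tail : ∀ ε → 0ℚ < ε → ∃ λ N → ∀ n → N ℕ.≤ n → expSum B n - expSum B N < ε
    small-tail ε 0<ε with archimedean (B + B)
    ... | M , 2B≤M with divide 0<ε (+-mono-≤-< (+-mono-≤ (term-nonNeg M) (term-nonNeg M)) (positive⁻¹ 1ℚ))
    ... | q , 0<q , εq with archimedean q
    ... | k , q≤k = k ℕ.+ M , λ n N≤n → ≤-<-trans
      (series-tail 2B≤M (ℕ.≤⇒≤′ (ℕ.m≤n+m M k)) (ℕ.≤⇒≤′ N≤n))
      (*-cancelʳ-<-nonNeg f {{nonNegative (fromℕ-nonNeg (suc k))}} (≤-<-trans
        (subst (_≤ T + T) (sym (*-distribʳ-+ f t t)) (+-mono-≤ (term-decay 2B≤M k) (term-decay 2B≤M k)))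
        (<-≤-trans
          (subst₂ _<_ (+-identityʳ (T + T)) (sym εq) (+-monoʳ-< (T + T) (positive⁻¹ 1ℚ)))
          (*-monoˡ-≤-nonNeg ε {{nonNegative (<⇒≤ 0<ε)}}
            (≤-trans q≤k (fromℕ-mono {k} {suc k} (ℕ.≤′-step ℕ.≤′-refl)))))))
      where
      t = expTerm B (k ℕ.+ M)
      T = expTerm B M
      f = fromℕ (suc k)

private

  exp-close : ∀ {ε δ B K} a b m n (0≤B : 0ℚ ≤ B) →
    (∀ n → K ℕ.≤ n → expSum B n - expSum B K < ε * ½ * ½) →
    (derivSum 0≤B K + 1ℚ) * δ ≡ ε * ½ →
    ∣ a ∣ ≤ B → ∣ b ∣ ≤ B → ∣ a - b ∣ < δ → K ℕ.≤ m → K ℕ.≤ n →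
    ∣ expSum a m - expSum b n ∣ < ε
  exp-close {ε} {δ} {B} {K} a b m n 0≤B tail< Dδ a≤B b≤B ab K≤m K≤n =
    subst (∣ expSum a m - expSum b n ∣ <_) quarters
      (≤-<-trans (triangle (expSum a m) (expSum a K) (expSum b n))
        (+-mono-< tail-m (≤-<-trans (triangle (expSum a K) (expSum b K) (expSum b n))
          (+-mono-≤-< middle tail-n))))
    where
    D : ℚ
    D = derivSum 0≤B K
    tail-m : ∣ expSum a m - expSum a K ∣ < ε * ½ * ½
    tail-m = ≤-<-trans (tail-bound 0≤B a≤B (ℕ.≤⇒≤′ K≤m)) (tail< m K≤m)
    tail-n : ∣ expSum b K - expSum b n ∣ < ε * ½ * ½
    tail-n = subst (_< ε * ½ * ½) (∣-∣-swap (expSum b n) (expSum b K))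
      (≤-<-trans (tail-bound 0≤B b≤B (ℕ.≤⇒≤′ K≤n)) (tail< n K≤n))
    middle : ∣ expSum a K - expSum b K ∣ ≤ ε * ½
    middle = ≤-trans (sum-lipschitz 0≤B a≤B b≤B K) (subst (∣ a - b ∣ * D ≤_)
      (trans (*-comm δ (D + 1ℚ)) Dδ)
      (*-mono (0≤∣p∣ (a - b)) (+-mono-≤ (derivSum-nonNeg 0≤B K) (nonNegative⁻¹ 1ℚ)) (<⇒≤ ab)
        (subst (_≤ D + 1ℚ) (+-identityʳ D) (+-monoʳ-≤ D (nonNegative⁻¹ 1ℚ)))))
    quarters : ε * ½ * ½ + (ε * ½ + ε * ½ * ½) ≡ ε
    quarters = trans (cong (λ q → ε * ½ * ½ + q) (+-comm (ε * ½) (ε * ½ * ½)))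
      (trans (sym (+-assoc (ε * ½ * ½) (ε * ½ * ½) (ε * ½)))
        (trans (cong (_+ ε * ½) (half (ε * ½))) (half ε)))

  exp-cauchy : ∀ (s : ℕ → ℚ) → Bounded s →
    (∀ ε → 0ℚ < ε → ∃ (CloseFrom s ε)) →
    ∀ ε → 0ℚ < ε → ∃ (CloseFrom (λ n → expSum (s n) n) ε)
  exp-cauchy s (B , 0<B , N₀ , sB) s-cauchy ε 0<ε =
    choose (small-tail 0≤B (ε * ½ * ½) (half-pos (half-pos 0<ε)))
    where
    0≤B : 0ℚ ≤ B
    0≤B = <⇒≤ 0<B
    combine : ∀ {K δ} → (∀ n → K ℕ.≤ n → expSum B n - expSum B K < ε * ½ * ½) →
      (derivSum 0≤B K + 1ℚ) * δ ≡ ε * ½ → ∃ (CloseFrom s δ) →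
      ∃ (CloseFrom (λ n → expSum (s n) n) ε)
    combine {K} tail< Dδ (N₁ , sδ) = L , λ m n L≤m L≤n →
      exp-close (s m) (s n) m n 0≤B tail< Dδ
        (sB m (ℕ.≤-trans N₀≤L L≤m)) (sB n (ℕ.≤-trans N₀≤L L≤n))
        (sδ m n (ℕ.≤-trans N₁≤L L≤m) (ℕ.≤-trans N₁≤L L≤n))
        (ℕ.≤-trans K≤L L≤m) (ℕ.≤-trans K≤L L≤n)
      where
      L = K ℕ.⊔ (N₀ ℕ.⊔ N₁)
      K≤L : K ℕ.≤ L
      K≤L = ℕ.m≤m⊔n K _
      N₀≤L : N₀ ℕ.≤ L
      N₀≤L = ℕ.≤-trans (ℕ.m≤m⊔n N₀ N₁) (ℕ.m≤n⊔m K _)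
      N₁≤L : N₁ ℕ.≤ L
      N₁≤L = ℕ.≤-trans (ℕ.m≤n⊔m N₀ N₁) (ℕ.m≤n⊔m K _)
    choose : (∃ λ K → ∀ n → K ℕ.≤ n → expSum B n - expSum B K < ε * ½ * ½) →
      ∃ (CloseFrom (λ n → expSum (s n) n) ε)
    choose (K , tail<) = close
      (divide (+-mono-≤-< (derivSum-nonNeg 0≤B K) (positive⁻¹ 1ℚ)) (half-pos 0<ε))
      where
      close : (∃ λ δ → 0ℚ < δ × (derivSum 0≤B K + 1ℚ) * δ ≡ ε * ½) →
        ∃ (CloseFrom (λ n → expSum (s n) n) ε)
      close (δ , 0<δ , Dδ) = combine tail< Dδ (s-cauchy δ 0<δ)

exp : ℝ → ℝ
seq (exp x) n = expSum (seq x n) n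
cauchy (exp x) = exp-cauchy (seq x) (bounded x) (cauchy x)

------------------------------------------------------------------------
-- Distributions on ℕ

infixr 8 _^ℝ_

_^ℝ_ : ℝ → ℕ → ℝ
x ^ℝ zero  = 1ℝ
x ^ℝ suc k = x *ℝ x ^ℝ k

PMF : Set
PMF = ℕ → ℝ

cdf : PMF → ℕ → ℝ
cdf p zero    = p zero
cdf p (suc k) = cdf p k +ℝ p (suc k)

-- Convergence of distribution functions at the continuity points of the limit.
-- For variables with values in ℕ the distribution function is 0 below 0 and
-- constant on [k , k+1), so evaluating at k covers every x in (k , k+1).
ConvergesInDistribution : (ℕ → PMF) → PMF → Set
ConvergesInDistribution p q = ∀ k → (λ n → cdf (p n) k) ⟶ cdf q k

poisson : ℝ → PMF
poisson rate k = exp (-ℝ rate) *ℝ rate ^ℝ k *ℝ fromℚ ((+ 1 / k ℕ.!) {{k ℕ.!≢0}})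

------------------------------------------------------------------------
-- Measures with finitely many atoms

-- [ (a₁ , w₁) , … ] stands for Σᵢ wᵢ δ_{aᵢ}; atoms may repeat.
Measure : Set → Set
Measure A = List (A × ℚ)

δ : ∀ {A} → A → Measure A
δ a = (a , 1ℚ) ∷ []

total : ∀ {A} → Measure A → ℚ
total = foldr (λ (_ , w) s → w + s) 0ℚ

measure : ∀ {A} → Measure A → {P : A → Set} → (∀ a → Dec (P a)) → ℚ
measure μ P? = total (filter (λ (a , _) → P? a) μ)

pushforward : ∀ {A B : Set} → (A → B) → Measure A → Measure B
pushforward f = map λ (a , w) → f a , w

pmf : Measure ℕ → PMF
pmf μ k = fromℚ (measure μ (λ i → i ℕ.≟ k))

------------------------------------------------------------------------
-- The star transposition walk

-- The law of h g for independent h ∼ μ and g ∼ ν, where h g applies g first.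
infixr 7 _⊛_
_⊛_ : ∀ {n} → Measure (Permutation′ n) → Measure (Permutation′ n) → Measure (Permutation′ n)
_⊛_ = cartesianProductWith λ (h , p) (g , q) → g ∘ₚ h , p * q

_⊛^_ : ∀ {n} → Measure (Permutation′ n) → ℕ → Measure (Permutation′ n)
μ ⊛^ zero  = δ Perm.id
μ ⊛^ suc k = μ ⊛ μ ⊛^ k

-- On S_n with n = r + 2, so that the n − 1 = r + 1 transpositions exist;
-- the point called 1 in S_n is zero here.
star : ∀ r → Measure (Permutation′ (2 ℕ.+ r))
star r = map (λ i → transpose Fin.zero (Fin.suc i) , + 1 / suc r) (allFin (suc r))

-- x is the least element of a cycle of π of length exactly j: if π^i x > x
-- for 0 < i < j and π^j x = x, then x, π x, …, π^(j-1) x are distinct.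
LeastInCycle : ∀ {n} → ℕ → Permutation′ n → Pred (Fin n) _
LeastInCycle j π x =
  (fold x (π ⟨$⟩ʳ_) j ≡ x) ×
  (∀ (i : Fin j) → 0 ℕ.< toℕ i → x Fin.< fold x (π ⟨$⟩ʳ_) (toℕ i))

leastInCycle? : ∀ {n} j (π : Permutation′ n) → Decidable (LeastInCycle j π)
leastInCycle? j π x =
  (fold x (π ⟨$⟩ʳ_) j Fin.≟ x) ×-dec
  Fin.all? λ i → (0 ℕ.<? toℕ i) →-dec (x Fin.<? fold x (π ⟨$⟩ʳ_) (toℕ i))

#cycles : ∀ {n} → ℕ → Permutation′ n → ℕ
#cycles {n} j π = length (filter (leastInCycle? j π) (allFin n))

-- The law of the number of j-cycles in S_{r+2} after k steps.
cycleLaw : ℕ → ∀ r → ℕ → PMF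
cycleLaw j r k = pmf (pushforward (#cycles j) (star r ⊛^ k))

{-# OPTIONS --safe #-}
module Submission where

-- A star transposition either merges a cycle into the cycle of the centre or
-- splits a piece off that cycle, each piece length below the full length arising
-- from exactly one transposition.  Hence the number X of j-cycles avoiding the
-- centre is nearly an immigration–death chain: with ε = 1/(n − 1), a new j-cycle
-- is born with probability ε as long as the cycle of the centre is longer than j,
-- and each one dies with probability jε.  The binomial moments of X satisfy a
-- triangular linear recursion whose solution is λᵐ/m! up to O(1/n), with
-- λ = (1 − (1 − jε)ᵏ)/j → (1 − e^{-jc})/j.  Newton's forward difference formula with
-- remainder turns the convergence of moments into that of point probabilities.

open import Defs
open import Data.Bool.Base using (true; false; if_then_else_)
open import Data.Fin.Base as Fin using (Fin; toℕ)
open import Data.Fin.Permutation using (Permutation′; _⟨$⟩ʳ_; _∘ₚ_; transpose)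
import Data.Fin.Permutation as Perm
import Data.Fin.Permutation.Components as PC
import Data.Fin.Properties as Fin
open import Data.Integer.Base as ℤ using (+_)
import Data.Integer.Properties as ℤ
open import Data.List.Base
  using (List; []; _∷_; _++_; map; filter; length; allFin; tabulate; lookup; concatMap)
open import Data.List.Membership.Propositional using (_∈_)
open import Data.List.Membership.Propositional.Properties using (∈-∃++; ∈-lookup)
import Data.List.Properties as List
open import Data.List.Relation.Binary.Permutation.Propositional
  using (_↭_; ↭-refl; ↭-sym; ↭-trans; ↭-reflexive; prep; ↭⇒↭ₛ)
import Data.List.Relation.Binary.Permutation.Propositional as ↭
open import Data.List.Relation.Binary.Permutation.Propositional.Properties
  using (↭-length; filter-↭; ∈-resp-↭; map⁺; ++-comm; ++⁺ˡ; ++⁺ʳ; shift; drop-∷)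
import Data.List.Relation.Binary.Permutation.Setoid.Properties as ↭ₛ
open import Data.List.Relation.Unary.All as All using (All; []; _∷_)
import Data.List.Relation.Unary.All.Properties as All
open import Data.List.Relation.Unary.AllPairs using ([]; _∷_)
open import Data.List.Relation.Unary.Any using (here; there; index)
import Data.List.Relation.Unary.Any.Properties as Any
open import Data.List.Relation.Unary.Unique.Propositional using (Unique)
open import Data.List.Relation.Unary.Unique.Propositional.Properties using (allFin⁺)
open import Data.Maybe.Base using (Maybe; just; nothing)
open import Data.Nat.Base as ℕ using (ℕ; zero; suc; NonZero) renaming (_+_ to _+ℕ_)
open import Data.Nat.GeneralisedArithmetic using (fold)
open import Data.Nat.ListAction using (sum)
open import Data.Nat.ListAction.Properties using (sum-↭)
import Data.Nat.Properties as ℕ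
open import Data.Product.Base using (∃; _×_; _,_; proj₁; proj₂)
open import Data.Rational.Base hiding (NonZero)
import Data.Rational.Base as ℚ
open import Data.Rational.Properties
import Data.Rational.Unnormalised.Base as ℚᵘ
import Data.Rational.Unnormalised.Properties as ℚᵘ
open import Data.Sum.Base using (inj₁; inj₂)
open import Function.Base using (_∘_; _$_; id)
open import Level using (0ℓ)
open import Relation.Binary.Definitions using (tri<; tri≈; tri>)
open import Relation.Binary.PropositionalEquality hiding (J)
open import Relation.Nullary using (Dec; yes; no; does; contradiction)
open import Relation.Nullary.Decidable using (dec-true; dec-false)
open import Relation.Unary using (Pred; Decidable)
open import Tactic.RingSolver using (solve-∀)
open import Tactic.RingSolver.Core.AlmostCommutativeRing using (AlmostCommutativeRing; fromCommutativeRing)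

-- Rational arithmetic

-- X alone is not a Markov chain, since a birth requires a long centre cycle. The whole defect is
-- collected in one weight, `G`, which is charged as an error. Binomial moments suit the chain
-- because a birth adds exactly binom(X, m - 1) to binom(X, m), while deaths multiply the mean of
-- binom(X, m) by 1 - jmε. The recursion for order m therefore involves only the orders m and m - 1.
-- Discarding deaths and failed births bounds the m-th binomial moment after k steps by (kε)ᵐ/m!.
-- This decay beats the growth 2ᵐ of iterated differences of a point indicator, so the remainder in
-- Newton's formula is small uniformly in n. Newton's formula serves a second time: for x ↦ pˣ with
-- p = 1 - jε it is the truncated binomial theorem, and it yields the limit of (1 - jε)ᵏ. Every
-- quantity at finite n is rational, so the analysis stays with rational sequences: a limiting real
-- enters through its r-th approximant, compared with the r-th law.

ℚ-ring : AlmostCommutativeRing _ _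
ℚ-ring = fromCommutativeRing +-*-commutativeRing isZero
  where
  isZero : ∀ p → Maybe (0ℚ ≡ p)
  isZero p with 0ℚ ≟ p
  ... | yes 0≡p = just 0≡p
  ... | no  _   = nothing

0≤1 : 0ℚ ≤ 1ℚ
0≤1 = nonNegative⁻¹ 1ℚ

0<1 : 0ℚ < 1ℚ
0<1 = positive⁻¹ 1ℚ

module _ {p q : ℚ} where

  *-nonNeg : 0ℚ ≤ p → 0ℚ ≤ q → 0ℚ ≤ p * q
  *-nonNeg 0≤p 0≤q = nonNegative⁻¹ (p * q)
    {{nonNeg*nonNeg⇒nonNeg p {{nonNegative 0≤p}} q {{nonNegative 0≤q}}}}

  *-pos : 0ℚ < p → 0ℚ < q → 0ℚ < p * q
  *-pos 0<p 0<q = positive⁻¹ (p * q) {{pos*pos⇒pos p {{positive 0<p}} q {{positive 0<q}}}}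

  p≤q⇒0≤q-p : p ≤ q → 0ℚ ≤ q - p
  p≤q⇒0≤q-p p≤q = subst (_≤ q - p) (+-inverseʳ p) (+-monoˡ-≤ (- p) p≤q)

  0≤q-p⇒p≤q : 0ℚ ≤ q - p → p ≤ q
  0≤q-p⇒p≤q h = subst₂ _≤_ (+-identityˡ p) (lemma q p) (+-monoˡ-≤ p h)
    where
    lemma : ∀ q p → (q - p) + p ≡ q
    lemma = solve-∀ ℚ-ring

  p≤p+q : 0ℚ ≤ q → p ≤ p + q
  p≤p+q 0≤q = subst (_≤ p + q) (+-identityʳ p) (+-monoʳ-≤ p 0≤q)

  p≤q+p : 0ℚ ≤ q → p ≤ q + p
  p≤q+p 0≤q = subst (_≤ q + p) (+-identityˡ p) (+-monoˡ-≤ p 0≤q)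

  p-q≤p : 0ℚ ≤ q → p - q ≤ p
  p-q≤p 0≤q = subst (p - q ≤_) (+-identityʳ p) (+-monoʳ-≤ p (neg-antimono-≤ 0≤q))

*-mono-≤ : ∀ {p q r s} → 0ℚ ≤ p → 0ℚ ≤ s → p ≤ q → r ≤ s → p * r ≤ q * s
*-mono-≤ {p} {s = s} 0≤p 0≤s p≤q r≤s = ≤-trans
  (*-monoˡ-≤-nonNeg p {{nonNegative 0≤p}} r≤s)
  (*-monoʳ-≤-nonNeg s {{nonNegative 0≤s}} p≤q)

*-monoˡ : ∀ {p q r} → 0ℚ ≤ p → q ≤ r → p * q ≤ p * r
*-monoˡ {p} 0≤p = *-monoˡ-≤-nonNeg p {{nonNegative 0≤p}}

*-monoʳ : ∀ {p q r} → 0ℚ ≤ r → p ≤ q → p * r ≤ q * r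
*-monoʳ {r = r} 0≤r = *-monoʳ-≤-nonNeg r {{nonNegative 0≤r}}

p*q≤p : ∀ {p q} → 0ℚ ≤ p → q ≤ 1ℚ → p * q ≤ p
p*q≤p {p} {q} 0≤p q≤1 = subst (p * q ≤_) (*-identityʳ p) (*-monoˡ 0≤p q≤1)

p≤∣p∣ : ∀ p → p ≤ ∣ p ∣
p≤∣p∣ p with ≤-total 0ℚ p
... | inj₁ 0≤p = ≤-reflexive (sym (0≤p⇒∣p∣≡p 0≤p))
... | inj₂ p≤0 = ≤-trans p≤0 (0≤∣p∣ p)

module _ {p b : ℚ} where

  ∣p∣≤b : p ≤ b → - p ≤ b → ∣ p ∣ ≤ b
  ∣p∣≤b p≤b -p≤b with ∣p∣≡p∨∣p∣≡-p p
  ... | inj₁ eq = ≤-trans (≤-reflexive eq) p≤b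
  ... | inj₂ eq = ≤-trans (≤-reflexive eq) -p≤b

  ∣p∣≤b⇒p≤b : ∣ p ∣ ≤ b → p ≤ b
  ∣p∣≤b⇒p≤b = ≤-trans (p≤∣p∣ p)

  ∣p∣≤b⇒-p≤b : ∣ p ∣ ≤ b → - p ≤ b
  ∣p∣≤b⇒-p≤b h = ≤-trans (p≤∣p∣ (- p)) (subst (_≤ b) (sym (∣-p∣≡∣p∣ p)) h)

∣p+q∣≤a+b : ∀ {p q a b} → ∣ p ∣ ≤ a → ∣ q ∣ ≤ b → ∣ p + q ∣ ≤ a + b
∣p+q∣≤a+b {p} {q} p≤a q≤b = ≤-trans (∣p+q∣≤∣p∣+∣q∣ p q) (+-mono-≤ p≤a q≤b)

∣p-q∣≤a+b : ∀ {p q a b} → ∣ p ∣ ≤ a → ∣ q ∣ ≤ b → ∣ p - q ∣ ≤ a + b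
∣p-q∣≤a+b {p} {q} p≤a q≤b = ≤-trans (∣p-q∣≤∣p∣+∣q∣ p q) (+-mono-≤ p≤a q≤b)

∣p*q∣≤a*b : ∀ {p q a b} → ∣ p ∣ ≤ a → ∣ q ∣ ≤ b → ∣ p * q ∣ ≤ a * b
∣p*q∣≤a*b {p} {q} {a} {b} p≤a q≤b = subst (_≤ a * b) (sym (∣p*q∣≡∣p∣*∣q∣ p q))
  (*-mono-≤ (0≤∣p∣ p) (≤-trans (0≤∣p∣ q) q≤b) p≤a q≤b)

∣p-q∣≡∣q-p∣ : ∀ p q → ∣ p - q ∣ ≡ ∣ q - p ∣
∣p-q∣≡∣q-p∣ p q = trans (sym (∣-p∣≡∣p∣ (p - q))) (cong ∣_∣ (lemma p q))
  where
  lemma : ∀ p q → - (p - q) ≡ q - p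
  lemma = solve-∀ ℚ-ring

∣p-r∣≤a+b : ∀ {p q r a b} → ∣ p - q ∣ ≤ a → ∣ q - r ∣ ≤ b → ∣ p - r ∣ ≤ a + b
∣p-r∣≤a+b {p} {q} {r} {a} {b} h₁ h₂ =
  subst (λ x → ∣ x ∣ ≤ a + b) (lemma p q r) (∣p+q∣≤a+b h₁ h₂)
  where
  lemma : ∀ p q r → (p - q) + (q - r) ≡ p - r
  lemma = solve-∀ ℚ-ring

∣p∣≤∣q∣+∣p-q∣ : ∀ p q → ∣ p ∣ ≤ ∣ q ∣ + ∣ p - q ∣
∣p∣≤∣q∣+∣p-q∣ p q = subst (λ x → ∣ x ∣ ≤ ∣ q ∣ + ∣ p - q ∣) (lemma p q) (∣p+q∣≤∣p∣+∣q∣ q (p - q))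
  where
  lemma : ∀ p q → q + (p - q) ≡ p
  lemma = solve-∀ ℚ-ring

half+half : ∀ p → p * ½ + p * ½ ≡ p
half+half p = trans (sym (*-distribˡ-+ p ½ ½)) (*-identityʳ p)

0<½p : ∀ {p} → 0ℚ < p → 0ℚ < p * ½
0<½p 0<p = *-pos 0<p (positive⁻¹ ½)

abstract

  -- Dividing ε by q + 1 instead of q covers q = 0.
  shrink : ∀ {q ε} → 0ℚ ≤ q → 0ℚ < ε → ∃ λ η → 0ℚ < η × q * η ≤ ε
  shrink {q} {ε} 0≤q 0<ε = ε * 1/[q+1] , *-pos 0<ε (positive⁻¹ 1/[q+1] {{1/pos⇒pos (q + 1ℚ)}}) ,
    (begin
      q * (ε * 1/[q+1])          ≤⟨ *-monoʳ {q} (*-nonNeg (<⇒≤ 0<ε) 0≤1/) (p≤p+q 0≤1) ⟩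
      (q + 1ℚ) * (ε * 1/[q+1])   ≡⟨ lemma (q + 1ℚ) ε 1/[q+1] ⟩
      ε * ((q + 1ℚ) * 1/[q+1])   ≡⟨ cong (ε *_) (*-inverseʳ (q + 1ℚ)) ⟩
      ε * 1ℚ                     ≡⟨ *-identityʳ ε ⟩
      ε                          ∎)
    where
    open ≤-Reasoning
    instance
      q+1>0 : Positive (q + 1ℚ)
      q+1>0 = positive (+-mono-≤-< 0≤q 0<1)
      q+1≢0 : ℚ.NonZero (q + 1ℚ)
      q+1≢0 = pos⇒nonZero (q + 1ℚ)
    1/[q+1] : ℚ
    1/[q+1] = 1/ (q + 1ℚ)
    0≤1/ : 0ℚ ≤ 1/[q+1]
    0≤1/ = <⇒≤ (positive⁻¹ 1/[q+1] {{1/pos⇒pos (q + 1ℚ)}})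
    lemma : ∀ a b c → a * (b * c) ≡ b * (a * c)
    lemma = solve-∀ ℚ-ring

infixr 8 _^_

_^_ : ℚ → ℕ → ℚ
p ^ zero  = 1ℚ
p ^ suc n = p * p ^ n

module _ {p : ℚ} (0≤p : 0ℚ ≤ p) where

  ^-nonNeg : ∀ n → 0ℚ ≤ p ^ n
  ^-nonNeg zero    = 0≤1
  ^-nonNeg (suc n) = *-nonNeg 0≤p (^-nonNeg n)

  ^-≤1 : p ≤ 1ℚ → ∀ n → p ^ n ≤ 1ℚ
  ^-≤1 p≤1 zero    = ≤-refl
  ^-≤1 p≤1 (suc n) = ≤-trans (p*q≤p 0≤p (^-≤1 p≤1 n)) p≤1

recip : ℕ → ℚ
recip n = + 1 / suc n

private

  toℚᵘ-fromℕ : ∀ n → toℚᵘ (fromℕ n) ℚᵘ.≃ ℚᵘ.mkℚᵘ (+ n) 0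
  toℚᵘ-fromℕ n = toℚᵘ-fromℚᵘ (ℚᵘ.mkℚᵘ (+ n) 0)

  toℚᵘ-recip : ∀ n → toℚᵘ (recip n) ℚᵘ.≃ ℚᵘ.mkℚᵘ (+ 1) n
  toℚᵘ-recip n = toℚᵘ-fromℚᵘ (ℚᵘ.mkℚᵘ (+ 1) n)

fromℕ-+ : ∀ m n → fromℕ (m ℕ.+ n) ≡ fromℕ m + fromℕ n
fromℕ-+ m n = toℚᵘ-injective (begin
  toℚᵘ (fromℕ (m ℕ.+ n))                       ≈⟨ toℚᵘ-fromℕ (m ℕ.+ n) ⟩
  ℚᵘ.mkℚᵘ (+ (m ℕ.+ n)) 0                      ≈⟨ ℚᵘ.*≡* (cong (ℤ._* + 1) (trans (ℤ.pos-+ m n)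
                                                   (sym (cong₂ ℤ._+_ (ℤ.*-identityʳ (+ m)) (ℤ.*-identityʳ (+ n)))))) ⟩
  ℚᵘ.mkℚᵘ (+ m) 0 ℚᵘ.+ ℚᵘ.mkℚᵘ (+ n) 0         ≈⟨ ℚᵘ.+-cong (toℚᵘ-fromℕ m) (toℚᵘ-fromℕ n) ⟨
  toℚᵘ (fromℕ m) ℚᵘ.+ toℚᵘ (fromℕ n)           ≈⟨ toℚᵘ-homo-+ (fromℕ m) (fromℕ n) ⟨
  toℚᵘ (fromℕ m + fromℕ n)                     ∎)
  where open ℚᵘ.≃-Reasoning

fromℕ-suc : ∀ n → fromℕ (suc n) ≡ 1ℚ + fromℕ n
fromℕ-suc = fromℕ-+ 1

0≤fromℕ : ∀ n → 0ℚ ≤ fromℕ n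
0≤fromℕ n = nonNegative⁻¹ (fromℕ n) {{normalize-nonNeg n 1}}

fromℕ-mono-≤ : ∀ {m n} → m ℕ.≤ n → fromℕ m ≤ fromℕ n
fromℕ-mono-≤ {m} {n} m≤n = subst (fromℕ m ≤_)
  (trans (sym (fromℕ-+ m (n ℕ.∸ m))) (cong fromℕ (ℕ.m+[n∸m]≡n m≤n))) (p≤p+q (0≤fromℕ (n ℕ.∸ m)))

0≤recip : ∀ n → 0ℚ ≤ recip n
0≤recip n = nonNegative⁻¹ (recip n) {{normalize-nonNeg 1 (suc n)}}

fromℕ*recip : ∀ n → fromℕ (suc n) * recip n ≡ 1ℚ
fromℕ*recip n = toℚᵘ-injective (begin
  toℚᵘ (fromℕ (suc n) * recip n)                ≈⟨ toℚᵘ-homo-* (fromℕ (suc n)) (recip n) ⟩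
  toℚᵘ (fromℕ (suc n)) ℚᵘ.* toℚᵘ (recip n)      ≈⟨ ℚᵘ.*-cong (toℚᵘ-fromℕ (suc n)) (toℚᵘ-recip n) ⟩
  ℚᵘ.mkℚᵘ (+ suc n) 0 ℚᵘ.* ℚᵘ.mkℚᵘ (+ 1) n      ≈⟨ ℚᵘ.*≡* (trans (ℤ.*-identityʳ _)
                                                     (trans (ℤ.*-comm (+ suc n) (+ 1)) (sym (ℤ.*-identityˡ _)))) ⟩
  toℚᵘ 1ℚ                                       ∎)
  where open ℚᵘ.≃-Reasoning

fromℕ*recip*q : ∀ n q → fromℕ (suc n) * (recip n * q) ≡ q
fromℕ*recip*q n q = trans (sym (*-assoc (fromℕ (suc n)) (recip n) q))
  (trans (cong (_* q) (fromℕ*recip n)) (*-identityˡ q))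

fromℕ-cancel : ∀ n {p q} → fromℕ (suc n) * p ≡ fromℕ (suc n) * q → p ≡ q
fromℕ-cancel n {p} {q} eq = trans (sym (undo p)) (trans (cong (recip n *_) eq) (undo q))
  where
  undo : ∀ p → recip n * (fromℕ (suc n) * p) ≡ p
  undo p = trans (lemma (recip n) (fromℕ (suc n)) p) (fromℕ*recip*q n p)
    where
    lemma : ∀ a b c → a * (b * c) ≡ b * (a * c)
    lemma = solve-∀ ℚ-ring

fromℕ-cancel-≤ : ∀ n {p q} → fromℕ (suc n) * p ≤ fromℕ (suc n) * q → p ≤ q
fromℕ-cancel-≤ n = *-cancelˡ-≤-pos (fromℕ (suc n)) {{normalize-pos (suc n) 1}}

recip-mono-≤ : ∀ {m n} → m ℕ.≤ n → recip n ≤ recip m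
recip-mono-≤ {m} {n} m≤n = begin
  recip n                                  ≡⟨ fromℕ*recip*q m (recip n) ⟨
  fromℕ (suc m) * (recip m * recip n)
    ≤⟨ *-monoʳ (*-nonNeg (0≤recip m) (0≤recip n)) (fromℕ-mono-≤ (ℕ.s≤s m≤n)) ⟩
  fromℕ (suc n) * (recip m * recip n)      ≡⟨ cong (fromℕ (suc n) *_) (*-comm (recip m) (recip n)) ⟩
  fromℕ (suc n) * (recip n * recip m)      ≡⟨ fromℕ*recip*q n (recip m) ⟩
  recip m                                  ∎
  where open ≤-Reasoning

recip-≤1 : ∀ n → recip n ≤ 1ℚ
recip-≤1 n = recip-mono-≤ {0} {n} ℕ.z≤n

abstract

  ∃recip≤ : ∀ ε → 0ℚ < ε → ∃ λ n → recip n ≤ ε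
  ∃recip≤ ε@(mkℚ (+ zero)   d c) 0<ε with positive {ε} 0<ε
  ... | ()
  -- The numerator is at least 1, so the denominator d + 1 of ε itself is large enough.
  ∃recip≤ ε@(mkℚ (+ suc k)  d c) 0<ε = d , toℚᵘ-cancel-≤ (ℚᵘ.≤-respˡ-≃ (ℚᵘ.≃-sym (toℚᵘ-recip d))
    (ℚᵘ.*≤* (ℤ.*-monoʳ-≤-nonNeg (+ suc d) (ℤ.+≤+ {1} {suc k} (ℕ.s≤s ℕ.z≤n)))))
  ∃recip≤ ε@(mkℚ ℤ.-[1+ k ] d c) 0<ε with positive {ε} 0<ε
  ... | ()

-- Rational sequences

Eventually : (ℕ → Set) → Set
Eventually P = ∃ λ N → ∀ n → N ℕ.≤ n → P n

always : ∀ {P} → (∀ n → P n) → Eventually P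
always p = 0 , λ n _ → p n

eventually-map : ∀ {P Q} → Eventually P → (∀ n → P n → Q n) → Eventually Q
eventually-map (N , p) f = N , λ n N≤n → f n (p n N≤n)

eventually-map₂ : ∀ {P Q R} → Eventually P → Eventually Q → (∀ n → P n → Q n → R n) → Eventually R
eventually-map₂ (M , p) (N , q) f = M ℕ.⊔ N , λ n h →
  f n (p n (ℕ.≤-trans (ℕ.m≤m⊔n M N) h)) (q n (ℕ.≤-trans (ℕ.m≤n⊔m M N) h))

eventually-≥ : ∀ k → Eventually (k ℕ.≤_)
eventually-≥ k = k , λ _ h → h

Null Bounded : (ℕ → ℚ) → Set
Null s    = ∀ ε → 0ℚ < ε → Eventually λ n → ∣ s n ∣ ≤ ε
Bounded s = ∃ λ b → Eventually λ n → ∣ s n ∣ ≤ b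

infix 4 _≋_

-- A record instead of a synonym for `Null`, so that both sequences can be inferred from the type.
record _≋_ (s t : ℕ → ℚ) : Set where
  constructor null⇒≋
  field ≋⇒null : Null λ n → s n - t n

open _≋_

-- The device for exchanging limits: a truncation order may be chosen from η and then kept fixed, so
-- the error t has to vanish only for that one order.
null-approx : ∀ {s} →
  (∀ η → 0ℚ < η → ∃ λ t → Null t × Eventually λ n → ∣ s n ∣ ≤ t n + η) → Null s
null-approx {s} approx ε 0<ε with approx (ε * ½) (0<½p 0<ε)
... | t , t-null , s≤t = eventually-map₂ s≤t (t-null (ε * ½) (0<½p 0<ε))
    (λ n h h′ → ≤-trans h (subst (t n + ε * ½ ≤_) (half+half ε) (+-monoˡ-≤ (ε * ½) (∣p∣≤b⇒p≤b h′))))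

null-zero : Null λ _ → 0ℚ
null-zero ε 0<ε = always λ _ → <⇒≤ 0<ε

null-+ : ∀ {s t} → Null s → Null t → Null λ n → s n + t n
null-+ {s} {t} s-null t-null ε 0<ε = eventually-map₂ (s-null (ε * ½) (0<½p 0<ε)) (t-null (ε * ½) (0<½p 0<ε))
    (λ n h h′ → subst (∣ s n + t n ∣ ≤_) (half+half ε) (∣p+q∣≤a+b {s n} {t n} h h′))

null-* : ∀ {s t} → Bounded s → Null t → Null λ n → s n * t n
null-* {s} {t} (b , s≤b) t-null ε 0<ε with shrink (0≤∣p∣ b) 0<ε
... | η , 0<η , bη≤ε = eventually-map₂ s≤b (t-null η 0<η)
    (λ n h h′ → ≤-trans (∣p*q∣≤a*b {s n} {t n} {∣ b ∣} {η} (≤-trans h (p≤∣p∣ b)) h′) bη≤ε)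

null-cong : ∀ {s t} → (∀ n → s n ≡ t n) → Null s → Null t
null-cong s≡t s-null ε 0<ε = eventually-map (s-null ε 0<ε) (λ n → subst (λ p → ∣ p ∣ ≤ ε) (s≡t n))

null-recip : Null recip
null-recip ε 0<ε with ∃recip≤ ε 0<ε
... | N , recip≤ε = N , λ n N≤n →
  subst (_≤ ε) (sym (0≤p⇒∣p∣≡p (0≤recip n))) (≤-trans (recip-mono-≤ N≤n) recip≤ε)

bounded-const : ∀ b → Bounded λ _ → b
bounded-const b = ∣ b ∣ , always λ _ → ≤-refl

bounded-- : ∀ {s} → Bounded s → Bounded λ n → - s n
bounded-- {s} (b , h) = b , eventually-map h (λ n → subst (_≤ b) (sym (∣-p∣≡∣p∣ (s n))))

bounded-+ : ∀ {s t} → Bounded s → Bounded t → Bounded λ n → s n + t n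
bounded-+ {s} {t} (a , s≤a) (b , t≤b) = a + b , eventually-map₂ s≤a t≤b (λ n → ∣p+q∣≤a+b {s n} {t n})

bounded-* : ∀ {s t} → Bounded s → Bounded t → Bounded λ n → s n * t n
bounded-* {s} {t} (a , s≤a) (b , t≤b) = a * b , eventually-map₂ s≤a t≤b (λ n → ∣p*q∣≤a*b {s n} {t n})

bounded-≋ : ∀ {s t} → s ≋ t → Bounded t → Bounded s
bounded-≋ {s} {t} s≋t (b , t≤b) = b + 1ℚ , eventually-map₂ (≋⇒null s≋t 1ℚ 0<1) t≤b
    (λ n h h′ → ≤-trans (∣p∣≤∣q∣+∣p-q∣ (s n) (t n)) (+-mono-≤ h′ h))

bounded-seq : ∀ x → Bounded (seq x)
bounded-seq x with cauchy x 1ℚ 0<1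
... | N , close = ∣ seq x N ∣ + 1ℚ , N , λ n N≤n → ≤-trans (∣p∣≤∣q∣+∣p-q∣ (seq x n) (seq x N))
  (+-monoʳ-≤ ∣ seq x N ∣ (<⇒≤ (close n N N≤n ℕ.≤-refl)))

≋-refl : ∀ {s} → s ≋ s
≋-refl {s} = null⇒≋ $ null-cong (λ n → sym (+-inverseʳ (s n))) null-zero

≋-sym : ∀ {s t} → s ≋ t → t ≋ s
≋-sym {s} {t} s≋t = null⇒≋ λ ε 0<ε → eventually-map (≋⇒null s≋t ε 0<ε) (λ n → subst (_≤ ε) (∣p-q∣≡∣q-p∣ (s n) (t n)))

≋-+ : ∀ {s s′ t t′} → s ≋ s′ → t ≋ t′ → (λ n → s n + t n) ≋ (λ n → s′ n + t′ n)
≋-+ {s} {s′} {t} {t′} s≋s′ t≋t′ = null⇒≋ $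
  null-cong (λ n → lemma (s n) (s′ n) (t n) (t′ n)) (null-+ (≋⇒null s≋s′) (≋⇒null t≋t′))
  where
  lemma : ∀ a a′ b b′ → (a - a′) + (b - b′) ≡ (a + b) - (a′ + b′)
  lemma = solve-∀ ℚ-ring

≋-* : ∀ {s s′ t t′} → Bounded s′ → Bounded t′ →
  s ≋ s′ → t ≋ t′ → (λ n → s n * t n) ≋ (λ n → s′ n * t′ n)
≋-* {s} {s′} {t} {t′} s′-bounded t′-bounded s≋s′ t≋t′ = null⇒≋ $
  null-cong (λ n → lemma (s n) (s′ n) (t n) (t′ n))
    (null-+ (null-* (bounded-≋ s≋s′ s′-bounded) (≋⇒null t≋t′)) (null-* t′-bounded (≋⇒null s≋s′)))
  where
  lemma : ∀ a a′ b b′ → a * (b - b′) + b′ * (a - a′) ≡ a * b - a′ * b′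
  lemma = solve-∀ ℚ-ring

≋-neg : ∀ {t t′} → t ≋ t′ → (λ n → - t n) ≋ (λ n → - t′ n)
≋-neg {t} {t′} t≋t′ = null⇒≋ $
  null-cong (λ n → lemma (t n) (t′ n)) (≋⇒null (≋-sym t≋t′))
  where
  lemma : ∀ p q → q - p ≡ - p - - q
  lemma = solve-∀ ℚ-ring

≋-*ˡ : ∀ {t t′} b → t ≋ t′ → (λ n → b * t n) ≋ (λ n → b * t′ n)
≋-*ˡ {t} {t′} b t≋t′ = null⇒≋ $
  null-cong (λ n → lemma b (t n) (t′ n)) (null-* (bounded-const b) (≋⇒null t≋t′))
  where
  lemma : ∀ b p q → b * (p - q) ≡ b * p - b * q
  lemma = solve-∀ ℚ-ring

-- Terms and partial sums of the exponential series

expTerm-suc : ∀ x m → fromℕ (suc m) * expTerm x (suc m) ≡ x * expTerm x m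
expTerm-suc x m = trans (lemma (fromℕ (suc m)) (expTerm x m) x (recip m)) (fromℕ*recip*q m (x * expTerm x m))
  where
  lemma : ∀ f t x r → f * (t * (x * r)) ≡ f * (r * (x * t))
  lemma = solve-∀ ℚ-ring

∣expTerm∣≤ : ∀ {x a} → ∣ x ∣ ≤ a → ∀ m → ∣ expTerm x m ∣ ≤ expTerm a m
∣expTerm∣≤ x≤a zero    = ≤-refl
∣expTerm∣≤ {x} {a} x≤a (suc m) = ∣p*q∣≤a*b {expTerm x m} {x * recip m} (∣expTerm∣≤ x≤a m)
  (∣p*q∣≤a*b {x} {recip m} x≤a (≤-reflexive (0≤p⇒∣p∣≡p (0≤recip m))))

0≤expTerm : ∀ {a} → 0ℚ ≤ a → ∀ m → 0ℚ ≤ expTerm a m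
0≤expTerm {a} 0≤a m = ≤-trans (0≤∣p∣ (expTerm a m)) (∣expTerm∣≤ (≤-reflexive (0≤p⇒∣p∣≡p 0≤a)) m)

expTerm-mono : ∀ {a b} → 0ℚ ≤ a → a ≤ b → ∀ m → expTerm a m ≤ expTerm b m
expTerm-mono {a} 0≤a a≤b m =
  ∣p∣≤b⇒p≤b (∣expTerm∣≤ (≤-trans (≤-reflexive (0≤p⇒∣p∣≡p 0≤a)) a≤b) m)

expTerm-scale : ∀ a x m → a ^ m * expTerm x m ≡ expTerm (a * x) m
expTerm-scale a x zero    = *-identityˡ 1ℚ
expTerm-scale a x (suc m) = trans (lemma a (a ^ m) (expTerm x m) x (recip m))
  (cong (_* (a * x * recip m)) (expTerm-scale a x m))
  where
  lemma : ∀ a p t x r → (a * p) * (t * (x * r)) ≡ (p * t) * (a * x * r)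
  lemma = solve-∀ ℚ-ring

expTerm-suc-≤ : ∀ {a} → 0ℚ ≤ a → ∀ m → expTerm a (suc m) ≤ a * expTerm a m
expTerm-suc-≤ {a} 0≤a m = subst (_≤ a * expTerm a m) (lemma (expTerm a m) a (recip m))
  (p*q≤p (*-nonNeg 0≤a (0≤expTerm 0≤a m)) (recip-≤1 m))
  where
  lemma : ∀ t a r → (a * t) * r ≡ t * (a * r)
  lemma = solve-∀ ℚ-ring

expTail : ∀ {x a} → ∣ x ∣ ≤ a → ∀ m n → m ℕ.≤′ n →
  ∣ expSum x n - expSum x m ∣ ≤ expSum a n - expSum a m
expTail {x} {a} x≤a m m ℕ.≤′-refl = ≤-reflexive
  (trans (cong ∣_∣ (+-inverseʳ (expSum x m))) (sym (+-inverseʳ (expSum a m))))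
expTail {x} {a} x≤a m (suc n) (ℕ.≤′-step m≤n) = subst₂ (λ p q → ∣ p ∣ ≤ q)
  (lemma (expSum x n) (expTerm x n) (expSum x m)) (lemma (expSum a n) (expTerm a n) (expSum a m))
  (∣p+q∣≤a+b (expTail x≤a m n m≤n) (∣expTerm∣≤ x≤a n))
  where
  lemma : ∀ s t u → (s - u) + t ≡ (s + t) - u
  lemma = solve-∀ ℚ-ring

abstract

  -- The Cauchy property of exp supplies the convergence of the majorising series.
  expTail-small : ∀ a ε → 0ℚ < ε → ∃ λ M → ∀ {x} → ∣ x ∣ ≤ a →
    ∀ m n → M ℕ.≤ m → m ℕ.≤ n → ∣ expSum x n - expSum x m ∣ ≤ ε
  expTail-small a ε 0<ε = let M , close = cauchy (exp (fromℚ a)) ε 0<ε in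
    M , λ x≤a m n M≤m m≤n → ≤-trans (expTail x≤a m n (ℕ.≤⇒≤′ m≤n))
      (∣p∣≤b⇒p≤b (<⇒≤ (close n m (ℕ.≤-trans M≤m m≤n) M≤m)))

-- A term is the difference of two consecutive partial sums.
expTerm-small : ∀ a ε → 0ℚ < ε → ∃ λ M → ∀ m → M ℕ.≤ m → expTerm a m ≤ ε
expTerm-small a ε 0<ε = let M , tail = expTail-small ∣ a ∣ ε 0<ε in
  M , λ m M≤m → ∣p∣≤b⇒p≤b (subst (λ p → ∣ p ∣ ≤ ε) (lemma (expSum a m) (expTerm a m))
    (tail {a} ≤-refl m (suc m) M≤m (ℕ.n≤1+n m)))
  where
  lemma : ∀ s t → (s + t) - s ≡ t
  lemma = solve-∀ ℚ-ring

expTerm-bounded : ∀ {t} → Bounded t → ∀ m → Bounded λ n → expTerm (t n) m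
expTerm-bounded (b , t≤b) m = expTerm b m , eventually-map t≤b (λ n h → ∣expTerm∣≤ h m)

expSum-bounded : ∀ {t} → Bounded t → ∀ m → Bounded λ n → expSum (t n) m
expSum-bounded t-bounded zero    = bounded-const 0ℚ
expSum-bounded t-bounded (suc m) = bounded-+ (expSum-bounded t-bounded m) (expTerm-bounded t-bounded m)

module _ {s t : ℕ → ℚ} (s≋t : s ≋ t) (t-bounded : Bounded t) where

  expTerm-≋ : ∀ m → (λ n → expTerm (s n) m) ≋ (λ n → expTerm (t n) m)
  expTerm-≋ zero    = ≋-refl
  expTerm-≋ (suc m) = ≋-* (expTerm-bounded t-bounded m) (bounded-* t-bounded (bounded-const (recip m)))
    (expTerm-≋ m) (≋-* t-bounded (bounded-const (recip m)) s≋t ≋-refl)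

  expSum-≋ : ∀ m → (λ n → expSum (s n) m) ≋ (λ n → expSum (t n) m)
  expSum-≋ zero    = ≋-refl
  expSum-≋ (suc m) = ≋-+ (expSum-≋ m) (expTerm-≋ m)

-- The second-order Taylor remainder of t_m(x) = x^m / m!, with t_{-1} = 0;
-- it satisfies m R_m = y R_{m-1} + (y − x)² t_{m-2}(x).
prevTerm : ℚ → ℕ → ℚ
prevTerm x zero    = 0ℚ
prevTerm x (suc m) = expTerm x m

prevTerm-suc : ∀ x m → fromℕ m * expTerm x m ≡ x * prevTerm x m
prevTerm-suc x zero    = trans (*-zeroˡ 1ℚ) (sym (*-zeroʳ x))
prevTerm-suc x (suc m) = expTerm-suc x m

taylor : ℚ → ℚ → ℕ → ℚ
taylor x d m = expTerm (x + d) m - (expTerm x m + d * prevTerm x m)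

taylor-suc : ∀ x d m →
  fromℕ (suc m) * taylor x d (suc m) ≡ (x + d) * taylor x d m + (d * d) * prevTerm x m
taylor-suc x d m = begin
  f′ * (ty′ - (tx′ + d * tx))                      ≡⟨ lemma₁ f′ ty′ tx′ d tx ⟩
  f′ * ty′ - (f′ * tx′ + d * (f′ * tx))
    ≡⟨ cong₂ (λ a b → a - (b + d * (f′ * tx))) (expTerm-suc (x + d) m) (expTerm-suc x m) ⟩
  y * ty - (x * tx + d * (f′ * tx))
    ≡⟨ cong (λ f → y * ty - (x * tx + d * (f * tx))) (fromℕ-suc m) ⟩
  y * ty - (x * tx + d * ((1ℚ + f) * tx))          ≡⟨ lemma₂ x d ty tx f ⟩
  y * (ty - tx) - d * (f * tx)                     ≡⟨ cong (λ a → y * (ty - tx) - d * a) (prevTerm-suc x m) ⟩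
  y * (ty - tx) - d * (x * px)                     ≡⟨ lemma₃ x d ty tx px ⟩
  y * (ty - (tx + d * px)) + (d * d) * px          ∎
  where
  open ≡-Reasoning
  y = x + d ; ty = expTerm y m ; tx = expTerm x m ; px = prevTerm x m
  ty′ = expTerm y (suc m) ; tx′ = expTerm x (suc m) ; f = fromℕ m ; f′ = fromℕ (suc m)
  lemma₁ : ∀ f a b d c → f * (a - (b + d * c)) ≡ f * a - (f * b + d * (f * c))
  lemma₁ = solve-∀ ℚ-ring
  lemma₂ : ∀ x d ty tx f → (x + d) * ty - (x * tx + d * ((1ℚ + f) * tx)) ≡ (x + d) * (ty - tx) - d * (f * tx)
  lemma₂ = solve-∀ ℚ-ring
  lemma₃ : ∀ x d ty tx px → (x + d) * (ty - tx) - d * (x * px) ≡ (x + d) * (ty - (tx + d * px)) + (d * d) * px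
  lemma₃ = solve-∀ ℚ-ring

taylor-0 : ∀ x d → taylor x d 0 ≡ 0ℚ
taylor-0 x d = lemma d
  where
  lemma : ∀ d → 1ℚ - (1ℚ + d * 0ℚ) ≡ 0ℚ
  lemma = solve-∀ ℚ-ring

taylor-1 : ∀ x d → taylor x d 1 ≡ 0ℚ
taylor-1 x d = fromℕ-cancel 0 (trans (taylor-suc x d 0)
  (trans (cong (λ r → (x + d) * r + d * d * 0ℚ) (taylor-0 x d)) (lemma (x + d) (d * d) (fromℕ 1))))
  where
  lemma : ∀ y e f → y * 0ℚ + e * 0ℚ ≡ f * 0ℚ
  lemma = solve-∀ ℚ-ring

0≤prevTerm : ∀ {x} → 0ℚ ≤ x → ∀ m → 0ℚ ≤ prevTerm x m
0≤prevTerm 0≤x zero    = ≤-refl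
0≤prevTerm 0≤x (suc m) = 0≤expTerm 0≤x m

-- Equivalently t_m(x) + d t_{m-1}(x) ≤ t_m(x + d). This inequality drives the induction on time in
-- `moment-≤` and the induction on k in `binom*^≤expTerm`.
taylor-nonNeg : ∀ {x d} → 0ℚ ≤ x → 0ℚ ≤ d → ∀ m → 0ℚ ≤ taylor x d m
taylor-nonNeg {x} {d} 0≤x 0≤d zero    = ≤-reflexive (sym (taylor-0 x d))
taylor-nonNeg {x} {d} 0≤x 0≤d (suc m) =
  fromℕ-cancel-≤ m (subst₂ _≤_ (sym (*-zeroʳ (fromℕ (suc m)))) (sym (taylor-suc x d m))
    (+-mono-≤ (*-nonNeg (+-mono-≤ 0≤x 0≤d) (taylor-nonNeg 0≤x 0≤d m))
      (*-nonNeg (*-nonNeg 0≤d 0≤d) (0≤prevTerm 0≤x m))))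

-- As x + d ≤ 1, each of the two summands in the recursion is at most d², and 2d² is absorbed by the
-- factor m once m ≥ 2. The orders 0 and 1, where that factor is too small, have zero remainder.
taylor-≤ : ∀ {x d} → 0ℚ ≤ x → 0ℚ ≤ d → x + d ≤ 1ℚ → ∀ m → taylor x d m ≤ d * d
taylor-≤ {x} {d} 0≤x 0≤d y≤1 zero       = ≤-trans (≤-reflexive (taylor-0 x d)) (*-nonNeg 0≤d 0≤d)
taylor-≤ {x} {d} 0≤x 0≤d y≤1 (suc zero) = ≤-trans (≤-reflexive (taylor-1 x d)) (*-nonNeg 0≤d 0≤d)
taylor-≤ {x} {d} 0≤x 0≤d y≤1 (suc m@(suc l)) = fromℕ-cancel-≤ m (begin
  f * taylor x d (suc m)                              ≡⟨ taylor-suc x d m ⟩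
  (x + d) * taylor x d m + (d * d) * expTerm x l      ≤⟨ +-mono-≤
    (≤-trans (*-mono-≤ (+-mono-≤ 0≤x 0≤d) (*-nonNeg 0≤d 0≤d) y≤1 (taylor-≤ 0≤x 0≤d y≤1 m)) (≤-reflexive (*-identityˡ (d * d))))
    (p*q≤p (*-nonNeg 0≤d 0≤d) (x^m/m!≤1 l)) ⟩
  d * d + d * d                                       ≡⟨ lemma (d * d) ⟩
  (1ℚ + 1ℚ) * (d * d)
    ≤⟨ *-monoʳ {fromℕ 2} (*-nonNeg 0≤d 0≤d) (fromℕ-mono-≤ {2} {suc m} (ℕ.s≤s (ℕ.s≤s ℕ.z≤n))) ⟩
  f * (d * d)                                         ∎)
  where
  open ≤-Reasoning
  f = fromℕ (suc m)
  lemma : ∀ a → a + a ≡ (1ℚ + 1ℚ) * a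
  lemma = solve-∀ ℚ-ring
  x≤1 : x ≤ 1ℚ
  x≤1 = ≤-trans (p≤p+q 0≤d) y≤1
  x^m/m!≤1 : ∀ l → expTerm x l ≤ 1ℚ
  x^m/m!≤1 zero    = ≤-refl
  x^m/m!≤1 (suc l) = ≤-trans (p*q≤p (0≤expTerm 0≤x l) (≤-trans (p*q≤p 0≤x (recip-≤1 l)) x≤1)) (x^m/m!≤1 l)

-- Cycles of permutations as lists

module _ {A : Set} where

  -- The list holds only the intermediate points. Distinctness is not part of the notion; in a
  -- `Shape` it comes from the covering of `allFin`.
  Path : (A → A) → A → List A → A → Set
  Path f a []       b = f a ≡ b
  Path f a (x ∷ xs) b = f a ≡ x × Path f x xs b

  path-++ : ∀ {f a b c} xs {ys} → Path f a xs b → Path f b ys c → Path f a (xs ++ b ∷ ys) c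
  path-++ []       p       q = p , q
  path-++ (x ∷ xs) (e , p) q = e , path-++ xs p q

  path-split : ∀ {f a b c} xs {ys} → Path f a (xs ++ b ∷ ys) c → Path f a xs b × Path f b ys c
  path-split []       (e , q) = e , q
  path-split (x ∷ xs) (e , p) = let p₁ , p₂ = path-split xs p in (e , p₁) , p₂

  -- Only the last arc is redirected. This is all that a transposition does to a path whose
  -- intermediate points it fixes.
  path-∘ : ∀ {f g : A → A} {a b} xs → All (λ x → g x ≡ x) xs → Path f a xs b → Path (g ∘ f) a xs (g b)
  path-∘ {g = g} []       []       p       = cong g p
  path-∘ {g = g} (x ∷ xs) (h ∷ hs) (e , p) = trans (cong g e) h , path-∘ xs hs p

  fold-suc : ∀ (f : A → A) a n → fold a f (suc n) ≡ fold (f a) f n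
  fold-suc f a zero    = refl
  fold-suc f a (suc n) = cong f (fold-suc f a n)

  path-lookup : ∀ {f a b} xs → Path f a xs b → ∀ i → fold a f (suc (toℕ i)) ≡ lookup xs i
  path-lookup (x ∷ xs) (e , p) Fin.zero    = e
  path-lookup {f} {a} (x ∷ xs) (refl , p) (Fin.suc i) =
    trans (fold-suc f a (suc (toℕ i))) (path-lookup xs p i)

  path-end : ∀ {f a b} xs → Path f a xs b → fold a f (suc (length xs)) ≡ b
  path-end []       p = p
  path-end {f} {a} (x ∷ xs) (refl , p) = trans (fold-suc f a (suc (length xs))) (path-end xs p)

  Cycle : (A → A) → A × List A → Set
  Cycle f (x , xs) = Path f x xs x

  elems : A × List A → List A
  elems (x , xs) = x ∷ xs

  size : A × List A → ℕ
  size (_ , xs) = suc (length xs)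

  flat : List (A × List A) → List A
  flat = concatMap elems

  rotate : ∀ {f} c {y} → y ∈ elems c → Cycle f c → ∃ λ ys → Cycle f (y , ys) × y ∷ ys ↭ elems c
  rotate (x , xs) (here refl) p = xs , p , ↭-refl
  rotate (x , xs) (there y∈xs) p with ∈-∃++ y∈xs
  ... | us , vs , refl = let p₁ , p₂ = path-split us p in
    vs ++ x ∷ us , path-++ vs p₂ p₁ , ++-comm (_ ∷ vs) (x ∷ us)

  Unique-resp-↭ : ∀ {xs ys : List A} → xs ↭ ys → Unique xs → Unique ys
  Unique-resp-↭ p = ↭ₛ.Unique-resp-↭ (setoid A) (↭⇒↭ₛ p)

  Unique-++⁻ʳ : ∀ (xs : List A) {ys} → Unique (xs ++ ys) → Unique ys
  Unique-++⁻ʳ []       u       = u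
  Unique-++⁻ʳ (x ∷ xs) (_ ∷ u) = Unique-++⁻ʳ xs u

  Unique-++⁻ˡ : ∀ (xs : List A) {ys} → Unique (xs ++ ys) → Unique xs
  Unique-++⁻ˡ []       u       = []
  Unique-++⁻ˡ (x ∷ xs) (h ∷ u) = All.++⁻ˡ xs h ∷ Unique-++⁻ˡ xs u

  length-filter-single : ∀ {P : Pred A 0ℓ} (P? : Decidable P) {xs m} → Unique xs → m ∈ xs → P m →
    (∀ {x} → x ∈ xs → P x → x ≡ m) → length (filter P? xs) ≡ 1
  length-filter-single P? {x ∷ xs} (x∉xs ∷ u) (here refl) Pm only =
    trans (cong length (List.filter-accept P? Pm)) (cong suc (cong length (List.filter-none P?
      (All.tabulate λ {y} y∈xs Py → All.lookup x∉xs y∈xs (sym (only (there y∈xs) Py))))))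
  length-filter-single P? {x ∷ xs} (x∉xs ∷ u) (there m∈xs) Pm only =
    trans (cong length (List.filter-reject P? λ Px → All.lookup x∉xs m∈xs (only (here refl) Px)))
      (length-filter-single P? u m∈xs Pm (only ∘ there))

minimum : ∀ {n} (x : Fin n) xs → ∃ λ m → m ∈ x ∷ xs × All (m Fin.≤_) (x ∷ xs)
minimum x []       = x , here refl , Fin.≤-refl ∷ []
minimum x (y ∷ ys) with minimum y ys
... | m , m∈ , m≤ with Fin.≤-total x m
...   | inj₁ x≤m = x , here refl , Fin.≤-refl ∷ All.map (Fin.≤-trans x≤m) m≤
...   | inj₂ m≤x = m , there m∈ , m≤x ∷ m≤

-- Counting the cycles of a given length

-- Reading only the boolean `does` lets comparisons of successors reduce by computation, on which
-- `diff-point-suc` and `below-suc` rely.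
indicator : ∀ {P : Set} → Dec P → ℕ
indicator d = if does d then 1 else 0

count : ℕ → List ℕ → ℕ
count j ls = sum (map (λ l → indicator (l ℕ.≟ j)) ls)

module _ {n} (π : Permutation′ n) where

  -- If the orbit closed before the list is exhausted, x would occur in `xs`. If it closed later, it
  -- would meet x at an intermediate time, where a point strictly above x is required.
  least⇒ : ∀ j {x xs} → Cycle (π ⟨$⟩ʳ_) (x , xs) → Unique (x ∷ xs) → LeastInCycle (suc j) π x →
    length xs ≡ j × All (x Fin.<_) xs
  least⇒ j {x} {xs} cycle (x∉xs ∷ _) (closed , below) with ℕ.<-cmp j (length xs)
  ... | tri< j<l _ _ = contradiction
    (trans (sym closed) (trans (cong (λ k → fold x (π ⟨$⟩ʳ_) (suc k)) (sym (Fin.toℕ-fromℕ< j<l)))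
      (path-lookup xs cycle (Fin.fromℕ< j<l))))
    (All.lookup x∉xs (∈-lookup (Fin.fromℕ< j<l)))
  ... | tri≈ _ refl _ = refl , All.tabulate λ {y} y∈xs →
    subst (x Fin.<_) (trans (path-lookup xs cycle (index y∈xs)) (sym (Any.lookup-index y∈xs)))
      (below (Fin.suc (index y∈xs)) (ℕ.s≤s ℕ.z≤n))
  ... | tri> _ _ l<j = contradiction
    (subst (x Fin.<_) (trans (cong (fold x (π ⟨$⟩ʳ_)) (Fin.toℕ-fromℕ< (ℕ.s≤s l<j))) (path-end xs cycle))
      (below (Fin.fromℕ< (ℕ.s≤s l<j)) (subst (0 ℕ.<_) (sym (Fin.toℕ-fromℕ< (ℕ.s≤s l<j))) (ℕ.s≤s ℕ.z≤n))))
    (Fin.<-irrefl refl)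

  least⇐ : ∀ {x xs} → Cycle (π ⟨$⟩ʳ_) (x , xs) → All (x Fin.<_) xs → LeastInCycle (suc (length xs)) π x
  least⇐ {x} {xs} cycle x<xs = path-end xs cycle , λ where
    (Fin.suc i) _ → subst (x Fin.<_) (sym (path-lookup xs cycle i)) (All.lookup x<xs (∈-lookup i))

  -- A cycle may be restarted at any of its points. Of these restarts exactly one, at the minimum,
  -- has all other points above its first point.
  count-cycle : ∀ j c → Cycle (π ⟨$⟩ʳ_) c → Unique (elems c) → (size? : Dec (size c ≡ suc j)) →
    length (filter (leastInCycle? (suc j) π) (elems c)) ≡ indicator size?
  count-cycle j c cycle unique (no size≢) = cong length (List.filter-none (leastInCycle? (suc j) π)
    (All.tabulate λ {y} y∈ least → let ys , cycle′ , p = rotate c y∈ cycle in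
      size≢ (trans (sym (↭-length p))
        (cong suc (proj₁ (least⇒ j cycle′ (Unique-resp-↭ (↭-sym p) unique) least))))))
  count-cycle j c@(x , xs) cycle unique (yes refl) with minimum x xs
  ... | m , m∈ , m≤ with rotate c m∈ cycle
  ...   | ys , cycle′ , p = length-filter-single (leastInCycle? (suc j) π) unique m∈
    (subst (λ k → LeastInCycle k π m) (↭-length p) (least⇐ cycle′ (m<ys (Unique-resp-↭ (↭-sym p) unique))))
    λ y∈ least → only y∈ (rotate c y∈ cycle) least
    where
    m<ys : Unique (m ∷ ys) → All (m Fin.<_) ys
    m<ys (m∉ys ∷ _) = All.tabulate λ {y} y∈ys → Fin.≤∧≢⇒<
      (All.lookup m≤ (∈-resp-↭ p (there y∈ys))) (All.lookup m∉ys y∈ys)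
    only : ∀ {y} → y ∈ elems c → (∃ λ zs → Cycle (π ⟨$⟩ʳ_) (y , zs) × y ∷ zs ↭ elems c) →
      LeastInCycle (suc j) π y → y ≡ m
    only {y} y∈ (zs , cycle″ , p′) least with ∈-resp-↭ (↭-sym p′) m∈
    ... | here m≡y   = sym m≡y
    ... | there m∈zs = contradiction
      (All.lookup (proj₂ (least⇒ j cycle″ (Unique-resp-↭ (↭-sym p′) unique) least)) m∈zs)
      (ℕ.≤⇒≯ (All.lookup m≤ y∈))

  count-cycles : ∀ j cs → All (Cycle (π ⟨$⟩ʳ_)) cs → Unique (flat cs) →
    length (filter (leastInCycle? (suc j) π) (flat cs)) ≡ count (suc j) (map size cs)
  count-cycles j []       []            _      = refl
  count-cycles j (c ∷ cs) (cycle ∷ cycles) unique = begin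
    length (filter P? (elems c ++ flat cs))
      ≡⟨ cong length (List.filter-++ P? (elems c) (flat cs)) ⟩
    length (filter P? (elems c) ++ filter P? (flat cs))           ≡⟨ List.length-++ (filter P? (elems c)) ⟩
    length (filter P? (elems c)) ℕ.+ length (filter P? (flat cs)) ≡⟨ cong₂ ℕ._+_
      (count-cycle j c cycle (Unique-++⁻ˡ (elems c) unique) (size c ℕ.≟ suc j))
      (count-cycles j cs cycles (Unique-++⁻ʳ (elems c) unique)) ⟩
    count (suc j) (map size (c ∷ cs))                             ∎
    where
    open ≡-Reasoning
    P? = leastInCycle? (suc j) π

-- The cycle of the centre 0 has length q + 1, and ls lists the lengths of the other cycles.
data Shape {n} (π : Permutation′ (suc n)) : ℕ → List ℕ → Set where
  shape : ∀ s cs → flat ((Fin.zero , s) ∷ cs) ↭ allFin (suc n) →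
    Cycle (π ⟨$⟩ʳ_) (Fin.zero , s) → All (Cycle (π ⟨$⟩ʳ_)) cs → Shape π (length s) (map size cs)

#cycles-shape : ∀ {n} {π : Permutation′ (suc n)} {q ls} → Shape π q ls →
  ∀ j → #cycles (suc j) π ≡ count (suc j) (suc q ∷ ls)
#cycles-shape {n} {π} (shape s cs cover cycle cycles) j = trans
  (↭-length (filter-↭ (leastInCycle? (suc j) π) (↭-sym cover)))
  (count-cycles π j ((Fin.zero , s) ∷ cs) (cycle ∷ cycles) (Unique-resp-↭ (↭-sym cover) (allFin⁺ (suc n))))

shape-id : ∀ n → Shape {n} Perm.id 0 (map size (map (λ i → Fin.suc i , []) (allFin n)))
shape-id n = shape [] fixed (↭-reflexive (cong (Fin.zero ∷_) (trans (flat-fixed (allFin n)) (List.map-tabulate id Fin.suc)))) refl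
  (All.map⁺ (All.universal (λ _ → refl) (allFin n)))
  where
  fixed = map (λ i → Fin.suc i , []) (allFin n)
  flat-fixed : ∀ is → flat (map (λ i → Fin.suc i , []) is) ≡ map Fin.suc is
  flat-fixed []       = refl
  flat-fixed (i ∷ is) = cong (Fin.suc i ∷_) (flat-fixed is)

-- One step of the walk on the cycle structure

transpose-matchʳ : ∀ {n} (i j : Fin n) → PC.transpose i j j ≡ i
transpose-matchʳ i j with j Fin.≟ i
... | yes j≡i = j≡i
... | no _ rewrite dec-true (j Fin.≟ j) refl = refl

transpose-other : ∀ {n} {i j k : Fin n} → k ≢ i → k ≢ j → PC.transpose i j k ≡ k
transpose-other {i = i} {j} {k} k≢i k≢j
  rewrite dec-false (k Fin.≟ i) k≢i | dec-false (k Fin.≟ j) k≢j = refl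

flat-++ : ∀ {A : Set} (cs ds : List (A × List A)) → flat (cs ++ ds) ≡ flat cs ++ flat ds
flat-++ = List.concatMap-++ elems

module _ {n} (π : Permutation′ (suc n)) (y : Fin (suc n)) where

  private
    τ : Fin (suc n) → Fin (suc n)
    τ = PC.transpose Fin.zero y

  step-fixed : ∀ {rest} → Fin.zero ∷ y ∷ rest ↭ allFin (suc n) → All (λ x → τ x ≡ x) rest
  step-fixed p with Unique-resp-↭ (↭-sym p) (allFin⁺ (suc n))
  ... | (_ ∷ 0∉rest) ∷ (y∉rest ∷ _) =
    All.zipWith (λ (0≢x , y≢x) → transpose-other (0≢x ∘ sym) (y≢x ∘ sym)) (0∉rest , y∉rest)

  step-cycles : ∀ cs → All (λ x → τ x ≡ x) (flat cs) → All (Cycle (π ⟨$⟩ʳ_)) cs →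
    All (Cycle ((π ∘ₚ transpose Fin.zero y) ⟨$⟩ʳ_)) cs
  step-cycles []              _     []               = []
  step-cycles ((x , xs) ∷ cs) (τx ∷ fixed) (cycle ∷ cycles) =
    subst (Path _ x xs) τx (path-∘ xs (All.++⁻ˡ xs fixed) cycle) ∷
    step-cycles cs (All.++⁻ʳ xs fixed) cycles

  -- The transposition acts after π, so the arc into y now enters the centre and the arc into the
  -- centre now enters y. This cuts off the segment that begins at y.
  shape-split : ∀ u v cs → flat ((Fin.zero , u ++ y ∷ v) ∷ cs) ↭ allFin (suc n) →
    Cycle (π ⟨$⟩ʳ_) (Fin.zero , u ++ y ∷ v) → All (Cycle (π ⟨$⟩ʳ_)) cs →
    Shape (π ∘ₚ transpose Fin.zero y) (length u) (suc (length v) ∷ map size cs)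
  shape-split u v cs cover cycle cycles = let p , q = path-split u cycle in
    shape u ((y , v) ∷ cs) cover′
      (subst (Path _ _ u) (transpose-matchʳ Fin.zero y) (path-∘ u (All.++⁻ˡ u fixed) p))
      (path-∘ v (All.++⁻ˡ v (All.++⁻ʳ u fixed)) q ∷ step-cycles cs (All.++⁻ʳ v (All.++⁻ʳ u fixed)) cycles)
    where
    cover′ : Fin.zero ∷ u ++ y ∷ v ++ flat cs ↭ allFin (suc n)
    cover′ = subst (λ zs → Fin.zero ∷ zs ↭ allFin (suc n)) (List.++-assoc u (y ∷ v) (flat cs)) cover
    fixed : All (λ x → τ x ≡ x) (u ++ v ++ flat cs)
    fixed = step-fixed (↭-trans (prep Fin.zero (↭-sym (shift y u (v ++ flat cs)))) cover′)

  -- The same two arcs are redirected as in a split. With y on another cycle, restarted at y, this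
  -- inserts the whole of that cycle after `s`.
  shape-merge : ∀ s as c bs → y ∈ elems c → flat ((Fin.zero , s) ∷ as ++ c ∷ bs) ↭ allFin (suc n) →
    Cycle (π ⟨$⟩ʳ_) (Fin.zero , s) → All (Cycle (π ⟨$⟩ʳ_)) (as ++ c ∷ bs) →
    Shape (π ∘ₚ transpose Fin.zero y) (length s ℕ.+ size c) (map size (as ++ bs))
  shape-merge s as c bs y∈c cover cycle cycles with rotate c y∈c (All.head (All.++⁻ʳ as cycles))
  ... | d , cycle-c , d↭c = subst (λ q → Shape (π ∘ₚ transpose Fin.zero y) q (map size (as ++ bs)))
    (trans (List.length-++ s) (cong (length s ℕ.+_) (↭-length d↭c)))
    (shape (s ++ y ∷ d) (as ++ bs) cover′
      (path-++ s (path-∘ s (All.++⁻ˡ s fixed) cycle)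
        (subst (Path _ y d) (transpose-matchʳ Fin.zero y) (path-∘ d (All.++⁻ˡ d (All.++⁻ʳ s fixed)) cycle-c)))
      (step-cycles (as ++ bs) (All.++⁻ʳ d (All.++⁻ʳ s fixed))
        (All.++⁺ (All.++⁻ˡ as cycles) (All.tail (All.++⁻ʳ as cycles)))))
    where
    open ↭.PermutationReasoning
    cover′ : Fin.zero ∷ (s ++ y ∷ d) ++ flat (as ++ bs) ↭ allFin (suc n)
    cover′ = begin
      Fin.zero ∷ (s ++ y ∷ d) ++ flat (as ++ bs)          ≡⟨ cong (Fin.zero ∷_) (List.++-assoc s (y ∷ d) _) ⟩
      (Fin.zero ∷ s) ++ (y ∷ d) ++ flat (as ++ bs)        ↭⟨ ++⁺ˡ (Fin.zero ∷ s) (++⁺ʳ _ d↭c) ⟩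
      (Fin.zero ∷ s) ++ elems c ++ flat (as ++ bs)
        ≡⟨ cong (λ zs → (Fin.zero ∷ s) ++ elems c ++ zs) (flat-++ as bs) ⟩
      (Fin.zero ∷ s) ++ elems c ++ flat as ++ flat bs
        ≡⟨ cong ((Fin.zero ∷ s) ++_) (List.++-assoc (elems c) (flat as) _) ⟨
      (Fin.zero ∷ s) ++ (elems c ++ flat as) ++ flat bs
        ↭⟨ ++⁺ˡ (Fin.zero ∷ s) (++⁺ʳ (flat bs) (++-comm (elems c) (flat as))) ⟩
      (Fin.zero ∷ s) ++ (flat as ++ elems c) ++ flat bs
        ≡⟨ cong ((Fin.zero ∷ s) ++_) (List.++-assoc (flat as) (elems c) _) ⟩
      (Fin.zero ∷ s) ++ flat as ++ flat (c ∷ bs)          ≡⟨ cong ((Fin.zero ∷ s) ++_) (flat-++ as (c ∷ bs)) ⟨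
      (Fin.zero ∷ s) ++ flat (as ++ c ∷ bs)               ↭⟨ cover ⟩
      allFin (suc n)                                      ∎
    fixed : All (λ x → τ x ≡ x) (s ++ d ++ flat (as ++ bs))
    fixed = step-fixed (↭-trans (prep Fin.zero (↭-sym (shift y s (d ++ flat (as ++ bs)))))
      (subst (λ zs → Fin.zero ∷ zs ↭ allFin (suc n)) (List.++-assoc s (y ∷ d) _) cover′))

∑ : ∀ {A : Set} → (A → ℚ) → List A → ℚ
∑ f []       = 0ℚ
∑ f (x ∷ xs) = f x + ∑ f xs

module _ {A : Set} where

  ∑-++ : ∀ (f : A → ℚ) xs ys → ∑ f (xs ++ ys) ≡ ∑ f xs + ∑ f ys
  ∑-++ f []       ys = sym (+-identityˡ _)
  ∑-++ f (x ∷ xs) ys = trans (cong (_+_ (f x)) (∑-++ f xs ys)) (sym (+-assoc (f x) _ _))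

  ∑-↭ : ∀ (f : A → ℚ) {xs ys} → xs ↭ ys → ∑ f xs ≡ ∑ f ys
  ∑-↭ f ↭.refl         = refl
  ∑-↭ f (↭.prep x p)   = cong (_+_ (f x)) (∑-↭ f p)
  ∑-↭ f (↭.swap {xs} {ys} x y p) = trans (lemma (f x) (f y) (∑ f xs)) (cong (λ r → f y + (f x + r)) (∑-↭ f p))
    where
    lemma : ∀ a b c → a + (b + c) ≡ b + (a + c)
    lemma = solve-∀ ℚ-ring
  ∑-↭ f (↭.trans p q)  = trans (∑-↭ f p) (∑-↭ f q)

  ∑-map : ∀ {B : Set} (f : A → ℚ) (g : B → A) xs → ∑ f (map g xs) ≡ ∑ (f ∘ g) xs
  ∑-map f g []       = refl
  ∑-map f g (x ∷ xs) = cong (_+_ (f (g x))) (∑-map f g xs)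

  ∑-const : ∀ (f : A → ℚ) b xs → (∀ {x} → x ∈ xs → f x ≡ b) → ∑ f xs ≡ fromℕ (length xs) * b
  ∑-const f b []       eq = sym (*-zeroˡ b)
  ∑-const f b (x ∷ xs) eq = begin
    f x + ∑ f xs                        ≡⟨ cong₂ _+_ (eq (here refl)) (∑-const f b xs (eq ∘ there)) ⟩
    b + fromℕ (length xs) * b           ≡⟨ lemma b (fromℕ (length xs)) ⟩
    (1ℚ + fromℕ (length xs)) * b        ≡⟨ cong (_* b) (fromℕ-suc (length xs)) ⟨
    fromℕ (suc (length xs)) * b         ∎
    where
    open ≡-Reasoning
    lemma : ∀ b l → b + l * b ≡ (1ℚ + l) * b
    lemma = solve-∀ ℚ-ring

-- Σ_{p < q} g p (q − p)
splitSum : (ℕ → ℕ → ℚ) → ℕ → ℚ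
splitSum g zero    = 0ℚ
splitSum g (suc q) = g 0 (suc q) + splitSum (λ p → g (suc p)) q

-- Σ over the entries l of ls of l · g l (the rest of ls)
mergeSum : (ℕ → List ℕ → ℚ) → List ℕ → ℚ
mergeSum g []       = 0ℚ
mergeSum g (l ∷ ls) = fromℕ l * g l ls + mergeSum (λ k ks → g k (l ∷ ks)) ls

stepSum : (ℕ → List ℕ → ℚ) → ℕ → List ℕ → ℚ
stepSum f q ls = splitSum (λ p l → f p (l ∷ ls)) q + mergeSum (λ l → f (q ℕ.+ l)) ls

∑-splits : ∀ {A : Set} (G : A → ℚ) g v →
  (∀ u y w → v ≡ u ++ y ∷ w → G y ≡ g (length u) (suc (length w))) → ∑ G v ≡ splitSum g (length v)
∑-splits G g []      eq = refl
∑-splits G g (y ∷ v) eq = cong₂ _+_ (eq [] y v refl)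
  (∑-splits G (λ p → g (suc p)) v λ u z w v≡ → eq (y ∷ u) z w (cong (y ∷_) v≡))

-- Merging through any point of a given cycle has the same effect on the lengths, whence the factor
-- l in `mergeSum`.
∑-merges : ∀ {A : Set} (G : A → ℚ) g cs →
  (∀ as c bs → cs ≡ as ++ c ∷ bs → ∀ {y} → y ∈ elems c → G y ≡ g (size c) (map size (as ++ bs))) →
  ∑ G (flat cs) ≡ mergeSum g (map size cs)
∑-merges G g []       eq = refl
∑-merges G g (c ∷ cs) eq = trans (∑-++ G (elems c) (flat cs)) (cong₂ _+_
  (∑-const G (g (size c) (map size cs)) (elems c) (eq [] c cs refl))
  (∑-merges G (λ k ks → g k (size c ∷ ks)) cs λ as d bs cs≡ → eq (c ∷ as) d bs (cong (c ∷_) cs≡)))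

-- Lumpability: the sum over all moves depends on π only through its cycle type, so the cycle type
-- performs a Markov chain of its own.
∑-star : ∀ {n} {π : Permutation′ (suc n)} {q ls} → Shape π q ls →
  ∀ (F : Permutation′ (suc n) → ℚ) f → (∀ {ρ p ks} → Shape ρ p ks → F ρ ≡ f p ks) →
  ∑ (λ i → F (π ∘ₚ transpose Fin.zero (Fin.suc i))) (allFin n) ≡ stepSum f q ls
∑-star {n} {π} (shape s cs cover cycle cycles) F f F≡f = begin
  ∑ (G ∘ Fin.suc) (allFin n)       ≡⟨ ∑-map G Fin.suc (allFin n) ⟨
  ∑ G (map Fin.suc (allFin n))     ≡⟨ cong (∑ G) (List.map-tabulate id Fin.suc) ⟩
  -- Both sides of `cover` start with the centre; without it, the other points are enumerated cycle
  -- by cycle.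
  ∑ G (tabulate Fin.suc)           ≡⟨ ∑-↭ G (drop-∷ cover) ⟨
  ∑ G (s ++ flat cs)               ≡⟨ ∑-++ G s (flat cs) ⟩
  ∑ G s + ∑ G (flat cs)            ≡⟨ cong₂ _+_
    (∑-splits G (λ p l → f p (l ∷ map size cs)) s λ { u y w refl → F≡f (shape-split π y u w cs cover cycle cycles) })
    (∑-merges G (λ l → f (length s ℕ.+ l)) cs λ { as c bs refl y∈c → F≡f (shape-merge π _ s as c bs y∈c cover cycle cycles) }) ⟩
  stepSum f (length s) (map size cs) ∎
  where
  open ≡-Reasoning
  G : Fin (suc n) → ℚ
  G y = F (π ∘ₚ transpose Fin.zero y)

-- Binomial coefficients and Newton's forward difference formula

binom : ℕ → ℕ → ℚ
binom x       zero    = 1ℚ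
binom zero    (suc m) = 0ℚ
binom (suc x) (suc m) = binom x m + binom x (suc m)

0≤binom : ∀ x m → 0ℚ ≤ binom x m
0≤binom x       zero    = 0≤1
0≤binom zero    (suc m) = ≤-refl
0≤binom (suc x) (suc m) = +-mono-≤ (0≤binom x m) (0≤binom x (suc m))

binom-suc-≤ : ∀ x m → binom x m ≤ binom (suc x) m
binom-suc-≤ x zero    = ≤-refl
binom-suc-≤ x (suc m) = p≤q+p (0≤binom x m)

-- The subtraction is rational, so x < m needs no separate treatment: there both binomials vanish.
binom-sucʳ : ∀ x m → fromℕ (suc m) * binom x (suc m) ≡ (fromℕ x - fromℕ m) * binom x m
binom-sucʳ zero zero    = refl
binom-sucʳ zero (suc m) = lemma (fromℕ (suc (suc m))) (fromℕ 0 - fromℕ (suc m))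
  where
  lemma : ∀ a b → a * 0ℚ ≡ b * 0ℚ
  lemma = solve-∀ ℚ-ring
binom-sucʳ (suc x) zero = begin
  1ℚ * (1ℚ + binom x 1)             ≡⟨ *-distribˡ-+ 1ℚ 1ℚ (binom x 1) ⟩
  1ℚ + 1ℚ * binom x 1               ≡⟨ cong (_+_ 1ℚ) (binom-sucʳ x 0) ⟩
  1ℚ + (fromℕ x - 0ℚ) * 1ℚ          ≡⟨ lemma (fromℕ x) ⟩
  (1ℚ + fromℕ x - 0ℚ) * 1ℚ          ≡⟨ cong (λ a → (a - 0ℚ) * 1ℚ) (fromℕ-suc x) ⟨
  (fromℕ (suc x) - 0ℚ) * 1ℚ         ∎
  where
  open ≡-Reasoning
  lemma : ∀ a → 1ℚ + (a - 0ℚ) * 1ℚ ≡ (1ℚ + a - 0ℚ) * 1ℚ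
  lemma = solve-∀ ℚ-ring
binom-sucʳ (suc x) (suc m) = begin
  f₂ * (b₁ + binom x (suc (suc m)))                    ≡⟨ *-distribˡ-+ f₂ b₁ _ ⟩
  f₂ * b₁ + f₂ * binom x (suc (suc m))
    ≡⟨ cong₂ (λ f r → f * b₁ + r) (fromℕ-suc (suc m)) (binom-sucʳ x (suc m)) ⟩
  (1ℚ + f₁) * b₁ + (fx - f₁) * b₁
    ≡⟨ cong (λ f → (1ℚ + f) * b₁ + (fx - f) * b₁) (fromℕ-suc m) ⟩
  (1ℚ + (1ℚ + f)) * b₁ + (fx - (1ℚ + f)) * b₁          ≡⟨ lemma₁ fx f b₁ ⟩
  (1ℚ + f) * b₁ + (fx - f) * b₁                        ≡⟨ cong (λ g → g * b₁ + (fx - f) * b₁) (fromℕ-suc m) ⟨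
  f₁ * b₁ + (fx - f) * b₁                              ≡⟨ cong (_+ (fx - f) * b₁) (binom-sucʳ x m) ⟩
  (fx - f) * b + (fx - f) * b₁                         ≡⟨ lemma₂ fx f b b₁ ⟩
  ((1ℚ + fx) - (1ℚ + f)) * (b + b₁)
    ≡⟨ cong₂ (λ g h → (g - h) * (b + b₁)) (fromℕ-suc x) (fromℕ-suc m) ⟨
  (fromℕ (suc x) - f₁) * (b + b₁)                      ∎
  where
  open ≡-Reasoning
  fx = fromℕ x ; f = fromℕ m ; f₁ = fromℕ (suc m) ; f₂ = fromℕ (suc (suc m))
  b = binom x m ; b₁ = binom x (suc m)
  lemma₁ : ∀ x f b → (1ℚ + (1ℚ + f)) * b + (x - (1ℚ + f)) * b ≡ (1ℚ + f) * b + (x - f) * b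
  lemma₁ = solve-∀ ℚ-ring
  lemma₂ : ∀ x f b c → (x - f) * b + (x - f) * c ≡ ((1ℚ + x) - (1ℚ + f)) * (b + c)
  lemma₂ = solve-∀ ℚ-ring

binom-absorb : ∀ x m → fromℕ (suc x) * binom x m ≡ fromℕ (suc m) * binom (suc x) (suc m)
binom-absorb x m = sym (begin
  f₁ * (b + binom x (suc m))            ≡⟨ *-distribˡ-+ f₁ b _ ⟩
  f₁ * b + f₁ * binom x (suc m)         ≡⟨ cong₂ (λ g r → g * b + r) (fromℕ-suc m) (binom-sucʳ x m) ⟩
  (1ℚ + f) * b + (fromℕ x - f) * b      ≡⟨ lemma (fromℕ x) f b ⟩
  (1ℚ + fromℕ x) * b                    ≡⟨ cong (_* b) (fromℕ-suc x) ⟨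
  fromℕ (suc x) * b                     ∎)
  where
  open ≡-Reasoning
  f = fromℕ m ; f₁ = fromℕ (suc m) ; b = binom x m
  lemma : ∀ x f b → (1ℚ + f) * b + (x - f) * b ≡ (1ℚ + x) * b
  lemma = solve-∀ ℚ-ring

diff : ℕ → (ℕ → ℚ) → ℕ → ℚ
diff zero    φ x = φ x
diff (suc m) φ x = diff m φ (suc x) - diff m φ x

diff-comm : ∀ m φ x → diff m (diff 1 φ) x ≡ diff (suc m) φ x
diff-comm zero    φ x = refl
diff-comm (suc m) φ x = cong₂ _-_ (diff-comm m φ (suc x)) (diff-comm m φ x)

sumTo : ℕ → (ℕ → ℚ) → ℚ
sumTo zero    a = 0ℚ
sumTo (suc M) a = sumTo M a + a M

newton : (ℕ → ℚ) → ℕ → ℕ → ℚ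
newton φ M x = sumTo M λ m → diff m φ 0 * binom x m

newton-0 : ∀ φ M → newton φ (suc M) 0 ≡ φ 0
newton-0 φ zero    = lemma (φ 0)
  where
  lemma : ∀ a → 0ℚ + a * 1ℚ ≡ a
  lemma = solve-∀ ℚ-ring
newton-0 φ (suc M) = trans (cong (_+_ (newton φ (suc M) 0)) (*-zeroʳ (diff (suc M) φ 0)))
  (trans (+-identityʳ _) (newton-0 φ M))

newton-suc : ∀ φ M x → newton φ (suc M) (suc x) ≡ newton φ (suc M) x + newton (diff 1 φ) M x
newton-suc φ zero    x = sym (+-identityʳ _)
newton-suc φ (suc M) x = begin
  newton φ (suc M) (suc x) + d * (b + b₁)
    ≡⟨ cong (_+ d * (b + b₁)) (newton-suc φ M x) ⟩
  newton φ (suc M) x + newton (diff 1 φ) M x + d * (b + b₁)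
    ≡⟨ lemma (newton φ (suc M) x) (newton (diff 1 φ) M x) d b b₁ ⟩
  newton φ (suc M) x + d * b₁ + (newton (diff 1 φ) M x + d * b)
    ≡⟨ cong (λ e → newton φ (suc M) x + d * b₁ + (newton (diff 1 φ) M x + e * b)) (diff-comm M φ 0) ⟨
  newton φ (suc (suc M)) x + newton (diff 1 φ) (suc M) x           ∎
  where
  open ≡-Reasoning
  d = diff (suc M) φ 0 ; b = binom x M ; b₁ = binom x (suc M)
  lemma : ∀ p q d b c → p + q + d * (b + c) ≡ p + d * c + (q + d * b)
  lemma = solve-∀ ℚ-ring

-- Passing from x to x + 1 adds the remainder of `diff 1 φ` of order one less, and Pascal's rule
-- adds the two bounds. At x = 0 an expansion of positive order is exact.
newton-remainder : ∀ M φ B → (∀ x → ∣ diff M φ x ∣ ≤ B) → ∀ x → ∣ φ x - newton φ M x ∣ ≤ B * binom x M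
newton-remainder zero φ B bound x =
  subst₂ _≤_ (cong ∣_∣ (sym (+-identityʳ (φ x)))) (sym (*-identityʳ B)) (bound x)
newton-remainder (suc M) φ B bound zero = ≤-reflexive (begin
  ∣ φ 0 - newton φ (suc M) 0 ∣   ≡⟨ cong (λ r → ∣ φ 0 - r ∣) (newton-0 φ M) ⟩
  ∣ φ 0 - φ 0 ∣                  ≡⟨ cong ∣_∣ (+-inverseʳ (φ 0)) ⟩
  0ℚ                             ≡⟨ *-zeroʳ B ⟨
  B * 0ℚ                         ∎)
  where open ≡-Reasoning
newton-remainder (suc M) φ B bound (suc x) = subst₂ (λ p q → ∣ p ∣ ≤ q)
  (trans (lemma (φ x) (φ (suc x)) (newton φ (suc M) x) (newton (diff 1 φ) M x))
    (cong (λ r → φ (suc x) - r) (sym (newton-suc φ M x))))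
  (trans (+-comm (B * binom x (suc M)) _) (sym (*-distribˡ-+ B (binom x M) (binom x (suc M)))))
  (∣p+q∣≤a+b {φ x - newton φ (suc M) x} {diff 1 φ x - newton (diff 1 φ) M x}
    (newton-remainder (suc M) φ B bound x)
    (newton-remainder M (diff 1 φ) B (λ y → subst (λ p → ∣ p ∣ ≤ B) (sym (diff-comm M φ y)) (bound y)) x))
  where
  lemma : ∀ a b m n → (a - m) + ((b - a) - n) ≡ b - (m + n)
  lemma = solve-∀ ℚ-ring

diff-bound : ∀ φ → (∀ x → ∣ φ x ∣ ≤ 1ℚ) → ∀ m x → ∣ diff m φ x ∣ ≤ fromℕ 2 ^ m
diff-bound φ φ≤1 zero    x = φ≤1 x
diff-bound φ φ≤1 (suc m) x = subst (∣ diff (suc m) φ x ∣ ≤_) (lemma (fromℕ 2 ^ m))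
  (∣p-q∣≤a+b {diff m φ (suc x)} {diff m φ x} (diff-bound φ φ≤1 m (suc x)) (diff-bound φ φ≤1 m x))
  where
  lemma : ∀ a → a + a ≡ (1ℚ + 1ℚ) * a
  lemma = solve-∀ ℚ-ring

-- Powers are eigenfunctions of the difference operator, which turns their Newton expansion into the
-- binomial theorem for (1 + (p - 1))ˣ.
diff-power : ∀ p m x → diff m (p ^_) x ≡ (p - 1ℚ) ^ m * p ^ x
diff-power p zero    x = sym (*-identityˡ (p ^ x))
diff-power p (suc m) x = trans (cong₂ _-_ (diff-power p m (suc x)) (diff-power p m x))
  (lemma p ((p - 1ℚ) ^ m) (p ^ x))
  where
  lemma : ∀ p a b → a * (p * b) - a * b ≡ ((p - 1ℚ) * a) * b
  lemma = solve-∀ ℚ-ring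

point : ℕ → ℕ → ℚ
point i x = fromℕ (indicator (x ℕ.≟ i))

diff-point-suc : ∀ m i x → diff m (point (suc i)) (suc x) ≡ diff m (point i) x
diff-point-suc zero    i x = refl
diff-point-suc (suc m) i x = cong₂ _-_ (diff-point-suc m i (suc x)) (diff-point-suc m i x)

diff-point-0 : ∀ m x → diff m (point 0) (suc x) ≡ 0ℚ
diff-point-0 zero    x = refl
diff-point-0 (suc m) x = cong₂ _-_ (diff-point-0 m (suc x)) (diff-point-0 m x)

diff-point-< : ∀ {m i} → m ℕ.< i → diff m (point i) 0 ≡ 0ℚ
diff-point-< {zero}  {suc i} _           = refl
diff-point-< {suc m} {suc i} (ℕ.s≤s m<i) = cong₂ _-_
  (trans (diff-point-suc m i 0) (diff-point-< m<i)) (diff-point-< (ℕ.m≤n⇒m≤1+n m<i))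

-- Σ_m (Δᵐ 1_{i})(0) λᵐ/m! is the Poisson weight e^{-λ} λⁱ/i!, term by term.
diff-point-term : ∀ x i l → diff (i ℕ.+ l) (point i) 0 * expTerm x (i ℕ.+ l) ≡ expTerm x i * expTerm (- x) l
diff-point-term x zero zero = refl
diff-point-term x zero (suc l) = fromℕ-cancel l (begin
  f * ((diff l (point 0) 1 - d) * t₁)           ≡⟨ cong (λ e → f * ((e - d) * t₁)) (diff-point-0 l 0) ⟩
  f * ((0ℚ - d) * t₁)                           ≡⟨ lemma₁ f d t₁ ⟩
  - (d * (f * t₁))                              ≡⟨ cong (λ e → - (d * e)) (expTerm-suc x l) ⟩
  - (d * (x * t))                               ≡⟨ lemma₂ d x t ⟩
  (- x) * (d * t)                               ≡⟨ cong ((- x) *_) (diff-point-term x zero l) ⟩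
  (- x) * (1ℚ * expTerm (- x) l)                ≡⟨ cong ((- x) *_) (*-identityˡ (expTerm (- x) l)) ⟩
  (- x) * expTerm (- x) l                       ≡⟨ expTerm-suc (- x) l ⟨
  f * expTerm (- x) (suc l)                     ≡⟨ cong (f *_) (*-identityˡ (expTerm (- x) (suc l))) ⟨
  f * (1ℚ * expTerm (- x) (suc l))              ∎)
  where
  open ≡-Reasoning
  f = fromℕ (suc l) ; d = diff l (point 0) 0 ; t = expTerm x l ; t₁ = expTerm x (suc l)
  lemma₁ : ∀ f d t → f * ((0ℚ - d) * t) ≡ - (d * (f * t))
  lemma₁ = solve-∀ ℚ-ring
  lemma₂ : ∀ d x t → - (d * (x * t)) ≡ (- x) * (d * t)
  lemma₂ = solve-∀ ℚ-ring
diff-point-term x (suc i) l = fromℕ-cancel m (begin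
  f * ((diff m (point (suc i)) 1 - d) * t₁)
    ≡⟨ cong (λ e → f * ((e - d) * t₁)) (diff-point-suc m i 0) ⟩
  f * ((d′ - d) * t₁)                                      ≡⟨ lemma₁ f (d′ - d) t₁ ⟩
  (d′ - d) * (f * t₁)                                      ≡⟨ cong ((d′ - d) *_) (expTerm-suc x m) ⟩
  (d′ - d) * (x * t)                                       ≡⟨ lemma₂ d′ d x t ⟩
  x * (d′ * t) - x * (d * t)
    ≡⟨ cong₂ (λ a b → x * a - x * b) (diff-point-term x i l) (previous l) ⟩
  x * (expTerm x i * e) - x * (u * prevTerm (- x) l)       ≡⟨ lemma₃ x (expTerm x i) e u (prevTerm (- x) l) ⟩
  (x * expTerm x i) * e + u * ((- x) * prevTerm (- x) l)
    ≡⟨ cong₂ (λ a b → a * e + u * b) (expTerm-suc x i) (prevTerm-suc (- x) l) ⟨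
  (fromℕ (suc i) * u) * e + u * (fromℕ l * e)              ≡⟨ lemma₄ (fromℕ (suc i)) u e (fromℕ l) ⟩
  (fromℕ (suc i) + fromℕ l) * (u * e)                      ≡⟨ cong (_* (u * e)) (fromℕ-+ (suc i) l) ⟨
  f * (u * e)                                              ∎)
  where
  open ≡-Reasoning
  m = i ℕ.+ l ; f = fromℕ (suc m) ; t = expTerm x m ; t₁ = expTerm x (suc m)
  d = diff m (point (suc i)) 0 ; d′ = diff m (point i) 0 ; u = expTerm x (suc i) ; e = expTerm (- x) l
  -- Relative to i + 1 the order i + l has index l - 1. For l = 0 the order lies below i + 1 and the
  -- difference vanishes, in agreement with `prevTerm` at 0.
  previous : ∀ l → diff (i ℕ.+ l) (point (suc i)) 0 * expTerm x (i ℕ.+ l) ≡ u * prevTerm (- x) l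
  previous zero    = trans (cong (_* expTerm x (i ℕ.+ 0)) (diff-point-< (ℕ.s≤s (ℕ.≤-reflexive (ℕ.+-identityʳ i)))))
    (trans (*-zeroˡ (expTerm x (i ℕ.+ 0))) (sym (*-zeroʳ u)))
  previous (suc l) = subst (λ k → diff k (point (suc i)) 0 * expTerm x k ≡ u * expTerm (- x) l)
    (sym (ℕ.+-suc i l)) (diff-point-term x (suc i) l)
  lemma₁ : ∀ f d t → f * (d * t) ≡ d * (f * t)
  lemma₁ = solve-∀ ℚ-ring
  lemma₂ : ∀ a b x t → (a - b) * (x * t) ≡ x * (a * t) - x * (b * t)
  lemma₂ = solve-∀ ℚ-ring
  lemma₃ : ∀ x a e u p → x * (a * e) - x * (u * p) ≡ (x * a) * e + u * ((- x) * p)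
  lemma₃ = solve-∀ ℚ-ring
  lemma₄ : ∀ f u e l → (f * u) * e + u * (l * e) ≡ (f + l) * (u * e)
  lemma₄ = solve-∀ ℚ-ring

-- The differences of order below i vanish, so of the i + M summands just M contribute.
sumTo-point : ∀ x i M → sumTo (i ℕ.+ M) (λ m → diff m (point i) 0 * expTerm x m) ≡ expTerm x i * expSum (- x) M
sumTo-point x i zero = trans (vanish (i ℕ.+ 0) (ℕ.≤-reflexive (ℕ.+-identityʳ i))) (sym (*-zeroʳ (expTerm x i)))
  where
  vanish : ∀ k → k ℕ.≤ i → sumTo k (λ m → diff m (point i) 0 * expTerm x m) ≡ 0ℚ
  vanish zero    _   = refl
  vanish (suc k) k<i = trans (cong₂ (λ a b → a + b * expTerm x k) (vanish k (ℕ.<⇒≤ k<i)) (diff-point-< k<i))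
    (trans (+-identityˡ (0ℚ * expTerm x k)) (*-zeroˡ (expTerm x k)))
sumTo-point x i (suc M) = trans (cong (λ k → sumTo k (λ m → diff m (point i) 0 * expTerm x m)) (ℕ.+-suc i M))
  (trans (cong₂ _+_ (sumTo-point x i M) (diff-point-term x i M)) (sym (*-distribˡ-+ (expTerm x i) _ _)))

-- Expectations under the walk

𝔼 : ∀ {A : Set} → Measure A → (A → ℚ) → ℚ
𝔼 μ f = ∑ (λ (a , w) → w * f a) μ

module _ {A : Set} where

  ∑-cong : ∀ {f g : A → ℚ} → (∀ x → f x ≡ g x) → ∀ xs → ∑ f xs ≡ ∑ g xs
  ∑-cong eq []       = refl
  ∑-cong eq (x ∷ xs) = cong₂ _+_ (eq x) (∑-cong eq xs)

  ∑-*ˡ : ∀ b (f : A → ℚ) xs → ∑ (λ x → b * f x) xs ≡ b * ∑ f xs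
  ∑-*ˡ b f []       = sym (*-zeroʳ b)
  ∑-*ˡ b f (x ∷ xs) = trans (cong (_+_ (b * f x)) (∑-*ˡ b f xs)) (sym (*-distribˡ-+ b (f x) _))

  ∑-zero : ∀ (xs : List A) → ∑ (λ _ → 0ℚ) xs ≡ 0ℚ
  ∑-zero []       = refl
  ∑-zero (x ∷ xs) = trans (+-identityˡ _) (∑-zero xs)

  ∑-+ : ∀ (f g : A → ℚ) xs → ∑ (λ x → f x + g x) xs ≡ ∑ f xs + ∑ g xs
  ∑-+ f g []       = refl
  ∑-+ f g (x ∷ xs) = trans (cong (_+_ (f x + g x)) (∑-+ f g xs)) (lemma (f x) (g x) (∑ f xs) (∑ g xs))
    where
    lemma : ∀ a b c d → a + b + (c + d) ≡ a + c + (b + d)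
    lemma = solve-∀ ℚ-ring

∑-swap : ∀ {A B : Set} (f : A → B → ℚ) xs ys →
  ∑ (λ x → ∑ (f x) ys) xs ≡ ∑ (λ y → ∑ (λ x → f x y) xs) ys
∑-swap f []       ys = sym (∑-zero ys)
∑-swap f (x ∷ xs) ys = trans (cong (_+_ (∑ (f x) ys)) (∑-swap f xs ys))
  (sym (∑-+ (f x) (λ y → ∑ (λ x → f x y) xs) ys))

measure-𝔼 : ∀ {A : Set} (g : A → ℕ) μ i →
  measure (pushforward g μ) (λ k → k ℕ.≟ i) ≡ 𝔼 μ (λ a → point i (g a))
measure-𝔼 g []            i = refl
measure-𝔼 g ((a , w) ∷ μ) i with g a ℕ.≡ᵇ i
... | true  = trans (cong (_+_ w) (measure-𝔼 g μ i))
  (cong (_+ 𝔼 μ (λ a → point i (g a))) (sym (*-identityʳ w)))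
... | false = trans (measure-𝔼 g μ i) (trans (sym (+-identityˡ _))
  (cong (_+ 𝔼 μ (λ a → point i (g a))) (sym (*-zeroʳ w))))

𝔼-⊛ : ∀ {n} (μ ν : Measure (Permutation′ n)) F → 𝔼 (μ ⊛ ν) F ≡ 𝔼 μ (λ h → 𝔼 ν (λ g → F (g ∘ₚ h)))
𝔼-⊛ []            ν F = refl
𝔼-⊛ ((h , p) ∷ μ) ν F = begin
  𝔼 (map (λ (g , q) → g ∘ₚ h , p * q) ν ++ (μ ⊛ ν)) F          ≡⟨ ∑-++ _ (map _ ν) (μ ⊛ ν) ⟩
  𝔼 (map (λ (g , q) → g ∘ₚ h , p * q) ν) F + 𝔼 (μ ⊛ ν) F       ≡⟨ cong₂ _+_ (∑-map _ _ ν) (𝔼-⊛ μ ν F) ⟩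
  ∑ (λ (g , q) → p * q * F (g ∘ₚ h)) ν + rest
    ≡⟨ cong (_+ rest) (∑-cong (λ (g , q) → *-assoc p q (F (g ∘ₚ h))) ν) ⟩
  ∑ (λ (g , q) → p * (q * F (g ∘ₚ h))) ν + rest
    ≡⟨ cong (_+ rest) (∑-*ˡ p (λ (g , q) → q * F (g ∘ₚ h)) ν) ⟩
  p * 𝔼 ν (λ g → F (g ∘ₚ h)) + rest                            ∎
  where
  open ≡-Reasoning
  rest = 𝔼 μ (λ h → 𝔼 ν (λ g → F (g ∘ₚ h)))

𝔼-swap : ∀ {A B : Set} (μ : Measure A) (ν : Measure B) (F : A → B → ℚ) →
  𝔼 μ (λ a → 𝔼 ν (F a)) ≡ 𝔼 ν (λ b → 𝔼 μ (λ a → F a b))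
𝔼-swap μ ν F = begin
  ∑ (λ (a , p) → p * 𝔼 ν (F a)) μ
    ≡⟨ ∑-cong (λ (a , p) → ∑-*ˡ p (λ (b , q) → q * F a b) ν) μ ⟨
  ∑ (λ (a , p) → ∑ (λ (b , q) → p * (q * F a b)) ν) μ                  ≡⟨ ∑-swap _ μ ν ⟩
  ∑ (λ (b , q) → ∑ (λ (a , p) → p * (q * F a b)) μ) ν                  ≡⟨ ∑-cong (λ (b , q) →
    trans (∑-cong (λ (a , p) → lemma p q (F a b)) μ) (∑-*ˡ q (λ (a , p) → p * F a b) μ)) ν ⟩
  ∑ (λ (b , q) → q * 𝔼 μ (λ a → F a b)) ν                              ∎
  where
  open ≡-Reasoning
  lemma : ∀ p q x → p * (q * x) ≡ q * (p * x)
  lemma = solve-∀ ℚ-ring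

-- Order, linearity and total mass of the one-step sums.

splitSum-mono : ∀ {g h} q → (∀ p l → p ℕ.+ l ≡ q → g p l ≤ h p l) → splitSum g q ≤ splitSum h q
splitSum-mono zero    le = ≤-refl
splitSum-mono (suc q) le = +-mono-≤ (le 0 (suc q) refl) (splitSum-mono q λ p l eq → le (suc p) l (cong suc eq))

splitSum-linear : ∀ a b g h q → splitSum (λ p l → a * g p l + b * h p l) q ≡ a * splitSum g q + b * splitSum h q
splitSum-linear a b g h zero    = lemma a b
  where
  lemma : ∀ a b → 0ℚ ≡ a * 0ℚ + b * 0ℚ
  lemma = solve-∀ ℚ-ring
splitSum-linear a b g h (suc q) = trans (cong (_+_ (a * g 0 (suc q) + b * h 0 (suc q)))
  (splitSum-linear a b (λ p → g (suc p)) (λ p → h (suc p)) q))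
  (lemma a b (g 0 (suc q)) (h 0 (suc q)) (splitSum (λ p → g (suc p)) q) (splitSum (λ p → h (suc p)) q))
  where
  lemma : ∀ a b x y z w → a * x + b * y + (a * z + b * w) ≡ a * (x + z) + b * (y + w)
  lemma = solve-∀ ℚ-ring

-- The factor `fromℕ l` is kept in the hypothesis to make entries 0 harmless: a list of naturals
-- does not exclude them, and they would not lengthen the cycle of the centre.
mergeSum-mono : ∀ {g h} ls → (∀ l ks → ls ↭ l ∷ ks → fromℕ l * g l ks ≤ fromℕ l * h l ks) →
  mergeSum g ls ≤ mergeSum h ls
mergeSum-mono []       le = ≤-refl
mergeSum-mono (l ∷ ls) le = +-mono-≤ (le l ls ↭.refl)
  (mergeSum-mono ls λ k ks p → le k (l ∷ ks) (↭.trans (↭.prep l p) (↭.swap l k ↭.refl)))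

mergeSum-linear : ∀ a b g h ls → mergeSum (λ l ks → a * g l ks + b * h l ks) ls ≡ a * mergeSum g ls + b * mergeSum h ls
mergeSum-linear a b g h []       = lemma a b
  where
  lemma : ∀ a b → 0ℚ ≡ a * 0ℚ + b * 0ℚ
  lemma = solve-∀ ℚ-ring
mergeSum-linear a b g h (l ∷ ls) = trans (cong (_+_ (fromℕ l * (a * g l ls + b * h l ls)))
  (mergeSum-linear a b (λ k ks → g k (l ∷ ks)) (λ k ks → h k (l ∷ ks)) ls))
  (lemma a b (fromℕ l) (g l ls) (h l ls) (mergeSum (λ k ks → g k (l ∷ ks)) ls) (mergeSum (λ k ks → h k (l ∷ ks)) ls))
  where
  lemma : ∀ a b c x y z w → c * (a * x + b * y) + (a * z + b * w) ≡ a * (c * x + z) + b * (c * y + w)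
  lemma = solve-∀ ℚ-ring

splitSum-const : ∀ a q → splitSum (λ _ _ → a) q ≡ fromℕ q * a
splitSum-const a zero    = sym (*-zeroˡ a)
splitSum-const a (suc q) = trans (cong (_+_ a) (splitSum-const a q))
  (trans (lemma a (fromℕ q)) (cong (_* a) (sym (fromℕ-suc q))))
  where
  lemma : ∀ a f → a + f * a ≡ (1ℚ + f) * a
  lemma = solve-∀ ℚ-ring

mergeSum-const : ∀ a ls → mergeSum (λ _ _ → a) ls ≡ fromℕ (sum ls) * a
mergeSum-const a []       = sym (*-zeroˡ a)
mergeSum-const a (l ∷ ls) = trans (cong (_+_ (fromℕ l * a)) (mergeSum-const a ls))
  (trans (sym (*-distribʳ-+ a (fromℕ l) (fromℕ (sum ls)))) (cong (_* a) (sym (fromℕ-+ l (sum ls)))))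

-- The walk as an operator on functions of the cycle type.

Observable : Set
Observable = ℕ → List ℕ → ℚ

module Walk (r : ℕ) where

  ε : ℚ
  ε = recip r

  -- The cycle lengths q + 1 and `ls` add up to n = r + 2.
  Valid : ℕ → List ℕ → Set
  Valid q ls = q ℕ.+ sum ls ≡ suc r

  step : Observable → Observable
  step f q ls = ε * stepSum f q ls

  start : List ℕ
  start = map size (map (λ i → Fin.suc i , []) (allFin (suc r)))

  -- The backward form of the chain: the last step is absorbed into the observable, so no law on
  -- cycle types has to be represented.
  E : ℕ → Observable → ℚ
  E zero    f = f 0 start
  E (suc k) f = E k (step f)

  -- The outermost factor of the convolution is the move made last. Once the two expectations are
  -- exchanged, averaging over it is `step`, by lumpability.
  𝔼-star^ : ∀ k (F : Permutation′ (2 ℕ.+ r) → ℚ) f → (∀ {π q ls} → Shape π q ls → F π ≡ f q ls) →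
    𝔼 (star r ⊛^ k) F ≡ E k f
  𝔼-star^ zero    F f F≡f = trans (trans (+-identityʳ _) (*-identityˡ _)) (F≡f (shape-id (suc r)))
  𝔼-star^ (suc k) F f F≡f = begin
    𝔼 (star r ⊛ star r ⊛^ k) F                                          ≡⟨ 𝔼-⊛ (star r) (star r ⊛^ k) F ⟩
    𝔼 (star r) (λ h → 𝔼 (star r ⊛^ k) (λ g → F (g ∘ₚ h)))
      ≡⟨ 𝔼-swap (star r) (star r ⊛^ k) (λ h g → F (g ∘ₚ h)) ⟩
    𝔼 (star r ⊛^ k) (λ g → 𝔼 (star r) (λ h → F (g ∘ₚ h)))               ≡⟨ 𝔼-star^ k _ (step f) one-step ⟩
    E k (step f)                                                        ∎
    where
    open ≡-Reasoning
    one-step : ∀ {π q ls} → Shape π q ls → 𝔼 (star r) (λ h → F (π ∘ₚ h)) ≡ step f q ls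
    one-step {π} sh = trans
      (∑-map (λ (h , w) → w * F (π ∘ₚ h)) (λ i → transpose Fin.zero (Fin.suc i) , ε) (allFin (suc r)))
      (trans (∑-*ˡ ε (λ i → F (π ∘ₚ transpose Fin.zero (Fin.suc i))) (allFin (suc r)))
        (cong (ε *_) (∑-star sh F f F≡f)))

  Nε≡1 : ε * fromℕ (suc r) ≡ 1ℚ
  Nε≡1 = trans (*-comm ε (fromℕ (suc r))) (fromℕ*recip r)

  start-valid : Valid 0 start
  start-valid = trans (ones (allFin (suc r))) (List.length-tabulate id)
    where
    ones : ∀ {n} (is : List (Fin n)) → sum (map size (map (λ i → Fin.suc i , []) is)) ≡ length is
    ones []       = refl
    ones (i ∷ is) = cong suc (ones is)

  step-mono : ∀ {f g} → (∀ q ls → Valid q ls → f q ls ≤ g q ls) →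
    ∀ q ls → Valid q ls → step f q ls ≤ step g q ls
  step-mono le q ls valid = *-monoˡ (0≤recip r) (+-mono-≤
    (splitSum-mono q λ p l p+l≡q → le p (l ∷ ls)
      (trans (sym (ℕ.+-assoc p l (sum ls))) (trans (cong (ℕ._+ sum ls) p+l≡q) valid)))
    (mergeSum-mono ls λ l ks p → *-monoˡ (0≤fromℕ l) (le (q ℕ.+ l) ks
      (trans (ℕ.+-assoc q l (sum ks)) (trans (cong (q ℕ.+_) (sym (sum-↭ p))) valid)))))

  E-mono : ∀ k {f g} → (∀ q ls → Valid q ls → f q ls ≤ g q ls) → E k f ≤ E k g
  E-mono zero    le = le 0 start start-valid
  E-mono (suc k) le = E-mono k (step-mono le)

  E-cong : ∀ k {f g} → (∀ q ls → Valid q ls → f q ls ≡ g q ls) → E k f ≡ E k g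
  E-cong k eq = ≤-antisym (E-mono k λ q ls v → ≤-reflexive (eq q ls v))
    (E-mono k λ q ls v → ≤-reflexive (sym (eq q ls v)))

  E-linear : ∀ k a b f g → E k (λ q ls → a * f q ls + b * g q ls) ≡ a * E k f + b * E k g
  E-linear zero    a b f g = refl
  E-linear (suc k) a b f g = trans (E-cong k λ q ls _ → step-linear q ls) (E-linear k a b (step f) (step g))
    where
    lemma : ∀ e a b x y z w → e * (a * x + b * y + (a * z + b * w)) ≡ a * (e * (x + z)) + b * (e * (y + w))
    lemma = solve-∀ ℚ-ring
    step-linear : ∀ q ls → step (λ q ls → a * f q ls + b * g q ls) q ls ≡ a * step f q ls + b * step g q ls
    step-linear q ls = trans (cong (ε *_) (cong₂ _+_
      (splitSum-linear a b (λ p l → f p (l ∷ ls)) (λ p l → g p (l ∷ ls)) q)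
      (mergeSum-linear a b (λ l → f (q ℕ.+ l)) (λ l → g (q ℕ.+ l)) ls)))
      (lemma ε a b (splitSum (λ p l → f p (l ∷ ls)) q) (splitSum (λ p l → g p (l ∷ ls)) q)
        (mergeSum (λ l → f (q ℕ.+ l)) ls) (mergeSum (λ l → g (q ℕ.+ l)) ls))

  ε*valid : ∀ a q ls → Valid q ls → ε * (fromℕ q * a + fromℕ (sum ls) * a) ≡ a
  ε*valid a q ls valid = begin
    ε * (fromℕ q * a + fromℕ (sum ls) * a)     ≡⟨ cong (ε *_) (*-distribʳ-+ a (fromℕ q) (fromℕ (sum ls))) ⟨
    ε * ((fromℕ q + fromℕ (sum ls)) * a)
      ≡⟨ cong (λ f → ε * (f * a)) (trans (sym (fromℕ-+ q (sum ls))) (cong fromℕ valid)) ⟩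
    ε * (fromℕ (suc r) * a)                    ≡⟨ *-assoc ε (fromℕ (suc r)) a ⟨
    ε * fromℕ (suc r) * a                      ≡⟨ cong (_* a) Nε≡1 ⟩
    1ℚ * a                                     ≡⟨ *-identityˡ a ⟩
    a                                          ∎
    where open ≡-Reasoning

  E-const : ∀ k a → E k (λ _ _ → a) ≡ a
  E-const zero    a = refl
  E-const (suc k) a = trans (E-cong k λ q ls valid →
    trans (cong (ε *_) (cong₂ _+_ (splitSum-const a q) (mergeSum-const a ls))) (ε*valid a q ls valid)) (E-const k a)

  E-+ : ∀ k f g → E k (λ q ls → f q ls + g q ls) ≡ E k f + E k g
  E-+ k f g = trans (E-cong k λ q ls _ → lemma (f q ls) (g q ls))
    (trans (E-linear k 1ℚ 1ℚ f g) (sym (lemma (E k f) (E k g))))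
    where
    lemma : ∀ a b → a + b ≡ 1ℚ * a + 1ℚ * b
    lemma = solve-∀ ℚ-ring

  E-*ˡ : ∀ k a f → E k (λ q ls → a * f q ls) ≡ a * E k f
  E-*ˡ k a f = trans (E-cong k λ q ls _ → lemma a (f q ls))
    (trans (E-linear k a 0ℚ f f) (sym (lemma a (E k f))))
    where
    lemma : ∀ a b → a * b ≡ a * b + 0ℚ * b
    lemma = solve-∀ ℚ-ring

  E-nonNeg : ∀ k {f} → (∀ q ls → 0ℚ ≤ f q ls) → 0ℚ ≤ E k f
  E-nonNeg k {f} 0≤f = subst (_≤ E k f) (E-const k 0ℚ) (E-mono k λ q ls _ → 0≤f q ls)

  E-minus : ∀ k f g → E k (λ q ls → f q ls - g q ls) ≡ E k f - E k g
  E-minus k f g = trans (E-cong k λ q ls _ → lemma (f q ls) (g q ls))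
    (trans (E-linear k 1ℚ (- 1ℚ) f g) (sym (lemma (E k f) (E k g))))
    where
    lemma : ∀ a b → a - b ≡ 1ℚ * a + (- 1ℚ) * b
    lemma = solve-∀ ℚ-ring

  E-∣-∣ : ∀ k f g h → (∀ q ls → ∣ f q ls - g q ls ∣ ≤ h q ls) → ∣ E k f - E k g ∣ ≤ E k h
  E-∣-∣ k f g h close = ∣p∣≤b
    (subst (_≤ E k h) (E-minus k f g) (E-mono k λ q ls _ → ∣p∣≤b⇒p≤b (close q ls)))
    (subst (_≤ E k h) (trans (E-minus k g f) (lemma (E k g) (E k f)))
      (E-mono k λ q ls _ → subst (_≤ h q ls) (sym (lemma (g q ls) (f q ls))) (∣p∣≤b⇒-p≤b (close q ls))))
    where
    lemma : ∀ a b → a - b ≡ - (b - a)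
    lemma = solve-∀ ℚ-ring

-- One step of the number of j-cycles

-- The indicator of q < l, which for the centre means a cycle of length at most l.
below : ℕ → ℕ → ℚ
below q       zero    = 0ℚ
below zero    (suc l) = 1ℚ
below (suc q) (suc l) = below q l

0≤below : ∀ q l → 0ℚ ≤ below q l
0≤below q       zero    = ≤-refl
0≤below zero    (suc l) = 0≤1
0≤below (suc q) (suc l) = 0≤below q l

below≤1 : ∀ q l → below q l ≤ 1ℚ
below≤1 q       zero    = 0≤1
below≤1 zero    (suc l) = ≤-refl
below≤1 (suc q) (suc l) = below≤1 q l

below-suc : ∀ q l → below q l ≡ below (suc q) l + fromℕ (indicator (suc q ℕ.≟ l))
below-suc q       zero          = refl
below-suc zero    (suc zero)    = refl
below-suc zero    (suc (suc l)) = refl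
below-suc (suc q) (suc l)       = below-suc q l

-- A merge lengthens the cycle of the centre by at least one, so going back over it lowers the
-- threshold.
below-+ : ∀ q k l → below (q ℕ.+ suc k) (suc l) ≤ below q l
below-+ zero    k zero    = ≤-refl
below-+ zero    k (suc l) = below≤1 k (suc l)
below-+ (suc q) k zero    = ≤-refl
below-+ (suc q) k (suc l) = below-+ q k l

count-↭ : ∀ j {ls ks} → ls ↭ ks → count j ls ≡ count j ks
count-↭ j p = sum-↭ (map⁺ (λ l → indicator (l ℕ.≟ j)) p)

indicator-affine : ∀ {P : Set} (P? : Dec P) (h : ℕ → ℚ) →
  h (indicator P?) ≡ h 0 + fromℕ (indicator P?) * (h 1 - h 0)
indicator-affine (yes _) h = lemma (h 0) (h 1)
  where
  lemma : ∀ a b → b ≡ a + 1ℚ * (b - a)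
  lemma = solve-∀ ℚ-ring
indicator-affine (no _)  h = lemma (h 0) (h 1)
  where
  lemma : ∀ a b → a ≡ a + 0ℚ * (b - a)
  lemma = solve-∀ ℚ-ring

-- The pieces have the lengths 1, ..., q, each once. Hence one split yields the length j + 1 if q ≥
-- j + 1, and none does otherwise.
splitSum-indicator : ∀ j (h : ℕ → ℚ) q → splitSum (λ _ l → h (indicator (l ℕ.≟ suc j))) q ≡
  fromℕ q * h 0 + (1ℚ - below q (suc j)) * (h 1 - h 0)
splitSum-indicator j h zero    = lemma (h 0) (h 1)
  where
  lemma : ∀ a b → 0ℚ ≡ 0ℚ * a + (1ℚ - 1ℚ) * (b - a)
  lemma = solve-∀ ℚ-ring
splitSum-indicator j h (suc q) = begin
  h (indicator d?) + splitSum (λ _ l → h (indicator (l ℕ.≟ suc j))) q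
    ≡⟨ cong₂ _+_ (indicator-affine d? h) (splitSum-indicator j h q) ⟩
  (h 0 + ind * Δ) + (fromℕ q * h 0 + (1ℚ - below q (suc j)) * Δ)
    ≡⟨ cong (λ b → (h 0 + ind * Δ) + (fromℕ q * h 0 + (1ℚ - b) * Δ)) (below-suc q (suc j)) ⟩
  (h 0 + ind * Δ) + (fromℕ q * h 0 + (1ℚ - (below (suc q) (suc j) + ind)) * Δ)
    ≡⟨ lemma (h 0) ind Δ (fromℕ q) (below (suc q) (suc j)) ⟩
  (1ℚ + fromℕ q) * h 0 + (1ℚ - below (suc q) (suc j)) * Δ
    ≡⟨ cong (λ f → f * h 0 + (1ℚ - below (suc q) (suc j)) * Δ) (fromℕ-suc q) ⟨
  fromℕ (suc q) * h 0 + (1ℚ - below (suc q) (suc j)) * Δ ∎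
  where
  open ≡-Reasoning
  d? = suc q ℕ.≟ suc j ; ind = fromℕ (indicator d?) ; Δ = h 1 - h 0
  lemma : ∀ a i d f b → (a + i * d) + (f * a + (1ℚ - (b + i)) * d) ≡ (1ℚ + f) * a + (1ℚ - b) * d
  lemma = solve-∀ ℚ-ring

-- A j-cycle disappears through any of its j points. The value of `ℕ.pred` at 0 does not matter, as
-- it is multiplied by the count.
mergeSum-count : ∀ j (h : ℕ → ℚ) ls → mergeSum (λ _ ks → h (count j ks)) ls ≡
  fromℕ (sum ls) * h (count j ls) + fromℕ j * (fromℕ (count j ls) * (h (ℕ.pred (count j ls)) - h (count j ls)))
mergeSum-count j h []       = lemma (h 0) (fromℕ j)
  where
  lemma : ∀ a f → 0ℚ ≡ 0ℚ * a + f * (0ℚ * (a - a))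
  lemma = solve-∀ ℚ-ring
mergeSum-count j h (l ∷ ls) = trans
  (cong (_+_ (fromℕ l * h c)) (mergeSum-count j (λ x → h (indicator (l ℕ.≟ j) ℕ.+ x)) ls))
  (trans (arith (l ℕ.≟ j) c)
    (cong (λ f → f * h c′ + fromℕ j * (fromℕ c′ * (h (ℕ.pred c′) - h c′))) (sym (fromℕ-+ l (sum ls)))))
  where
  c = count j ls ; c′ = count j (l ∷ ls) ; s = fromℕ (sum ls)
  arith : (d? : Dec (l ≡ j)) → ∀ c → let i = indicator d? in
    fromℕ l * h c + (s * h (i ℕ.+ c) + fromℕ j * (fromℕ c * (h (i ℕ.+ ℕ.pred c) - h (i ℕ.+ c)))) ≡
    (fromℕ l + s) * h (i ℕ.+ c) + fromℕ j * (fromℕ (i ℕ.+ c) * (h (ℕ.pred (i ℕ.+ c)) - h (i ℕ.+ c)))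
  arith (no _) c = lemma (fromℕ l) s (h c) (fromℕ j * (fromℕ c * (h (ℕ.pred c) - h c)))
    where
    lemma : ∀ l s a b → l * a + (s * a + b) ≡ (l + s) * a + b
    lemma = solve-∀ ℚ-ring
  arith (yes refl) zero = lemma (fromℕ l) s (h 0) (h 1)
    where
    lemma : ∀ l s a b → l * a + (s * b + l * (0ℚ * (b - b))) ≡ (l + s) * b + l * (1ℚ * (a - b))
    lemma = solve-∀ ℚ-ring
  arith (yes refl) (suc c) = trans (lemma (fromℕ l) s (h (suc c)) (h (suc (suc c))) (fromℕ (suc c)))
    (cong (λ f → (fromℕ l + s) * h (suc (suc c)) + fromℕ l * (f * (h (suc c) - h (suc (suc c)))))
      (sym (fromℕ-suc (suc c))))
    where
    lemma : ∀ l s a b f → l * a + (s * b + l * (f * (a - b))) ≡ (l + s) * b + l * ((1ℚ + f) * (a - b))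
    lemma = solve-∀ ℚ-ring

-- A lost cycle destroys the (m + 1)-subsets containing it, and every subset has m + 1 elements to
-- lose. Deaths thus act diagonally on binomial moments.
binom-pred : ∀ x m → fromℕ x * (binom (ℕ.pred x) (suc m) - binom x (suc m)) ≡ - (fromℕ (suc m) * binom x (suc m))
binom-pred zero    m = lemma (fromℕ (suc m))
  where
  lemma : ∀ f → 0ℚ * (0ℚ - 0ℚ) ≡ - (f * 0ℚ)
  lemma = solve-∀ ℚ-ring
binom-pred (suc x) m = trans (lemma (fromℕ (suc x)) (binom x m) (binom x (suc m))) (cong -_ (binom-absorb x m))
  where
  lemma : ∀ f b c → f * (c - (b + c)) ≡ - (f * b)
  lemma = solve-∀ ℚ-ring

splitSum-below : ∀ {a} → 0ℚ ≤ a → ∀ l q → splitSum (λ p _ → below p l * a) q ≤ fromℕ l * a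
splitSum-below         0≤a l       zero    = *-nonNeg (0≤fromℕ l) 0≤a
splitSum-below {a}     0≤a zero    (suc q) = ≤-trans (+-mono-≤ (≤-reflexive (*-zeroˡ a)) (splitSum-below 0≤a 0 q))
  (≤-reflexive (+-identityˡ _))
splitSum-below {a}     0≤a (suc l) (suc q) = ≤-trans (+-monoʳ-≤ (1ℚ * a) (splitSum-below 0≤a l q))
  (≤-reflexive (trans (sym (*-distribʳ-+ a 1ℚ (fromℕ l))) (cong (_* a) (sym (fromℕ-suc l)))))

binom-indicator-≤ : ∀ {P : Set} (P? : Dec P) x m → binom (indicator P? ℕ.+ x) m ≤ binom (suc x) m
binom-indicator-≤ (yes _) x m = ≤-refl
binom-indicator-≤ (no  _) x m = binom-suc-≤ x m

binom-monoˡ : ∀ i x m → binom x m ≤ binom (i ℕ.+ x) m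
binom-monoˡ zero    x m = ≤-refl
binom-monoˡ (suc i) x m = ≤-trans (binom-monoˡ i x m) (binom-suc-≤ (i ℕ.+ x) m)

triangular : ℕ → ℚ
triangular zero    = 0ℚ
triangular (suc l) = triangular l + fromℕ (suc l)

0≤triangular : ∀ l → 0ℚ ≤ triangular l
0≤triangular zero    = ≤-refl
0≤triangular (suc l) = +-mono-≤ (0≤triangular l) (0≤fromℕ (suc l))

-- The bound on |E binom(X, m) − λᵐ/m!| is this multiple of 1/(n − 1), where a bounds the scaled time.
momentError : ℕ → ℚ → ℕ → ℚ
momentError j a zero    = 0ℚ
momentError j a (suc m) = (fromℕ j + fromℕ j) * expTerm a m +
  a * (momentError j a m + triangular j * (prevTerm a m + expTerm a m) + 1ℚ)

0≤momentError : ∀ j {a} → 0ℚ ≤ a → ∀ m → 0ℚ ≤ momentError j a m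
0≤momentError j 0≤a zero    = ≤-refl
0≤momentError j 0≤a (suc m) = +-mono-≤
  (*-nonNeg (+-mono-≤ (0≤fromℕ j) (0≤fromℕ j)) (0≤expTerm 0≤a m))
  (*-nonNeg 0≤a (+-mono-≤ (+-mono-≤ (0≤momentError j 0≤a m)
    (*-nonNeg (0≤triangular j) (+-mono-≤ (0≤prevTerm 0≤a m) (0≤expTerm 0≤a m)))) 0≤1))

-- The number X of j-cycles ignores the cycle of the centre, even if its length is j.
module Moments (r i : ℕ) where

  open Walk r

  j : ℕ
  j = suc (suc i)

  X : List ℕ → ℕ
  X = count j

  M : ℕ → Observable
  M m q ls = binom (X ls) m

  -- The births missed because the cycle of the centre is too short. The threshold l is free because
  -- the bound on the expectation lowers it by one per step.
  G : ℕ → ℕ → Observable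
  G l m q ls = below q l * binom (X ls) m

  -- This is where j ≥ 2 matters: the identity has only fixed points.
  X-start : X start ≡ 0
  X-start = fixed-points (allFin (suc r))
    where
    fixed-points : ∀ {n} (is : List (Fin n)) → X (map size (map (λ i → Fin.suc i , []) is)) ≡ 0
    fixed-points []       = refl
    fixed-points (i ∷ is) = fixed-points is

  -- Deaths give the factor of the first term and births the second; a j-cycle can be split off only
  -- if q ≥ j, hence the correction by `G`.
  step-M : ∀ m q ls → Valid q ls → step (M (suc m)) q ls ≡
    (1ℚ - ε * (fromℕ j * fromℕ (suc m))) * M (suc m) q ls + ε * (M m q ls - G j m q ls)
  step-M m q ls valid = begin
    ε * stepSum (M (suc m)) q ls
      ≡⟨ cong (ε *_) (cong₂ _+_ (splitSum-indicator (suc i) (λ k → binom (k ℕ.+ x) (suc m)) q)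
                                (mergeSum-count j (λ x → binom x (suc m)) ls)) ⟩
    ε * (fromℕ q * b₁ + (1ℚ - below q j) * ((b + b₁) - b₁) + (fromℕ (sum ls) * b₁ + fromℕ j * (fromℕ x * (binom (ℕ.pred x) (suc m) - b₁))))
      ≡⟨ cong (λ p → ε * (fromℕ q * b₁ + (1ℚ - below q j) * ((b + b₁) - b₁) + (fromℕ (sum ls) * b₁ + fromℕ j * p))) (binom-pred x m) ⟩
    ε * (fromℕ q * b₁ + (1ℚ - below q j) * ((b + b₁) - b₁) + (fromℕ (sum ls) * b₁ + fromℕ j * (- (fromℕ (suc m) * b₁))))
      ≡⟨ lemma₁ ε (fromℕ q) (fromℕ (sum ls)) (fromℕ j) (fromℕ (suc m)) (below q j) b b₁ ⟩
    ε * (fromℕ q * b₁ + fromℕ (sum ls) * b₁) + (ε * (b - below q j * b) - ε * (fromℕ j * fromℕ (suc m)) * b₁)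
      ≡⟨ cong (_+ (ε * (b - below q j * b) - ε * (fromℕ j * fromℕ (suc m)) * b₁)) (ε*valid b₁ q ls valid) ⟩
    b₁ + (ε * (b - below q j * b) - ε * (fromℕ j * fromℕ (suc m)) * b₁)
      ≡⟨ lemma₂ (ε * (b - below q j * b)) (ε * (fromℕ j * fromℕ (suc m))) b₁ ⟩
    (1ℚ - ε * (fromℕ j * fromℕ (suc m))) * b₁ + ε * (b - below q j * b) ∎
    where
    open ≡-Reasoning
    x = X ls ; b = binom x m ; b₁ = binom x (suc m)
    lemma₁ : ∀ e q s j f w b c → e * (q * c + (1ℚ - w) * ((b + c) - c) + (s * c + j * (- (f * c)))) ≡
      e * (q * c + s * c) + (e * (b - w * b) - e * (j * f) * c)
    lemma₁ = solve-∀ ℚ-ring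
    lemma₂ : ∀ a d c → c + (a - d * c) ≡ (1ℚ - d) * c + a
    lemma₂ = solve-∀ ℚ-ring

  -- At most l + 1 splits leave a centre cycle that short, and each raises X by at most one. A merge
  -- cannot raise X, and before it the cycle of the centre was shorter still.
  step-G : ∀ l m q ls → Valid q ls →
    step (G (suc l) m) q ls ≤ G l m q ls + ε * fromℕ (suc l) * binom (suc (X ls)) m
  step-G l m q ls valid = begin
    ε * stepSum (G (suc l) m) q ls               ≤⟨ *-monoˡ (0≤recip r) (+-mono-≤ splits merges) ⟩
    -- The mass q of the splits is added to that of the merges to make the total probability one.
    ε * (fromℕ (suc l) * b₁ + fromℕ (sum ls) * g) ≤⟨ *-monoˡ (0≤recip r) (+-monoʳ-≤ (fromℕ (suc l) * b₁)
      (p≤q+p (*-nonNeg (0≤fromℕ q) 0≤g))) ⟩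
    ε * (fromℕ (suc l) * b₁ + (fromℕ q * g + fromℕ (sum ls) * g)) ≡⟨ *-distribˡ-+ ε (fromℕ (suc l) * b₁) _ ⟩
    ε * (fromℕ (suc l) * b₁) + ε * (fromℕ q * g + fromℕ (sum ls) * g)
      ≡⟨ cong₂ _+_ (sym (*-assoc ε (fromℕ (suc l)) b₁)) (ε*valid g q ls valid) ⟩
    ε * fromℕ (suc l) * b₁ + g                   ≡⟨ +-comm (ε * fromℕ (suc l) * b₁) g ⟩
    g + ε * fromℕ (suc l) * b₁                   ∎
    where
    open ≤-Reasoning
    b = binom (X ls) m ; b₁ = binom (suc (X ls)) m ; g = below q l * b
    0≤g : 0ℚ ≤ g
    0≤g = *-nonNeg (0≤below q l) (0≤binom (X ls) m)
    splits : splitSum (λ p k → below p (suc l) * binom (X (k ∷ ls)) m) q ≤ fromℕ (suc l) * b₁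
    splits = ≤-trans (splitSum-mono q λ p k _ → *-monoˡ {below p (suc l)} (0≤below p (suc l)) (binom-indicator-≤ (k ℕ.≟ j) (X ls) m))
      (splitSum-below (0≤binom (suc (X ls)) m) (suc l) q)
    merges : mergeSum (λ k ks → below (q ℕ.+ k) (suc l) * binom (X ks) m) ls ≤ fromℕ (sum ls) * g
    merges = ≤-trans (mergeSum-mono {h = λ _ _ → g} ls merge-≤) (≤-reflexive (mergeSum-const g ls))
      where
      merge-≤ : ∀ k ks → ls ↭ k ∷ ks → fromℕ k * (below (q ℕ.+ k) (suc l) * binom (X ks) m) ≤ fromℕ k * g
      merge-≤ zero    ks _ = ≤-reflexive (trans (*-zeroˡ (below (q ℕ.+ 0) (suc l) * binom (X ks) m)) (sym (*-zeroˡ g)))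
      merge-≤ (suc k) ks p = *-monoˡ (0≤fromℕ (suc k)) (*-mono-≤ (0≤below (q ℕ.+ suc k) (suc l)) (0≤binom (X ls) m)
        (below-+ q k l) (subst (λ x → binom (X ks) m ≤ binom x m) (sym (count-↭ j p))
          (binom-monoˡ (indicator (suc k ℕ.≟ j)) (X ks) m)))

  0≤ε : 0ℚ ≤ ε
  0≤ε = 0≤recip r

  0≤M : ∀ m q ls → 0ℚ ≤ M m q ls
  0≤M m q ls = 0≤binom (X ls) m

  0≤G : ∀ l m q ls → 0ℚ ≤ G l m q ls
  0≤G l m q ls = *-nonNeg (0≤below q l) (0≤M m q ls)

  step-M-≤ : ∀ m q ls → Valid q ls → step (M (suc m)) q ls ≤ 1ℚ * M (suc m) q ls + ε * M m q ls
  step-M-≤ m q ls valid = subst (_≤ 1ℚ * M (suc m) q ls + ε * M m q ls) (sym (step-M m q ls valid)) (+-mono-≤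
    (*-monoʳ {1ℚ - ε * (fromℕ j * fromℕ (suc m))} {1ℚ} (0≤M (suc m) q ls)
      (p-q≤p (*-nonNeg 0≤ε (*-nonNeg (0≤fromℕ j) (0≤fromℕ (suc m))))))
    (*-monoˡ 0≤ε (p-q≤p (0≤G j m q ls))))

  time : ℕ → ℚ
  time k = fromℕ k * ε

  time-suc : ∀ k → time k + ε ≡ time (suc k)
  time-suc k = trans (lemma (fromℕ k) ε) (cong (_* ε) (sym (fromℕ-suc k)))
    where
    lemma : ∀ f e → f * e + e ≡ (1ℚ + f) * e
    lemma = solve-∀ ℚ-ring

  0≤time : ∀ k → 0ℚ ≤ time k
  0≤time k = *-nonNeg (0≤fromℕ k) 0≤ε

  -- Without deaths and failed births, X is a sum of k independent indicators of mean ε, whose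
  -- binomial moments are at most (kε)ᵐ/m!. This a priori bound controls both `G` and the truncation
  -- of Newton's formula.
  moment-≤ : ∀ k m → E k (M m) ≤ expTerm (time k) m
  moment-≤ k       zero    = ≤-reflexive (E-const k 1ℚ)
  moment-≤ zero    (suc m) = subst (λ x → binom x (suc m) ≤ expTerm (time 0) (suc m)) (sym X-start)
    (0≤expTerm (0≤time 0) (suc m))
  moment-≤ (suc k) (suc m) = begin
    E k (step (M (suc m)))                                ≤⟨ E-mono k (step-M-≤ m) ⟩
    E k (λ q ls → 1ℚ * M (suc m) q ls + ε * M m q ls)     ≡⟨ E-linear k 1ℚ ε (M (suc m)) (M m) ⟩
    1ℚ * E k (M (suc m)) + ε * E k (M m)
      ≡⟨ cong (_+ ε * E k (M m)) (*-identityˡ (E k (M (suc m)))) ⟩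
    E k (M (suc m)) + ε * E k (M m)
      ≤⟨ +-mono-≤ (moment-≤ k (suc m)) (*-monoˡ 0≤ε (moment-≤ k m)) ⟩
    expTerm (time k) (suc m) + ε * expTerm (time k) m
      ≤⟨ 0≤q-p⇒p≤q (taylor-nonNeg (0≤time k) 0≤ε (suc m)) ⟩
    expTerm (time k + ε) (suc m)                          ≡⟨ cong (λ t → expTerm t (suc m)) (time-suc k) ⟩
    expTerm (time (suc k)) (suc m)                        ∎
    where open ≤-Reasoning

  shifted-moment-≤ : ∀ {a} k m → time k ≤ a → E k (λ _ ls → binom (suc (X ls)) m) ≤ prevTerm a m + expTerm a m
  shifted-moment-≤ k zero    _  = ≤-reflexive (trans (E-const k 1ℚ) (sym (+-identityˡ 1ℚ)))
  shifted-moment-≤ k (suc m) le = subst (_≤ _) (sym (E-+ k (M m) (M (suc m))))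
    (+-mono-≤ (≤-trans (moment-≤ k m) (expTerm-mono (0≤time k) le m))
      (≤-trans (moment-≤ k (suc m)) (expTerm-mono (0≤time k) le (suc m))))

  time-mono : ∀ {k l a} → k ℕ.≤ l → time l ≤ a → time k ≤ a
  time-mono k≤l le = ≤-trans (*-monoʳ 0≤ε (fromℕ-mono-≤ k≤l)) le

  -- A cycle of the centre of length at most l is created by a rare split
  -- within the last l steps, since every merge lengthens this cycle.
  G-≤ : ∀ {a} l k m → time (l ℕ.+ k) ≤ a →
    E (l ℕ.+ k) (G l m) ≤ triangular l * (prevTerm a m + expTerm a m) * ε
  G-≤ {a} zero    k m le = ≤-reflexive (trans (E-*ˡ k 0ℚ (M m)) (lemma (E k (M m)) (prevTerm a m + expTerm a m) ε))
    where
    lemma : ∀ x b e → 0ℚ * x ≡ 0ℚ * b * e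
    lemma = solve-∀ ℚ-ring
  G-≤ {a} (suc l) k m le = begin
    E (l ℕ.+ k) (step (G (suc l) m))
      ≤⟨ E-mono (l ℕ.+ k) (step-G l m) ⟩
    E (l ℕ.+ k) (λ q ls → G l m q ls + ε * fromℕ (suc l) * binom (suc (X ls)) m)
      ≡⟨ trans (E-+ (l ℕ.+ k) (G l m) (λ q ls → ε * fromℕ (suc l) * binom (suc (X ls)) m))
           (cong (_+_ (E (l ℕ.+ k) (G l m))) (E-*ˡ (l ℕ.+ k) (ε * fromℕ (suc l)) (λ _ ls → binom (suc (X ls)) m))) ⟩
    E (l ℕ.+ k) (G l m) + ε * fromℕ (suc l) * E (l ℕ.+ k) (λ _ ls → binom (suc (X ls)) m)
      ≤⟨ +-mono-≤ (G-≤ l k m le′) (*-monoˡ {ε * fromℕ (suc l)} (*-nonNeg 0≤ε (0≤fromℕ (suc l))) (shifted-moment-≤ (l ℕ.+ k) m le′)) ⟩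
    triangular l * b * ε + ε * fromℕ (suc l) * b
      ≡⟨ lemma (triangular l) b ε (fromℕ (suc l)) ⟩
    (triangular l + fromℕ (suc l)) * b * ε ∎
    where
    open ≤-Reasoning
    b = prevTerm a m + expTerm a m
    le′ : time (l ℕ.+ k) ≤ a
    le′ = time-mono (ℕ.n≤1+n (l ℕ.+ k)) le
    lemma : ∀ t b e f → t * b * e + e * f * b ≡ (t + f) * b * e
    lemma = solve-∀ ℚ-ring

  -- The solution of λ_{k+1} = λ_k + ε (1 − j λ_k) with λ_0 = 0 is (1 − (1 − jε)ᵏ) / j.
  survival : ℚ
  survival = 1ℚ - fromℕ j * ε

  rate : ℕ → ℚ
  rate k = recip (suc i) * (1ℚ - survival ^ k)

  module _ (jε≤1 : fromℕ j * ε ≤ 1ℚ) where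

    0≤survival : 0ℚ ≤ survival
    0≤survival = p≤q⇒0≤q-p jε≤1

    survival≤1 : survival ≤ 1ℚ
    survival≤1 = p-q≤p (*-nonNeg (0≤fromℕ j) 0≤ε)

    rate-suc : ∀ k → rate (suc k) ≡ rate k + ε * survival ^ k
    rate-suc k = begin
      recip (suc i) * (1ℚ - (1ℚ - fromℕ j * ε) * s)
        ≡⟨ lemma (recip (suc i)) (fromℕ j) ε s ⟩
      recip (suc i) * (1ℚ - s) + fromℕ j * (recip (suc i) * (ε * s))
        ≡⟨ cong (_+_ (rate k)) (fromℕ*recip*q (suc i) (ε * s)) ⟩
      recip (suc i) * (1ℚ - s) + ε * s                                         ∎
      where
      open ≡-Reasoning
      s = survival ^ k
      lemma : ∀ c f e s → c * (1ℚ - (1ℚ - f * e) * s) ≡ c * (1ℚ - s) + f * (c * (e * s))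
      lemma = solve-∀ ℚ-ring

    0≤rate : ∀ k → 0ℚ ≤ rate k
    0≤rate k = *-nonNeg (0≤recip (suc i)) (p≤q⇒0≤q-p (^-≤1 0≤survival survival≤1 k))

    rate≤1 : ∀ k → rate k ≤ 1ℚ
    rate≤1 k = ≤-trans (p*q≤p (0≤recip (suc i)) (p-q≤p (^-nonNeg 0≤survival k))) (recip-≤1 (suc i))

    increment≤ε : ∀ k → ε * survival ^ k ≤ ε
    increment≤ε k = p*q≤p 0≤ε (^-≤1 0≤survival survival≤1 k)

    rate≤time : ∀ k → rate k ≤ time k
    rate≤time zero    = ≤-reflexive (lemma (recip (suc i)) ε)
      where
      lemma : ∀ c e → c * (1ℚ - 1ℚ) ≡ 0ℚ * e
      lemma = solve-∀ ℚ-ring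
    rate≤time (suc k) = subst₂ _≤_ (sym (rate-suc k)) (time-suc k) (+-mono-≤ (rate≤time k) (increment≤ε k))

    -- The increment of the rate is ε(1 - jλ), so a first-order expansion of λᵐ/m! reproduces the
    -- moment recursion without `G`; the Taylor remainder is the only discrepancy.
    expTerm-rate-suc : ∀ m k → expTerm (rate (suc k)) (suc m) ≡
      (1ℚ - ε * (fromℕ j * fromℕ (suc m))) * expTerm (rate k) (suc m) + ε * expTerm (rate k) m
        + taylor (rate k) (ε * survival ^ k) (suc m)
    expTerm-rate-suc m k = begin
      expTerm (rate (suc k)) (suc m)
        ≡⟨ cong (λ x → expTerm x (suc m)) (rate-suc k) ⟩
      expTerm (rate k + ε * s) (suc m)
        ≡⟨ lemma₁ (expTerm (rate k + ε * s) (suc m)) t′ (ε * s) t ⟩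
      t′ + ε * s * t + R                                       ≡⟨ cong (λ u → t′ + ε * u * t + R) s≡1-jλ ⟩
      t′ + ε * (1ℚ - fromℕ j * rate k) * t + R                 ≡⟨ lemma₂ t′ ε (fromℕ j) (rate k) t R ⟩
      t′ - ε * fromℕ j * (rate k * t) + ε * t + R
        ≡⟨ cong (λ u → t′ - ε * fromℕ j * u + ε * t + R) (expTerm-suc (rate k) m) ⟨
      t′ - ε * fromℕ j * (fromℕ (suc m) * t′) + ε * t + R      ≡⟨ lemma₃ t′ ε (fromℕ j) (fromℕ (suc m)) t R ⟩
      (1ℚ - ε * (fromℕ j * fromℕ (suc m))) * t′ + ε * t + R    ∎
      where
      open ≡-Reasoning
      s = survival ^ k ; t = expTerm (rate k) m ; t′ = expTerm (rate k) (suc m)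
      R = taylor (rate k) (ε * s) (suc m)
      lemma₀ : ∀ s → s ≡ 1ℚ - (1ℚ - s)
      lemma₀ = solve-∀ ℚ-ring
      s≡1-jλ : s ≡ 1ℚ - fromℕ j * rate k
      s≡1-jλ = trans (lemma₀ s) (cong (λ u → 1ℚ - u) (sym (fromℕ*recip*q (suc i) (1ℚ - s))))
      lemma₁ : ∀ y a d t → y ≡ a + d * t + (y - (a + d * t))
      lemma₁ = solve-∀ ℚ-ring
      lemma₂ : ∀ a e f l t R → a + e * (1ℚ - f * l) * t + R ≡ a - e * f * (l * t) + e * t + R
      lemma₂ = solve-∀ ℚ-ring
      lemma₃ : ∀ a e f g t R → a - e * f * (g * a) + e * t + R ≡ (1ℚ - e * (f * g)) * a + e * t + R
      lemma₃ = solve-∀ ℚ-ring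

    moment-suc : ∀ m k → E (suc k) (M (suc m)) ≡
      (1ℚ - ε * (fromℕ j * fromℕ (suc m))) * E k (M (suc m)) + ε * (E k (M m) - E k (G j m))
    moment-suc m k = begin
      E k (step (M (suc m)))                                                     ≡⟨ E-cong k (step-M m) ⟩
      E k (λ q ls → u * M (suc m) q ls + ε * (M m q ls - G j m q ls))
        ≡⟨ E-linear k u ε (M (suc m)) (λ q ls → M m q ls - G j m q ls) ⟩
      u * E k (M (suc m)) + ε * E k (λ q ls → M m q ls - G j m q ls)
        ≡⟨ cong (λ v → u * E k (M (suc m)) + ε * v) (E-minus k (M m) (G j m)) ⟩
      u * E k (M (suc m)) + ε * (E k (M m) - E k (G j m))                        ∎
      where
      open ≡-Reasoning
      u = 1ℚ - ε * (fromℕ j * fromℕ (suc m))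

    -- From step j on the cycle of the centre is long with high probability.
    moment-close : ∀ {a} m k → time (k ℕ.+ j) ≤ a → ε * (fromℕ j * fromℕ m) ≤ 1ℚ →
      ∣ E (k ℕ.+ j) (M m) - expTerm (rate (k ℕ.+ j)) m ∣ ≤ momentError j a m * ε
    moment-close {a} zero k _ _ = ≤-reflexive (trans (cong (λ e → ∣ e - 1ℚ ∣) (E-const (k ℕ.+ j) 1ℚ)) (sym (*-zeroˡ ε)))
    moment-close {a} (suc m) k le jmε≤1 = begin
      ∣ E (k ℕ.+ j) (M (suc m)) - expTerm (rate (k ℕ.+ j)) (suc m) ∣     ≤⟨ go k le ⟩
      (J + J) * expTerm a m * ε + time k * K * ε                         ≤⟨ +-monoʳ-≤ ((J + J) * expTerm a m * ε)
        (*-monoʳ {time k * K} 0≤ε (*-monoʳ {time k} 0≤K (time-mono (ℕ.m≤m+n k j) le))) ⟩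
      (J + J) * expTerm a m * ε + a * K * ε
        ≡⟨ *-distribʳ-+ ε ((J + J) * expTerm a m) (a * K) ⟨
      momentError j a (suc m) * ε                                        ∎
      where
      open ≤-Reasoning
      J = fromℕ j
      K = momentError j a m + triangular j * (prevTerm a m + expTerm a m) + 1ℚ
      0≤a : 0ℚ ≤ a
      0≤a = ≤-trans (0≤time (k ℕ.+ j)) le
      0≤K : 0ℚ ≤ K
      0≤K = +-mono-≤ (+-mono-≤ (0≤momentError j 0≤a m)
        (*-nonNeg (0≤triangular j) (+-mono-≤ (0≤prevTerm 0≤a m) (0≤expTerm 0≤a m)))) 0≤1
      jm′ε≤1 : ε * (J * fromℕ m) ≤ 1ℚ
      jm′ε≤1 = ≤-trans (*-monoˡ 0≤ε (*-monoˡ (0≤fromℕ j) (fromℕ-mono-≤ (ℕ.n≤1+n m)))) jmε≤1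
      u = 1ℚ - ε * (J * fromℕ (suc m))
      0≤u : 0ℚ ≤ u
      0≤u = p≤q⇒0≤q-p jmε≤1
      u≤1 : u ≤ 1ℚ
      u≤1 = p-q≤p (*-nonNeg 0≤ε (*-nonNeg (0≤fromℕ j) (0≤fromℕ (suc m))))
      lemma : ∀ u a b e v t g R → u * (a - b) + e * (v - t) - e * g - R ≡ u * a + e * (v - g) - (u * b + e * t + R)
      lemma = solve-∀ ℚ-ring
      go : ∀ k → time (k ℕ.+ j) ≤ a →
        ∣ E (k ℕ.+ j) (M (suc m)) - expTerm (rate (k ℕ.+ j)) (suc m) ∣ ≤ (J + J) * expTerm a m * ε + time k * K * ε
      -- At time j nothing is known about the difference, so both terms are bounded separately by
      -- t_{m+1}(jε) ≤ jε t_m(a). This is the origin of the summand with `J + J`.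
      go zero le = begin
        ∣ E j (M (suc m)) - expTerm (rate j) (suc m) ∣
          ≤⟨ ∣p-q∣≤a+b {E j (M (suc m))} {expTerm (rate j) (suc m)}
               (≤-trans (≤-reflexive (0≤p⇒∣p∣≡p (E-nonNeg j (0≤M (suc m))))) (moment-≤ j (suc m)))
               (≤-trans (≤-reflexive (0≤p⇒∣p∣≡p (0≤expTerm (0≤rate j) (suc m)))) (expTerm-mono (0≤rate j) (rate≤time j) (suc m))) ⟩
        expTerm (time j) (suc m) + expTerm (time j) (suc m)
          ≤⟨ +-mono-≤ t≤ t≤ ⟩
        time j * expTerm a m + time j * expTerm a m
          ≡⟨ lemma′ J ε (expTerm a m) K ⟩
        (J + J) * expTerm a m * ε + time 0 * K * ε ∎
        where
        t≤ : expTerm (time j) (suc m) ≤ time j * expTerm a m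
        t≤ = ≤-trans (expTerm-suc-≤ (0≤time j) m) (*-monoˡ (0≤time j) (expTerm-mono (0≤time j) le m))
        lemma′ : ∀ f e t k → f * e * t + f * e * t ≡ (f + f) * t * e + 0ℚ * e * k * e
        lemma′ = solve-∀ ℚ-ring
      -- The old error is not amplified, since 0 ≤ u ≤ 1. The three parts of K arise from the error
      -- of order m, from `G` and from the Taylor remainder, each contributing a multiple of ε² per
      -- step.
      go (suc k) le = begin
        ∣ E (suc n) (M (suc m)) - expTerm (rate (suc n)) (suc m) ∣
          ≡⟨ cong ∣_∣ (trans (cong₂ _-_ (moment-suc m n) (expTerm-rate-suc m n))
               (sym (lemma u Eₘ₊₁ tₘ₊₁ ε (E n (M m)) (expTerm (rate n) m) (E n (G j m)) R))) ⟩
        ∣ u * (Eₘ₊₁ - tₘ₊₁) + ε * (E n (M m) - expTerm (rate n) m) - ε * E n (G j m) - R ∣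
          ≤⟨ ∣p-q∣≤a+b {u * (Eₘ₊₁ - tₘ₊₁) + ε * (E n (M m) - expTerm (rate n) m) - ε * E n (G j m)} {R}
               (∣p-q∣≤a+b {u * (Eₘ₊₁ - tₘ₊₁) + ε * (E n (M m) - expTerm (rate n) m)} {ε * E n (G j m)}
                 (∣p+q∣≤a+b {u * (Eₘ₊₁ - tₘ₊₁)} {ε * (E n (M m) - expTerm (rate n) m)}
                   (∣p*q∣≤a*b {u} {Eₘ₊₁ - tₘ₊₁} (≤-trans (≤-reflexive (0≤p⇒∣p∣≡p 0≤u)) u≤1) (go k le′))
                   (∣p*q∣≤a*b {ε} {E n (M m) - expTerm (rate n) m} (≤-reflexive (0≤p⇒∣p∣≡p 0≤ε)) (moment-close m k le′ jm′ε≤1)))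
                 (∣p*q∣≤a*b {ε} {E n (G j m)} (≤-reflexive (0≤p⇒∣p∣≡p 0≤ε))
                   (≤-trans (≤-reflexive (0≤p⇒∣p∣≡p (E-nonNeg n (0≤G j m)))) G-small)))
               R-small ⟩
        1ℚ * (C + time k * K * ε) + ε * (momentError j a m * ε) + ε * (triangular j * B * ε) + ε * ε
          ≡⟨ lemma′ C (fromℕ k) ε (momentError j a m) (triangular j * B) ⟩
        C + (1ℚ + fromℕ k) * ε * K * ε
          ≡⟨ cong (λ f → C + f * ε * K * ε) (fromℕ-suc k) ⟨
        C + time (suc k) * K * ε ∎
        where
        n = k ℕ.+ j
        Eₘ₊₁ = E n (M (suc m)) ; tₘ₊₁ = expTerm (rate n) (suc m)
        R = taylor (rate n) (ε * survival ^ n) (suc m)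
        C = (J + J) * expTerm a m * ε ; B = prevTerm a m + expTerm a m
        le′ : time (k ℕ.+ j) ≤ a
        le′ = time-mono (ℕ.n≤1+n (k ℕ.+ j)) le
        G-small : E n (G j m) ≤ triangular j * B * ε
        G-small = subst (λ n → E n (G j m) ≤ triangular j * B * ε) (ℕ.+-comm j k)
          (G-≤ j k m (subst (λ n → time n ≤ a) (ℕ.+-comm k j) le′))
        0≤d : 0ℚ ≤ ε * survival ^ n
        0≤d = *-nonNeg 0≤ε (^-nonNeg 0≤survival n)
        R-small : ∣ R ∣ ≤ ε * ε
        R-small = ≤-trans (≤-reflexive (0≤p⇒∣p∣≡p (taylor-nonNeg (0≤rate n) 0≤d (suc m))))
          (≤-trans (taylor-≤ (0≤rate n) 0≤d (subst (_≤ 1ℚ) (rate-suc n) (rate≤1 (suc n))) (suc m))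
            (*-mono-≤ 0≤d 0≤ε (increment≤ε n) (increment≤ε n)))
        lemma′ : ∀ c k e d g → 1ℚ * (c + k * e * (d + g + 1ℚ) * e) + e * (d * e) + e * (g * e) + e * e ≡
          c + (1ℚ + k) * e * (d + g + 1ℚ) * e
        lemma′ = solve-∀ ℚ-ring

-- Limits

null-∣-∣ : ∀ {s} → Null s → Null λ n → ∣ s n ∣
null-∣-∣ {s} s-null ε 0<ε = eventually-map (s-null ε 0<ε) λ n → subst (_≤ ε) (sym (∣∣p∣∣≡∣p∣ (s n)))

null-*recip : ∀ b → Null λ n → b * recip n
null-*recip b = null-* (bounded-const b) null-recip

eventually-*recip-≤ : ∀ b ε → 0ℚ < ε → Eventually λ n → b * recip n ≤ ε
eventually-*recip-≤ b ε 0<ε = eventually-map (null-*recip b ε 0<ε) λ n → ∣p∣≤b⇒p≤b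

-- The limit of (1 - y)ᵏ when y → 0 and ky approaches x.

binom*^≤expTerm : ∀ {y} → 0ℚ ≤ y → ∀ k m → y ^ m * binom k m ≤ expTerm (fromℕ k * y) m
binom*^≤expTerm 0≤y k zero = ≤-refl
binom*^≤expTerm {y} 0≤y zero (suc m) = ≤-trans (≤-reflexive (*-zeroʳ (y * y ^ m))) (0≤expTerm (*-nonNeg (0≤fromℕ 0) 0≤y) (suc m))
binom*^≤expTerm {y} 0≤y (suc k) (suc m) = begin
  y * y ^ m * (binom k m + binom k (suc m))
    ≡⟨ lemma y (y ^ m) (binom k m) (binom k (suc m)) ⟩
  y * y ^ m * binom k (suc m) + y * (y ^ m * binom k m)
    ≤⟨ +-mono-≤ (binom*^≤expTerm 0≤y k (suc m)) (*-monoˡ 0≤y (binom*^≤expTerm 0≤y k m)) ⟩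
  expTerm x (suc m) + y * expTerm x m
    ≤⟨ 0≤q-p⇒p≤q (taylor-nonNeg (*-nonNeg (0≤fromℕ k) 0≤y) 0≤y (suc m)) ⟩
  expTerm (x + y) (suc m)
    ≡⟨ cong (λ t → expTerm t (suc m)) (trans (lemma′ (fromℕ k) y) (cong (_* y) (sym (fromℕ-suc k)))) ⟩
  expTerm (fromℕ (suc k) * y) (suc m)                            ∎
  where
  open ≤-Reasoning
  x = fromℕ k * y
  lemma : ∀ y p a b → y * p * (a + b) ≡ y * p * b + y * (p * a)
  lemma = solve-∀ ℚ-ring
  lemma′ : ∀ f y → f * y + y ≡ (1ℚ + f) * y
  lemma′ = solve-∀ ℚ-ring

module PowerLimit (k : ℕ → ℕ) (y : ℕ → ℚ) (x : ℕ → ℚ) (x-bounded : Bounded x)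
  (0≤y : ∀ n → 0ℚ ≤ y n) (y≤1 : Eventually λ n → y n ≤ 1ℚ) (y-null : Null y)
  (ky≋x : (λ n → fromℕ (k n) * y n) ≋ x) where

  newton-term : ∀ m → (λ n → diff m ((1ℚ - y n) ^_) 0 * binom (k n) m) ≋ (λ n → expTerm (- x n) m)
  newton-term zero    = null⇒≋ (null-cong {s = λ _ → 0ℚ} (λ _ → refl) null-zero)
  newton-term (suc m) = null⇒≋ (null-cong recursion (≋⇒null
    (≋-* (expTerm-bounded {t = λ n → - x n} (bounded-- x-bounded) m)
      (bounded-* (bounded-- x-bounded) (bounded-const (recip m)))
      (newton-term m)
      (≋-* (bounded-- x-bounded) (bounded-const (recip m)) factor≋ ≋-refl))))
    where
    -- The ratio of the consecutive binomial terms m + 1 and m is -y(k - m)/(m + 1); this is its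
    -- numerator, which tends to -x.
    factor : ℕ → ℚ
    factor n = - (fromℕ (k n) * y n) + fromℕ m * y n
    factor≋ : factor ≋ (λ n → - x n)
    factor≋ = null⇒≋ (null-cong (λ n → lemma (x n) (fromℕ (k n) * y n) (fromℕ m) (y n))
      (null-+ (≋⇒null (≋-sym ky≋x)) (null-* (bounded-const (fromℕ m)) y-null)))
      where
      lemma : ∀ x z f y → (x - z) + f * y ≡ (- z + f * y) - (- x)
      lemma = solve-∀ ℚ-ring
    recursion : ∀ n → diff m ((1ℚ - y n) ^_) 0 * binom (k n) m * (factor n * recip m) - expTerm (- x n) (suc m) ≡
      diff (suc m) ((1ℚ - y n) ^_) 0 * binom (k n) (suc m) - expTerm (- x n) (suc m)
    recursion n = cong (_- expTerm (- x n) (suc m)) (fromℕ-cancel m (begin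
      f₁ * (diff m φ 0 * b * (factor n * recip m))
        ≡⟨ cong (λ d → f₁ * (d * b * (factor n * recip m))) (diff-power p m 0) ⟩
      f₁ * ((p - 1ℚ) ^ m * 1ℚ * b * (factor n * recip m))
        ≡⟨ lemma₁ f₁ ((p - 1ℚ) ^ m) b (factor n) (recip m) ⟩
      f₁ * (recip m * ((p - 1ℚ) ^ m * b * factor n))
        ≡⟨ fromℕ*recip*q m ((p - 1ℚ) ^ m * b * factor n) ⟩
      (p - 1ℚ) ^ m * b * factor n
        ≡⟨ lemma₂ (y n) ((p - 1ℚ) ^ m) b (fromℕ (k n)) (fromℕ m) ⟩
      (p - 1ℚ) * (p - 1ℚ) ^ m * 1ℚ * ((fromℕ (k n) - fromℕ m) * b)
        ≡⟨ cong ((p - 1ℚ) * (p - 1ℚ) ^ m * 1ℚ *_) (binom-sucʳ (k n) m) ⟨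
      (p - 1ℚ) * (p - 1ℚ) ^ m * 1ℚ * (f₁ * b₁)
        ≡⟨ cong (_* (f₁ * b₁)) (diff-power p (suc m) 0) ⟨
      diff (suc m) φ 0 * (f₁ * b₁)                             ≡⟨ lemma₃ (diff (suc m) φ 0) f₁ b₁ ⟩
      f₁ * (diff (suc m) φ 0 * b₁)                             ∎))
      where
      open ≡-Reasoning
      p = 1ℚ - y n ; φ = p ^_ ; b = binom (k n) m ; b₁ = binom (k n) (suc m) ; f₁ = fromℕ (suc m)
      lemma₁ : ∀ f a b g r → f * (a * 1ℚ * b * (g * r)) ≡ f * (r * (a * b * g))
      lemma₁ = solve-∀ ℚ-ring
      lemma₂ : ∀ y a b k m → a * b * (- (k * y) + m * y) ≡ ((1ℚ - y) - 1ℚ) * a * 1ℚ * ((k - m) * b)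
      lemma₂ = solve-∀ ℚ-ring
      lemma₃ : ∀ d f b → d * (f * b) ≡ f * (d * b)
      lemma₃ = solve-∀ ℚ-ring

  newton-≋ : ∀ M → (λ n → newton ((1ℚ - y n) ^_) M (k n)) ≋ (λ n → expSum (- x n) M)
  newton-≋ zero    = ≋-refl
  newton-≋ (suc M) = ≋-+ (newton-≋ M) (newton-term M)

  newton-close : ∀ {b} M n → y n ≤ 1ℚ → fromℕ (k n) * y n ≤ b →
    ∣ (1ℚ - y n) ^ k n - newton ((1ℚ - y n) ^_) M (k n) ∣ ≤ expTerm b M
  newton-close {b} M n yn≤1 ky≤b = begin
    ∣ p ^ k n - newton (p ^_) M (k n) ∣    ≤⟨ newton-remainder M (p ^_) (y n ^ M) diff≤ (k n) ⟩
    y n ^ M * binom (k n) M                ≤⟨ binom*^≤expTerm (0≤y n) (k n) M ⟩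
    expTerm (fromℕ (k n) * y n) M          ≤⟨ expTerm-mono (*-nonNeg (0≤fromℕ (k n)) (0≤y n)) ky≤b M ⟩
    expTerm b M                            ∎
    where
    open ≤-Reasoning
    p = 1ℚ - y n
    0≤p : 0ℚ ≤ p
    0≤p = p≤q⇒0≤q-p yn≤1
    ∣p-1∣ : ∣ p - 1ℚ ∣ ≤ y n
    ∣p-1∣ = ≤-reflexive (trans (cong ∣_∣ (lemma (y n))) (trans (∣-p∣≡∣p∣ (y n)) (0≤p⇒∣p∣≡p (0≤y n))))
      where
      lemma : ∀ y → (1ℚ - y) - 1ℚ ≡ - y
      lemma = solve-∀ ℚ-ring
    ∣^∣≤ : ∀ m → ∣ (p - 1ℚ) ^ m ∣ ≤ y n ^ m
    ∣^∣≤ zero    = ≤-refl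
    ∣^∣≤ (suc m) = ∣p*q∣≤a*b {p - 1ℚ} {(p - 1ℚ) ^ m} ∣p-1∣ (∣^∣≤ m)
    diff≤ : ∀ l → ∣ diff M (p ^_) l ∣ ≤ y n ^ M
    diff≤ l = subst₂ (λ u v → ∣ u ∣ ≤ v) (sym (diff-power p M l)) (*-identityʳ (y n ^ M))
      (∣p*q∣≤a*b {(p - 1ℚ) ^ M} {p ^ l} (∣^∣≤ M)
        (≤-trans (≤-reflexive (0≤p⇒∣p∣≡p (^-nonNeg 0≤p l))) (^-≤1 0≤p (p-q≤p (0≤y n)) l)))

  -- For fixed M the truncated binomial expansion converges term by term to the truncated
  -- exponential series. The two truncation errors, bᴹ/M! and a tail of that series, are small
  -- uniformly in n.
  power-≋ : (λ n → (1ℚ - y n) ^ k n) ≋ (λ n → expSum (- x n) n)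
  power-≋ = null⇒≋ $ null-approx λ η 0<η →
    let a , x≤a = bounded-- x-bounded
        b , ky≤b = bounded-≋ ky≋x x-bounded
        M₀ , tail = expTail-small a (η * ½) (0<½p 0<η)
        M₁ , term = expTerm-small b (η * ½) (0<½p 0<η)
        M = M₀ ℕ.⊔ M₁
    in (λ n → ∣ newton ((1ℚ - y n) ^_) M (k n) - expSum (- x n) M ∣) ,
      null-∣-∣ (≋⇒null (newton-≋ M)) ,
      eventually-map₂ (eventually-map₂ x≤a ky≤b λ _ → _,_) (eventually-map₂ y≤1 (eventually-≥ M) λ _ → _,_)
        λ n (x≤a , ky≤b) (y≤1 , M≤n) → combine η M n
          (≤-trans (newton-close M n y≤1 (∣p∣≤b⇒p≤b ky≤b)) (term M (ℕ.m≤n⊔m M₀ M₁)))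
          (tail x≤a M n (ℕ.m≤m⊔n M₀ M₁) M≤n)
    where
    combine : ∀ η M n → let p = (1ℚ - y n) ^ k n ; q = newton ((1ℚ - y n) ^_) M (k n) ; e = expSum (- x n) in
      ∣ p - q ∣ ≤ η * ½ → ∣ e n - e M ∣ ≤ η * ½ → ∣ p - e n ∣ ≤ ∣ q - e M ∣ + η
    combine η M n p-q e-e = subst (∣ p - e n ∣ ≤_)
      (trans (lemma (η * ½) ∣ q - e M ∣) (cong (_+_ ∣ q - e M ∣) (half+half η)))
      (∣p-r∣≤a+b {p} {q} {e n} p-q (∣p-r∣≤a+b {q} {e M} {e n} ≤-refl
        (subst (_≤ η * ½) (∣p-q∣≡∣q-p∣ (e n) (e M)) e-e)))
      where
      p = (1ℚ - y n) ^ k n ; q = newton ((1ℚ - y n) ^_) M (k n) ; e = expSum (- x n)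
      lemma : ∀ h t → h + (t + h) ≡ t + (h + h)
      lemma = solve-∀ ℚ-ring

-- Factorials and Poisson weights.

fromℕ-* : ∀ m n → fromℕ (m ℕ.* n) ≡ fromℕ m * fromℕ n
fromℕ-* zero    n = sym (*-zeroˡ (fromℕ n))
fromℕ-* (suc m) n = begin
  fromℕ (n ℕ.+ m ℕ.* n)               ≡⟨ fromℕ-+ n (m ℕ.* n) ⟩
  fromℕ n + fromℕ (m ℕ.* n)           ≡⟨ cong (_+_ (fromℕ n)) (fromℕ-* m n) ⟩
  fromℕ n + fromℕ m * fromℕ n         ≡⟨ lemma (fromℕ m) (fromℕ n) ⟩
  (1ℚ + fromℕ m) * fromℕ n            ≡⟨ cong (_* fromℕ n) (fromℕ-suc m) ⟨
  fromℕ (suc m) * fromℕ n             ∎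
  where
  open ≡-Reasoning
  lemma : ∀ a b → b + a * b ≡ (1ℚ + a) * b
  lemma = solve-∀ ℚ-ring

1/! : ℕ → ℚ
1/! v = (+ 1 / v ℕ.!) {{v ℕ.!≢0}}

fromℕ*1/ : ∀ n .{{_ : NonZero n}} → fromℕ n * (+ 1 / n) ≡ 1ℚ
fromℕ*1/ (suc n) = fromℕ*recip n

1/!-suc : ∀ v → 1/! (suc v) ≡ recip v * 1/! v
1/!-suc v = begin
  w′                                        ≡⟨ *-identityʳ w′ ⟨
  w′ * 1ℚ                                   ≡⟨ cong (w′ *_) one ⟨
  w′ * (F * (recip v * w))                  ≡⟨ lemma w′ F (recip v * w) ⟩
  (F * w′) * (recip v * w)
    ≡⟨ cong (_* (recip v * w)) (fromℕ*1/ (suc v ℕ.!) {{suc v ℕ.!≢0}}) ⟩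
  1ℚ * (recip v * w)                        ≡⟨ *-identityˡ (recip v * w) ⟩
  recip v * w                               ∎
  where
  open ≡-Reasoning
  w = 1/! v ; w′ = 1/! (suc v) ; F = fromℕ (suc v ℕ.!)
  lemma : ∀ a b c → a * (b * c) ≡ (b * a) * c
  lemma = solve-∀ ℚ-ring
  lemma′ : ∀ a b c d → a * b * (c * d) ≡ (a * c) * (b * d)
  lemma′ = solve-∀ ℚ-ring
  one : F * (recip v * w) ≡ 1ℚ
  one = begin
    F * (recip v * w)                                  ≡⟨ cong (_* (recip v * w)) (fromℕ-* (suc v) (v ℕ.!)) ⟩
    fromℕ (suc v) * fromℕ (v ℕ.!) * (recip v * w)      ≡⟨ lemma′ (fromℕ (suc v)) (fromℕ (v ℕ.!)) (recip v) w ⟩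
    (fromℕ (suc v) * recip v) * (fromℕ (v ℕ.!) * w)
      ≡⟨ cong₂ _*_ (fromℕ*recip v) (fromℕ*1/ (v ℕ.!) {{v ℕ.!≢0}}) ⟩
    1ℚ * 1ℚ                                            ≡⟨⟩
    1ℚ                                                 ∎

expTerm-! : ∀ x v → expTerm x v ≡ x ^ v * 1/! v
expTerm-! x zero    = refl
expTerm-! x (suc v) = trans (cong (_* (x * recip v)) (expTerm-! x v))
  (trans (lemma (x ^ v) (1/! v) x (recip v)) (cong (x * x ^ v *_) (sym (1/!-suc v))))
  where
  lemma : ∀ p w x r → p * w * (x * r) ≡ x * p * (r * w)
  lemma = solve-∀ ℚ-ring

seq-^ℝ : ∀ x v n → seq (x ^ℝ v) n ≡ seq x n ^ v
seq-^ℝ x zero    n = refl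
seq-^ℝ x (suc v) n = cong (seq x n *_) (seq-^ℝ x v n)

seq-poisson : ∀ x v n → seq (poisson x v) n ≡ expTerm (seq x n) v * expSum (- seq x n) n
seq-poisson x v n = begin
  expSum (- seq x n) n * seq (x ^ℝ v) n * 1/! v
    ≡⟨ cong (λ p → expSum (- seq x n) n * p * 1/! v) (seq-^ℝ x v n) ⟩
  expSum (- seq x n) n * seq x n ^ v * 1/! v         ≡⟨ lemma (expSum (- seq x n) n) (seq x n ^ v) (1/! v) ⟩
  seq x n ^ v * 1/! v * expSum (- seq x n) n
    ≡⟨ cong (_* expSum (- seq x n) n) (expTerm-! (seq x n) v) ⟨
  expTerm (seq x n) v * expSum (- seq x n) n         ∎
  where
  open ≡-Reasoning
  lemma : ∀ e p w → e * p * w ≡ p * w * e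
  lemma = solve-∀ ℚ-ring

-- It suffices to compare with the diagonal of the limit, which is a Cauchy sequence.
≋⇒⟶ : ∀ (y : ℕ → ℝ) s x → (∀ r n → seq (y r) n ≡ s r) → s ≋ seq x → y ⟶ x
≋⇒⟶ y s x y≡s s≋x ε 0<ε =
  -- Two errors of ε/4 leave a gap of ε/2, the positive witness that `_<ℝ_` asks for.
  let N₀ , close = ≋⇒null s≋x (ε * ½ * ½) (0<½p (0<½p 0<ε))
      N₁ , cauchy-x = cauchy x (ε * ½ * ½) (0<½p (0<½p 0<ε))
  in N₀ ℕ.⊔ N₁ , λ r N≤r →
    let near = λ n N₁≤n → ∣p-r∣≤a+b {s r} {seq x r} {seq x n} (close r (ℕ.≤-trans (ℕ.m≤m⊔n N₀ N₁) N≤r))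
                 (<⇒≤ (cauchy-x r n (ℕ.≤-trans (ℕ.m≤n⊔m N₀ N₁) N≤r) N₁≤n))
    in (ε * ½ , 0<½p 0<ε , N₁ , λ n N₁≤n → finish (subst (λ p → p - seq x n ≤ ε * ½ * ½ + ε * ½ * ½)
           (sym (y≡s r n)) (∣p∣≤b⇒p≤b (near n N₁≤n)))) ,
       (ε * ½ , 0<½p 0<ε , N₁ , λ n N₁≤n → finish (subst (λ p → seq x n - p ≤ ε * ½ * ½ + ε * ½ * ½)
           (sym (y≡s r n)) (∣p∣≤b⇒p≤b (subst (_≤ ε * ½ * ½ + ε * ½ * ½) (∣p-q∣≡∣q-p∣ (s r) (seq x n)) (near n N₁≤n)))))
  where
  finish : ∀ {p} → p ≤ ε * ½ * ½ + ε * ½ * ½ → p + ε * ½ ≤ ε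
  finish {p} le = subst (p + ε * ½ ≤_) (half+half ε)
    (+-monoˡ-≤ (ε * ½) (≤-trans le (≤-reflexive (half+half (ε * ½)))))

-- The number of steps and the scaled time.

floor-close : ∀ c n m → IsFloor (c *ℝ fromℚ (fromℕ n)) m →
  Eventually λ l → ∣ fromℕ m - seq c l * fromℕ n ∣ ≤ 1ℚ
floor-close c n m (lower , δ , 0<δ , upper) = eventually-map₂ (lower 1ℚ 0<1) upper λ l m≤cn+1 cn+δ≤m+1 → ∣p∣≤b
  (0≤q-p⇒p≤q (subst (0ℚ ≤_) (lemma₁ (fromℕ m) (seq c l * fromℕ n)) (p≤q⇒0≤q-p m≤cn+1)))
  (≤-trans (p≤p+q (<⇒≤ 0<δ)) (0≤q-p⇒p≤q (subst (0ℚ ≤_)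
    (trans (cong (_- (seq c l * fromℕ n + δ)) (fromℕ-suc m)) (lemma₂ (fromℕ m) (seq c l * fromℕ n) δ))
    (p≤q⇒0≤q-p cn+δ≤m+1))))
  where
  lemma₁ : ∀ m x → (x + 1ℚ) - m ≡ 1ℚ - (m - x)
  lemma₁ = solve-∀ ℚ-ring
  lemma₂ : ∀ m x d → (1ℚ + m) - (x + d) ≡ 1ℚ - (- (m - x) + d)
  lemma₂ = solve-∀ ℚ-ring

module Scaling (c : ℝ) (k : ℕ → ℕ) (isFloor : ∀ r → IsFloor (c *ℝ fromℚ (fromℕ (2 ℕ.+ r))) (k r)) where

  scaled : ℕ → ℚ
  scaled r = fromℕ (k r) * recip r

  -- In 1 + b, the 1 is the rounding error of the floor, and b pays for scaling by n - 1 instead of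
  -- n.
  scaled-close : ∀ {b η} r l → ∣ seq c l ∣ ≤ b → ∣ fromℕ (k r) - seq c l * fromℕ (2 ℕ.+ r) ∣ ≤ 1ℚ →
    ∣ seq c l - seq c r ∣ ≤ η → ∣ scaled r - seq c r ∣ ≤ (1ℚ + b) * recip r + η
  scaled-close {b} {η} r l c≤b floor c-c = ∣p-r∣≤a+b {scaled r} {seq c l} {seq c r}
    (subst₂ (λ p q → ∣ p ∣ ≤ q) eq (sym (*-distribʳ-+ ε 1ℚ b))
      (∣p+q∣≤a+b {(fromℕ (k r) - seq c l * fromℕ (2 ℕ.+ r)) * ε} {seq c l * ε}
        (∣p*q∣≤a*b {fromℕ (k r) - seq c l * fromℕ (2 ℕ.+ r)} {ε} floor ∣ε∣≤ε)
        (∣p*q∣≤a*b {seq c l} {ε} c≤b ∣ε∣≤ε))) c-c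
    where
    ε = recip r
    ∣ε∣≤ε : ∣ ε ∣ ≤ ε
    ∣ε∣≤ε = ≤-reflexive (0≤p⇒∣p∣≡p (0≤recip r))
    lemma₁ : ∀ m x f e → (m - x * (1ℚ + f)) * e + x * e ≡ m * e - x * (f * e)
    lemma₁ = solve-∀ ℚ-ring
    eq : (fromℕ (k r) - seq c l * fromℕ (2 ℕ.+ r)) * ε + seq c l * ε ≡ scaled r - seq c l
    eq = begin
      (fromℕ (k r) - seq c l * fromℕ (2 ℕ.+ r)) * ε + seq c l * ε
        ≡⟨ cong (λ f → (fromℕ (k r) - seq c l * f) * ε + seq c l * ε) (fromℕ-suc (suc r)) ⟩
      (fromℕ (k r) - seq c l * (1ℚ + fromℕ (suc r))) * ε + seq c l * ε
        ≡⟨ lemma₁ (fromℕ (k r)) (seq c l) (fromℕ (suc r)) ε ⟩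
      scaled r - seq c l * (fromℕ (suc r) * ε)
        ≡⟨ cong (λ p → scaled r - seq c l * p) (fromℕ*recip r) ⟩
      scaled r - seq c l * 1ℚ
        ≡⟨ cong (λ p → scaled r - p) (*-identityʳ (seq c l)) ⟩
      scaled r - seq c l                                                  ∎
      where open ≡-Reasoning

  scaled-≋ : scaled ≋ seq c
  scaled-≋ = null⇒≋ $ null-approx λ η 0<η →
    let b , N₀ , c≤b = bounded-seq c
        N₁ , close = cauchy c η 0<η
    in (λ r → (1ℚ + b) * recip r) , null-*recip (1ℚ + b) , N₁ , λ r N₁≤r →
      let N₂ , floor = floor-close c (2 ℕ.+ r) (k r) (isFloor r)
          -- The approximants of c respect the floor only from an index N₂ that depends on r. The
          -- comparison therefore passes through a later index l, which the Cauchy property joins to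
          -- r.
          l = N₀ ℕ.⊔ (N₁ ℕ.⊔ N₂)
      in scaled-close r l (c≤b l (ℕ.m≤m⊔n N₀ _))
           (floor l (ℕ.≤-trans (ℕ.m≤n⊔m N₁ N₂) (ℕ.m≤n⊔m N₀ _)))
           (<⇒≤ (close l r (ℕ.≤-trans (ℕ.m≤m⊔n N₁ N₂) (ℕ.m≤n⊔m N₀ _)) N₁≤r))

  ½p<p : ∀ {p} → 0ℚ < p → p * ½ < p
  ½p<p {p} 0<p = subst₂ _<_ (+-identityʳ (p * ½)) (half+half p) (+-monoʳ-< (p * ½) (0<½p 0<p))

  -- With k ≤ j the scaled time would be at most jε, which tends to 0, whereas it stays above half
  -- of a positive lower bound for c. Positivity of c enters here: `moment-close` and `G-≤` need j
  -- steps to have passed.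
  eventually-≤k : 0ℝ <ℝ c → ∀ j → Eventually λ r → j ℕ.≤ k r
  eventually-≤k 0<c j =
    let δ , 0<δ , δ≤c = 0<c
        0<½δ = 0<½p 0<δ
    in eventually-map₂ (eventually-map₂ δ≤c (≋⇒null scaled-≋ (δ * ½) 0<½δ) λ _ → _,_)
         (eventually-*recip-≤ (fromℕ j) (δ * ½ * ½) (0<½p 0<½δ))
         λ r (δ≤c , close) jε≤ → decide r δ 0<½δ δ≤c close jε≤
    where
    decide : ∀ r δ → 0ℚ < δ * ½ → 0ℚ + δ ≤ seq c r → ∣ scaled r - seq c r ∣ ≤ δ * ½ →
      fromℕ j * recip r ≤ δ * ½ * ½ → j ℕ.≤ k r
    decide r δ 0<½δ δ≤c close jε≤ with ℕ.≤-total j (k r)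
    ... | inj₁ j≤k = j≤k
    ... | inj₂ k≤j = contradiction (≤-<-trans (≤-trans scaled≥ scaled≤) (½p<p 0<½δ)) (<-irrefl refl)
      where
      scaled≤ : scaled r ≤ δ * ½ * ½
      scaled≤ = ≤-trans (*-monoʳ {fromℕ (k r)} (0≤recip r) (fromℕ-mono-≤ k≤j)) jε≤
      scaled≥ : δ * ½ ≤ scaled r
      scaled≥ = 0≤q-p⇒p≤q (subst (0ℚ ≤_) (trans (lemma δ (δ * ½) (scaled r) (seq c r))
          (cong (λ p → scaled r - p) (trans (cong (_- δ * ½) (sym (half+half δ))) (lemma′ (δ * ½)))))
        (+-mono-≤ (p≤q⇒0≤q-p (∣p∣≤b⇒-p≤b close)) (p≤q⇒0≤q-p (≤-trans (≤-reflexive (sym (+-identityˡ δ))) δ≤c))))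
        where
        lemma : ∀ d h s c → (h - - (s - c)) + (c - d) ≡ s - (d - h)
        lemma = solve-∀ ℚ-ring
        lemma′ : ∀ h → (h + h) - h ≡ h
        lemma′ = solve-∀ ℚ-ring

  survival-≋ : ∀ i → (λ r → Moments.survival r i ^ k r) ≋ (λ r → expSum (- (fromℕ (2 ℕ.+ i) * seq c r)) r)
  survival-≋ i = PowerLimit.power-≋ k (λ r → j * recip r) (λ r → j * seq c r)
    (bounded-* (bounded-const j) (bounded-seq c))
    (λ r → *-nonNeg (0≤fromℕ (2 ℕ.+ i)) (0≤recip r))
    (eventually-*recip-≤ j 1ℚ 0<1)
    (null-*recip j)
    (null⇒≋ (null-cong (λ r → cong (_- j * seq c r) (lemma j (fromℕ (k r)) (recip r)))
      (≋⇒null (≋-*ˡ j scaled-≋))))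
    where
    j = fromℕ (2 ℕ.+ i)
    lemma : ∀ j k e → j * (k * e) ≡ k * (j * e)
    lemma = solve-∀ ℚ-ring

  rate-≋ : ∀ i → (λ r → Moments.rate r i (k r)) ≋
    seq (fromℚ (+ 1 / suc (suc i)) *ℝ (1ℝ -ℝ exp (-ℝ (fromℚ (fromℕ (suc (suc i))) *ℝ c))))
  rate-≋ i = ≋-*ˡ (recip (suc i)) (null⇒≋ (null-cong
    (λ r → lemma (expSum (- (fromℕ (2 ℕ.+ i) * seq c r)) r) (Moments.survival r i ^ k r)) (≋⇒null (≋-sym (survival-≋ i)))))
    where
    lemma : ∀ a b → a - b ≡ (1ℚ - b) - (1ℚ - a)
    lemma = solve-∀ ℚ-ring

-- From moments to point probabilities and distribution functions.

module Law (i : ℕ) (k : ℕ → ℕ) (eventually-j≤k : Eventually λ r → 2 ℕ.+ i ℕ.≤ k r)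
  (scaled-bounded : Bounded λ r → fromℕ (k r) * recip r)
  (ρ : ℝ) (rate-≋ : (λ r → Moments.rate r i (k r)) ≋ seq ρ) where

  j : ℕ
  j = suc (suc i)

  scaled rate : ℕ → ℚ
  scaled r = fromℕ (k r) * recip r
  rate r   = Moments.rate r i (k r)

  law : ℕ → ℕ → ℚ
  law v r = measure (pushforward (#cycles j) (star r ⊛^ k r)) (λ m → m ℕ.≟ v)

  pointX : ℕ → ∀ r → Observable
  pointX v r q ls = point v (Moments.X r i ls)

  ∣point∣≤1 : ∀ v x → ∣ point v x ∣ ≤ 1ℚ
  ∣point∣≤1 v x = ∣indicator∣≤1 (x ℕ.≟ v)
    where
    ∣indicator∣≤1 : ∀ {P : Set} (P? : Dec P) → ∣ fromℕ (indicator P?) ∣ ≤ 1ℚ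
    ∣indicator∣≤1 (yes _) = ≤-refl
    ∣indicator∣≤1 (no  _) = 0≤1

  -- The cycle of the centre itself is counted by #cycles but not by X.
  law-close : ∀ v r → ∣ law v r - Walk.E r (k r) (pointX v r) ∣ ≤ Walk.E r (k r) (Moments.G r i j 0)
  law-close v r = subst (λ p → ∣ p - E (k r) (pointX v r) ∣ ≤ E (k r) (G j 0))
    (sym (trans (measure-𝔼 (#cycles j) (star r ⊛^ k r) v)
      (𝔼-star^ (k r) (λ π → point v (#cycles j π)) (λ q ls → point v (count j (suc q ∷ ls)))
        λ sh → cong (point v) (#cycles-shape sh (suc i)))))
    (E-∣-∣ (k r) (λ q ls → point v (count j (suc q ∷ ls))) (pointX v r) (G j 0)
      λ q ls → centre (suc q ℕ.≟ j) (X ls) (below-suc q j) (0≤below (suc q) j))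
    where
    open Walk r
    open Moments r i hiding (rate; survival; j)
    -- The two counts differ only if q + 1 = j, an event contained in q < j.
    centre : ∀ {P : Set} (P? : Dec P) x {b b′} → b ≡ b′ + fromℕ (indicator P?) → 0ℚ ≤ b′ →
      ∣ point v (indicator P? ℕ.+ x) - point v x ∣ ≤ b * 1ℚ
    centre (no _) x {b} {b′} b≡ 0≤b′ = begin
      ∣ point v x - point v x ∣   ≡⟨ cong ∣_∣ (+-inverseʳ (point v x)) ⟩
      0ℚ                          ≤⟨ 0≤b′ ⟩
      b′                          ≡⟨ +-identityʳ b′ ⟨
      b′ + 0ℚ                     ≡⟨ b≡ ⟨
      b                           ≡⟨ *-identityʳ b ⟨
      b * 1ℚ                      ∎
      where open ≤-Reasoning
    centre (yes _) x {b} {b′} b≡ 0≤b′ = begin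
      ∣ point v (suc x) - point v x ∣   ≤⟨ indicators (suc x ℕ.≟ v) (x ℕ.≟ v) ⟩
      1ℚ                                ≤⟨ p≤q+p 0≤b′ ⟩
      b′ + 1ℚ                           ≡⟨ b≡ ⟨
      b                                 ≡⟨ *-identityʳ b ⟨
      b * 1ℚ                            ∎
      where
      open ≤-Reasoning
      indicators : ∀ {P Q : Set} (P? : Dec P) (Q? : Dec Q) → ∣ fromℕ (indicator P?) - fromℕ (indicator Q?) ∣ ≤ 1ℚ
      indicators (yes _) (yes _) = 0≤1
      indicators (yes _) (no  _) = ≤-refl
      indicators (no  _) (yes _) = ≤-refl
      indicators (no  _) (no  _) = 0≤1

  E-newton : ∀ r n φ L → Walk.E r n (λ q ls → newton φ L (Moments.X r i ls)) ≡
    sumTo L (λ m → diff m φ 0 * Walk.E r n (Moments.M r i m))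
  E-newton r n φ zero    = E-const n 0ℚ
    where open Walk r
  E-newton r n φ (suc L) = trans
    (E-+ n (λ q ls → newton φ L (X ls)) (λ q ls → diff L φ 0 * M L q ls))
    (cong₂ _+_ (E-newton r n φ L) (E-*ˡ n (diff L φ 0) (M L)))
    where
    open Walk r
    open Moments r i

  newtonError : ℚ → ℕ → ℚ
  newtonError a L = sumTo L λ m → fromℕ 2 ^ m * momentError j a m

  -- The first error is Newton's remainder: 2ᴸ bounds the L-th difference and aᴸ/L! the L-th moment.
  -- The second replaces the L lower moments by λᵐ/m!, again at the cost of 2ᵐ each.
  pointX-close : ∀ v L r {a} → j ℕ.≤ k r → scaled r ≤ a → fromℕ j * recip r ≤ 1ℚ →
    recip r * (fromℕ j * fromℕ L) ≤ 1ℚ →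
    ∣ Walk.E r (k r) (pointX v r) - sumTo L (λ m → diff m (point v) 0 * expTerm (rate r) m) ∣ ≤
      expTerm (fromℕ 2 * a) L + newtonError a L * recip r
  pointX-close v L r {a} j≤k scaled≤a jε≤1 jLε≤1 = ∣p-r∣≤a+b
    {E (k r) (pointX v r)} {sumTo L (λ m → diff m (point v) 0 * E (k r) (M m))}
    {sumTo L (λ m → diff m (point v) 0 * expTerm (rate r) m)} truncation (sums L jLε≤1)
    where
    open Walk r
    open Moments r i hiding (rate; survival; j)
    moments : ∀ m → ε * (fromℕ j * fromℕ m) ≤ 1ℚ → ∣ E (k r) (M m) - expTerm (rate r) m ∣ ≤ momentError j a m * ε
    moments m jmε≤1 = subst (λ n → ∣ E n (M m) - expTerm (Moments.rate r i n) m ∣ ≤ momentError j a m * ε)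
      (ℕ.m∸n+n≡m j≤k) (moment-close jε≤1 m (k r ℕ.∸ j)
        (subst (λ n → time n ≤ a) (sym (ℕ.m∸n+n≡m j≤k)) scaled≤a) jmε≤1)
    truncation : ∣ E (k r) (pointX v r) - sumTo L (λ m → diff m (point v) 0 * E (k r) (M m)) ∣ ≤ expTerm (fromℕ 2 * a) L
    truncation = begin
      ∣ E (k r) (pointX v r) - sumTo L (λ m → diff m (point v) 0 * E (k r) (M m)) ∣
        ≡⟨ cong (λ p → ∣ E (k r) (pointX v r) - p ∣) (E-newton r (k r) (point v) L) ⟨
      ∣ E (k r) (pointX v r) - E (k r) (λ q ls → newton (point v) L (X ls)) ∣
        ≤⟨ E-∣-∣ (k r) (pointX v r) (λ q ls → newton (point v) L (X ls)) (λ q ls → fromℕ 2 ^ L * M L q ls)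
             (λ q ls → newton-remainder L (point v) (fromℕ 2 ^ L) (diff-bound (point v) (∣point∣≤1 v) L) (X ls)) ⟩
      E (k r) (λ q ls → fromℕ 2 ^ L * M L q ls)
        ≡⟨ E-*ˡ (k r) (fromℕ 2 ^ L) (M L) ⟩
      fromℕ 2 ^ L * E (k r) (M L)
        ≤⟨ *-monoˡ (^-nonNeg (0≤fromℕ 2) L) (≤-trans (moment-≤ (k r) L) (expTerm-mono (0≤time (k r)) scaled≤a L)) ⟩
      fromℕ 2 ^ L * expTerm a L
        ≡⟨ expTerm-scale (fromℕ 2) a L ⟩
      expTerm (fromℕ 2 * a) L ∎
      where open ≤-Reasoning
    sums : ∀ L → ε * (fromℕ j * fromℕ L) ≤ 1ℚ →
      ∣ sumTo L (λ m → diff m (point v) 0 * E (k r) (M m)) - sumTo L (λ m → diff m (point v) 0 * expTerm (rate r) m) ∣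
        ≤ newtonError a L * ε
    sums zero    _ = ≤-reflexive (sym (*-zeroˡ ε))
    sums (suc L) h = subst₂ (λ p q → ∣ p ∣ ≤ q)
      (lemma S S′ (diff L (point v) 0) (E (k r) (M L)) (expTerm (rate r) L))
      (lemma′ (newtonError a L) ε (fromℕ 2 ^ L) (momentError j a L))
      (∣p+q∣≤a+b {S - S′} {diff L (point v) 0 * (E (k r) (M L) - expTerm (rate r) L)}
        (sums L h′)
        (∣p*q∣≤a*b {diff L (point v) 0} {E (k r) (M L) - expTerm (rate r) L}
          (diff-bound (point v) (∣point∣≤1 v) L 0) (moments L h′)))
      where
      S  = sumTo L (λ m → diff m (point v) 0 * E (k r) (M m))
      S′ = sumTo L (λ m → diff m (point v) 0 * expTerm (rate r) m)
      h′ : ε * (fromℕ j * fromℕ L) ≤ 1ℚ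
      h′ = ≤-trans (*-monoˡ 0≤ε (*-monoˡ (0≤fromℕ j) (fromℕ-mono-≤ (ℕ.n≤1+n L)))) h
      lemma : ∀ s s′ d e t → (s - s′) + d * (e - t) ≡ (s + d * e) - (s′ + d * t)
      lemma = solve-∀ ℚ-ring
      lemma′ : ∀ n e p m → n * e + p * (m * e) ≡ (n + p * m) * e
      lemma′ = solve-∀ ℚ-ring

  -- For m = 0 the weight is a bare indicator, so this bounds the probability that the centre lies
  -- on a cycle of length at most j.
  G-close : ∀ r {a} → j ℕ.≤ k r → scaled r ≤ a → Walk.E r (k r) (Moments.G r i j 0) ≤ triangular j * 1ℚ * recip r
  G-close r {a} j≤k scaled≤a = subst (λ n → E n (G j 0) ≤ triangular j * (0ℚ + 1ℚ) * ε) (ℕ.m+[n∸m]≡n j≤k)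
    (G-≤ j (k r ℕ.∸ j) 0 (subst (λ n → time n ≤ a) (sym (ℕ.m+[n∸m]≡n j≤k)) scaled≤a))
    where
    open Walk r
    open Moments r i hiding (rate; survival; j)

  limitLaw : ℕ → ℕ → ℚ
  limitLaw v r = expTerm (seq ρ r) v * expSum (- seq ρ r) r

  truncated : (ℕ → ℚ) → ℕ → ℕ → ℕ → ℚ
  truncated x v K r = expTerm (x r) v * expSum (- x r) K

  ρ-bounded : Bounded (seq ρ)
  ρ-bounded = bounded-seq ρ

  truncated-≋ : ∀ v K → truncated rate v K ≋ truncated (seq ρ) v K
  truncated-≋ v K = ≋-* (expTerm-bounded ρ-bounded v) (expSum-bounded (bounded-- ρ-bounded) K)
    (expTerm-≋ rate-≋ ρ-bounded v) (expSum-≋ (≋-neg rate-≋) (bounded-- ρ-bounded) K)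

  -- K stays fixed while r grows. One half of η pays for Newton's remainder and the other for the
  -- tail of the exponential series; everything else vanishes with r.
  law-≤ : ∀ v K r {a b η θ} → j ℕ.≤ k r → scaled r ≤ a → fromℕ j * recip r ≤ 1ℚ →
    recip r * (fromℕ j * fromℕ (v ℕ.+ K)) ≤ 1ℚ → expTerm (fromℕ 2 * a) (v ℕ.+ K) ≤ η * ½ →
    ∣ expTerm (seq ρ r) v ∣ ≤ b → b * θ ≤ η * ½ →
    ∣ expSum (- seq ρ r) r - expSum (- seq ρ r) K ∣ ≤ θ →
    ∣ law v r - limitLaw v r ∣ ≤ triangular j * 1ℚ * recip r + newtonError a (v ℕ.+ K) * recip r
      + ∣ truncated rate v K r - truncated (seq ρ) v K r ∣ + η
  law-≤ v K r {a} {b} {η} {θ} j≤k scaled≤a jε≤1 jLε≤1 remainder≤ t≤b bθ≤ tail≤ = begin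
    ∣ law v r - limitLaw v r ∣
      ≤⟨ ∣p-r∣≤a+b {law v r} {Walk.E r (k r) (pointX v r)} {limitLaw v r}
           (≤-trans (law-close v r) (G-close r j≤k scaled≤a))
         (∣p-r∣≤a+b {Walk.E r (k r) (pointX v r)} {truncated rate v K r} {limitLaw v r}
           (≤-trans (subst (λ p → ∣ Walk.E r (k r) (pointX v r) - p ∣ ≤ _) (sumTo-point (rate r) v K)
             (pointX-close v (v ℕ.+ K) r j≤k scaled≤a jε≤1 jLε≤1)) (+-monoˡ-≤ N remainder≤))
         (∣p-r∣≤a+b {truncated rate v K r} {truncated (seq ρ) v K r} {limitLaw v r} ≤-refl tail)) ⟩
    T + (η * ½ + N + (D + η * ½))     ≡⟨ lemma T (η * ½) N D ⟩
    T + N + D + (η * ½ + η * ½)       ≡⟨ cong (_+_ (T + N + D)) (half+half η) ⟩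
    T + N + D + η                     ∎
    where
    open ≤-Reasoning
    T = triangular j * 1ℚ * recip r ; N = newtonError a (v ℕ.+ K) * recip r
    D = ∣ truncated rate v K r - truncated (seq ρ) v K r ∣
    t = expTerm (seq ρ r) v ; e = expSum (- seq ρ r)
    lemma : ∀ t h n d → t + (h + n + (d + h)) ≡ t + n + d + (h + h)
    lemma = solve-∀ ℚ-ring
    tail : ∣ truncated (seq ρ) v K r - limitLaw v r ∣ ≤ η * ½
    tail = ≤-trans (≤-reflexive (cong ∣_∣ (lemma′ t (e K) (e r))))
      (≤-trans (∣p*q∣≤a*b {t} {e K - e r} t≤b (≤-trans (≤-reflexive (∣p-q∣≡∣q-p∣ (e K) (e r))) tail≤)) bθ≤)
      where
      lemma′ : ∀ t a b → t * a - t * b ≡ t * (a - b)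
      lemma′ = solve-∀ ℚ-ring

  law-≋ : ∀ v → law v ≋ limitLaw v
  law-≋ v = null⇒≋ $ null-approx λ η 0<η →
    let a , scaled≤a = scaled-bounded
        b , t≤b = expTerm-bounded ρ-bounded v
        a′ , λ≤a′ = bounded-- ρ-bounded
        -- `Bounded` does not record that its bound is nonnegative, hence the absolute value.
        θ , 0<θ , bθ≤ = shrink {∣ b ∣} (0≤∣p∣ b) (0<½p 0<η)
        K₀ , tail = expTail-small a′ θ 0<θ
        K₁ , remainder = expTerm-small (fromℕ 2 * a) (η * ½) (0<½p 0<η)
        K = K₀ ℕ.⊔ K₁
    in (λ r → triangular j * 1ℚ * recip r + newtonError a (v ℕ.+ K) * recip r
          + ∣ truncated rate v K r - truncated (seq ρ) v K r ∣) ,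
      null-+ (null-+ (null-*recip (triangular j * 1ℚ)) (null-*recip (newtonError a (v ℕ.+ K))))
        (null-∣-∣ (≋⇒null (truncated-≋ v K))) ,
      eventually-map₂
        (eventually-map₂ (eventually-map₂ eventually-j≤k scaled≤a λ _ → _,_)
          (eventually-map₂ (eventually-*recip-≤ (fromℕ j) 1ℚ 0<1) (eventually-*recip-≤ (fromℕ j * fromℕ (v ℕ.+ K)) 1ℚ 0<1) λ _ → _,_) λ _ → _,_)
        (eventually-map₂ (eventually-map₂ t≤b λ≤a′ λ _ → _,_) (eventually-≥ K) λ _ → _,_)
        λ r ((j≤k , s≤a) , (jε≤1 , jLε≤1)) ((t≤b , λ≤a′) , K≤r) →
          law-≤ v K r {a} {∣ b ∣} {η} {θ} j≤k (∣p∣≤b⇒p≤b s≤a) jε≤1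
            (subst (_≤ 1ℚ) (*-comm (fromℕ j * fromℕ (v ℕ.+ K)) (recip r)) jLε≤1)
            (remainder (v ℕ.+ K) (ℕ.≤-trans (ℕ.m≤n⊔m K₀ K₁) (ℕ.m≤n+m K v)))
            (≤-trans t≤b (p≤∣p∣ b)) bθ≤ (tail λ≤a′ K r (ℕ.m≤m⊔n K₀ K₁) K≤r)

  pmf-≋ : ∀ v → law v ≋ seq (poisson ρ v)
  pmf-≋ v = null⇒≋ (null-cong (λ r → cong (λ p → law v r - p) (sym (seq-poisson ρ v r))) (≋⇒null (law-≋ v)))

  cdf-const : ∀ v r n → seq (cdf (cycleLaw (suc (suc i)) r (k r)) v) n ≡ sumTo (suc v) (λ u → law u r)
  cdf-const zero    r n = sym (+-identityˡ (law 0 r))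
  cdf-const (suc v) r n = cong (_+ law (suc v) r) (cdf-const v r n)

  cdf-≋ : ∀ v → (λ r → sumTo (suc v) (λ u → law u r)) ≋ seq (cdf (poisson ρ) v)
  cdf-≋ zero    = null⇒≋ (null-cong (λ r → cong (_- seq (poisson ρ 0) r) (sym (+-identityˡ (law 0 r)))) (≋⇒null (pmf-≋ 0)))
  cdf-≋ (suc v) = ≋-+ (cdf-≋ v) (pmf-≋ (suc v))

  converges : ConvergesInDistribution (λ r → cycleLaw (suc (suc i)) r (k r)) (poisson ρ)
  converges v = ≋⇒⟶ (λ r → cdf (cycleLaw (suc (suc i)) r (k r)) v) (λ r → sumTo (suc v) (λ u → law u r)) (cdf (poisson ρ) v)
    (cdf-const v) (cdf-≋ v)

theorem1p3 : ∀ (j : ℕ) .{{_ : NonZero j}} → 2 ℕ.≤ j →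
    ∀ (c : ℝ) → 0ℝ <ℝ c →
    ∀ (steps : ℕ → ℕ) → (∀ n → IsFloor (c *ℝ fromℚ (fromℕ n)) (steps n)) →
    ConvergesInDistribution
    (λ r → cycleLaw j r (steps (2 +ℕ r)))
    (poisson (fromℚ (+ 1 / j) *ℝ (1ℝ -ℝ exp (-ℝ (fromℚ (fromℕ j) *ℝ c)))))
theorem1p3 (suc zero) (ℕ.s≤s ())
theorem1p3 (suc (suc i)) {{j≢0}} _ c 0<c steps isFloor =
  Law.converges i (λ r → steps (2 +ℕ r)) (eventually-≤k 0<c (suc (suc i))) (bounded-≋ scaled-≋ (bounded-seq c))
    (fromℚ ((+ 1 / suc (suc i)) {{j≢0}}) *ℝ (1ℝ -ℝ exp (-ℝ (fromℚ (fromℕ (suc (suc i))) *ℝ c)))) (rate-≋ i)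
  where open Scaling c (λ r → steps (2 +ℕ r)) (λ r → isFloor (2 +ℕ r))
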